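{- For all integers $t\geq 3$ and $k,\ell\geq 4$: (i) $s_2(C_k,C_\ell)=3$; (ii) $s_2(K_t,C_\ell)=2(t-1)$.
   Context: All graphs are finite and simple. For graphs $H_1,\dots,H_q$, a graph $G$ is $q$-Ramsey for $(H_1,\dots,H_q)$ if every coloring of the edges of $G$ with colors $1,\dots,q$ contains, for some $i\in[q]$, a copy of $H_i$ all of whose edges have color $i$. $G$ is $q$-Ramsey-minimal for $(H_1,\dots,H_q)$ if it is $q$-Ramsey for this tuple but no proper subgraph of $G$ is. $s_q(H_1,\dots,H_q)$ denotes the minimum of the minimum degree $\delta(G)$ over all graphs $G$ that are $q$-Ramsey-minimal for $(H_1,\dots,H_q)$. $C_k$ is the cycle on $k$ vertices and $K_t$ the complete graph on $t$ vertices. -}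

module Defs where

open import Data.Nat using (ℕ; zero; suc; _≤_; _%_)
open import Data.Nat.Properties using () renaming (_≟_ to _≟ℕ_)
open import Data.Fin using (Fin; toℕ; _≟_)
open import Data.Bool using (Bool; true; false; not; _∧_; _∨_)
open import Data.List using (List; filter; length; allFin)
open import Data.Product using (Σ; ∃; _×_)
open import Data.Sum using (_⊎_)
open import Relation.Nullary using (¬_)
open import Relation.Nullary.Decidable using (⌊_⌋)
open import Relation.Binary.PropositionalEquality using (_≡_)
open import Function.Definitions using (Injective)

-- A finite simple graph on vertex set Fin n.  The field E is a raw
-- Boolean relation; adjacency is its symmetric, irreflexive closure,
-- so every value of this record is a simple graph, and every simple
-- graph on Fin n arises (take E = its adjacency).
record Graph : Set where
  field
    n : ℕ
    E : Fin n → Fin n → Bool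

open Graph public

adjB : (G : Graph) → Fin (n G) → Fin (n G) → Bool
adjB G u v = not ⌊ u ≟ v ⌋ ∧ (E G u v ∨ E G v u)

Adj : (G : Graph) → Fin (n G) → Fin (n G) → Set
Adj G u v = adjB G u v ≡ true

deg : (G : Graph) → Fin (n G) → ℕ
deg G u = length (filter (λ v → adjB G u v Data.Bool.≟ true) (allFin (n G)))

MinDegIs : Graph → ℕ → Set
MinDegIs G d = (∀ v → d ≤ deg G v) × ∃ λ v → deg G v ≡ d

IsEmbedding : (H G : Graph) → (Fin (n H) → Fin (n G)) → Set
IsEmbedding H G f = Injective _≡_ _≡_ f × (∀ a b → Adj H a b → Adj G (f a) (f b))

IsProper : (H G : Graph) → (Fin (n H) → Fin (n G)) → Set
IsProper H G f =
  (∃ λ v → ∀ a → ¬ (f a ≡ v)) ⊎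
  (∃ λ u → ∃ λ v → Adj G u v × (∀ a b → Adj H a b → f a ≡ u → f b ≡ v → ⊥'))
  where open import Data.Empty renaming (⊥ to ⊥')

Colouring : ℕ → Graph → Set
Colouring q G = Σ (Fin (n G) → Fin (n G) → Fin q) λ c → ∀ u v → c u v ≡ c v u

MonoCopy : {q : ℕ} (G : Graph) → (Fin (n G) → Fin (n G) → Fin q) → Fin q → Graph → Set
MonoCopy G c i H = Σ (Fin (n H) → Fin (n G)) λ φ →
  Injective _≡_ _≡_ φ ×
  (∀ a b → Adj H a b → Adj G (φ a) (φ b) × c (φ a) (φ b) ≡ i)

IsRamsey : (q : ℕ) → (Fin q → Graph) → Graph → Set
IsRamsey q Hs G = ∀ (col : Colouring q G) → ∃ λ i → MonoCopy G (Data.Product.proj₁ col) i (Hs i)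

IsRamseyMinimal : (q : ℕ) → (Fin q → Graph) → Graph → Set
IsRamseyMinimal q Hs G =
  IsRamsey q Hs G ×
  (∀ (H : Graph) (f : Fin (n H) → Fin (n G)) →
     IsEmbedding H G f → IsProper H G f → ¬ IsRamsey q Hs H)

sIs : (q : ℕ) → (Fin q → Graph) → ℕ → Set
sIs q Hs d =
  (∃ λ G → IsRamseyMinimal q Hs G × MinDegIs G d) ×
  (∀ G → IsRamseyMinimal q Hs G → ∀ v → d ≤ deg G v)

pair : Graph → Graph → Fin 2 → Graph
pair A B Fin.zero = A
pair A B (Fin.suc _) = B
  where import Data.Fin as Fin

-- cycle C_k on vertices 0,...,k-1, with i ~ i+1 mod k  (a cycle for k ≥ 3)
Cycle : ℕ → Graph
Cycle zero = record { n = zero ; E = λ _ _ → false }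
Cycle (suc m) = record { n = suc m ; E = λ i j → ⌊ toℕ j ≟ℕ (suc (toℕ i) % suc m) ⌋ }

Complete : ℕ → Graph
Complete t = record { n = t ; E = λ _ _ → true }

{-# OPTIONS --safe #-}
-- Upper bounds.  A base graph that admits a good colouring gets a new vertex w attached to each of its d-tuples, in
-- such a way that every colouring of the result contains a forbidden copy.  A minimal Ramsey subgraph then contains
-- some w, which has degree at most d.  It is enough that in every colouring of the base without forbidden copies
-- some d-tuple completes one, whatever the colours at w; mostly because any two of its points are ends of suitable
-- monochromatic paths.  Such base graphs come from the partite construction and from Ramsey's theorem.  For two odd
-- cycles a vertex is a pair of number sequences, a red edge interleaving the first and a blue edge the second ones
-- with a delay that excludes short odd cycles, and the paths are found among arithmetic progressions inside a
-- homogeneous set.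
-- Lower bounds.  If v has small degree in a minimal Ramsey graph G, a good colouring of G - v extends to v: one edge
-- at v gets blue and the others red.  For K_t that edge leads to a vertex common to all red cliques of size t - 1
-- among the neighbours of v, which exists by Hajnal's lemma on maximum cliques.
module Submission where

open import Defs
open import Data.Nat using (ℕ; zero; suc; pred; _+_; _*_; _∸_; _≤_; _<_; _⊔_; z≤n; s≤s; _%_; >-nonZero)
import Data.Nat as ℕ
open import Data.Nat.Properties
open import Data.Nat.DivMod using (_mod_; m<n⇒m%n≡m; n%n≡0; m%n<n)
open import Data.Nat.Tactic.RingSolver using (solve-∀)
open import Data.Fin using (Fin; zero; suc; toℕ; fromℕ<; splitAt; join; remQuot; combine; punchIn; punchOut)
import Data.Fin as Fin
import Data.Fin.Properties as Fin
open import Data.Fin.Subset using (Subset; ∣_∣; _∩_; _∪_)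
open import Data.Bool using (Bool; true; false; not; _∧_; _∨_; if_then_else_)
import Data.Bool.Properties as Bool
open import Data.List using (List; []; _∷_; map; filter; length; allFin; applyUpTo; lookup; cartesianProduct)
import Data.List.Properties as List
open import Data.List.Membership.Propositional using (_∈_)
import Data.List.Membership.Propositional.Properties as Mem
open import Data.List.Relation.Unary.Any using (Any; here; there)
import Data.List.Relation.Unary.Any as Any
open import Data.List.Relation.Unary.All using (All; []; _∷_)
import Data.List.Relation.Unary.All as All
open import Data.List.Relation.Unary.AllPairs using ([]; _∷_)
open import Data.List.Relation.Unary.Unique.Propositional using (Unique)
import Data.List.Relation.Unary.Unique.Propositional.Properties as Unique
open import Data.List.Relation.Binary.Sublist.Propositional using (_⊆_; []; _∷_; _∷ʳ_; minimum; ⊆-refl; ⊆-trans)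
open import Data.Vec using (Vec; []; _∷_; tabulate)
import Data.Vec as Vec
import Data.Vec.Properties as Vec
open import Data.Product using (∃; _×_; _,_; proj₁; proj₂; Σ-syntax; ∃-syntax; ∃₂; uncurry)
open import Data.Sum using (_⊎_; inj₁; inj₂; [_,_]′)
import Data.Sum as Sum
open import Data.Sum.Properties using (inj₁-injective; inj₂-injective)
open import Data.Empty using (⊥; ⊥-elim)
open import Data.Unit using (⊤; tt)
open import Function using (_∘_; id; case_of_)
open import Function.Definitions using (Injective)
open import Relation.Nullary using (¬_; Dec; yes; no; contradiction)
open import Relation.Nullary.Decidable using (⌊_⌋; map′; _×-dec_; _⊎-dec_; _→-dec_; ¬?; decidable-stable)
open import Relation.Binary.PropositionalEquality using (_≡_; _≢_; refl; sym; trans; cong; cong₂; subst; subst₂)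
open import Relation.Binary.Definitions using (DecidableEquality; tri<; tri≈; tri>)

-- The obstacle: the base must avoid both forbidden graphs in its good colouring and still contain
-- paths that one more vertex turns into forbidden cycles. For an even cycle this conflicts with
-- Ramsey arguments, since a monochromatic blown-up pair of parts already contains it. Even cycles
-- are therefore found either there or by alternating between base points and attached vertices, and
-- their colour is absent from the good colouring. Odd cycles can be excluded by a bound on the odd
-- girth (or by bipartiteness) while paths two edges shorter join all chosen points. The value 3
-- comes from the pigeonhole principle: of three edges at `w` two agree in colour. The value
-- `2(t-1)` comes from `t-1` classes with two points each: if no class has both its edges to `w`
-- blue, a red one can be chosen in each class, and with `w` they give a `K_t`; only `K_3` with an
-- odd cycle is treated through four parts with one point each. From below it is the bound in
-- Hajnal's lemma: the intersection and the union of the cliques of maximum size `t-1` have together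
-- at least `2(t-1)` vertices, so with fewer neighbours the intersection is not empty.

-- A retraction onto Fin size suffices for exhaustive search, and needs no function extensionality.
record Finite (A : Set) : Set where
  field
    size    : ℕ
    enc     : A → Fin size
    dec     : Fin size → A
    dec∘enc : ∀ a → dec (enc a) ≡ a

open Finite

module _ {A : Set} (F : Finite A) where

  enc-injective : ∀ {a b} → enc F a ≡ enc F b → a ≡ b
  enc-injective {a} {b} e = trans (sym (dec∘enc F a)) (trans (cong (dec F) e) (dec∘enc F b))

  ≟-finite : DecidableEquality A
  ≟-finite a b = map′ enc-injective (cong (enc F)) (enc F a Fin.≟ enc F b)

  any-finite? : {P : A → Set} → (∀ a → Dec (P a)) → Dec (∃ P)
  any-finite? {P} P? = map′ (λ (i , p) → dec F i , p)
    (λ (a , p) → enc F a , subst P (sym (dec∘enc F a)) p) (Fin.any? (P? ∘ dec F))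

  all-finite? : {P : A → Set} → (∀ a → Dec (P a)) → Dec (∀ a → P a)
  all-finite? {P} P? = map′ (λ p a → subst P (dec∘enc F a) (p (enc F a)))
    (λ p i → p (dec F i)) (Fin.all? (P? ∘ dec F))

  elements : List A
  elements = map (dec F) (allFin (size F))

  ∈-elements : ∀ a → a ∈ elements
  ∈-elements a = subst (_∈ elements) (dec∘enc F a) (Mem.∈-map⁺ (dec F) (Mem.∈-allFin (enc F a)))

finite-retract : {A B : Set} → Finite B → (f : A → B) (g : B → A) → (∀ a → g (f a) ≡ a) → Finite A
finite-retract F f g e = record { size = size F ; enc = enc F ∘ f ; dec = g ∘ dec F
  ; dec∘enc = λ a → trans (cong g (dec∘enc F (f a))) (e a) }

finite-Fin : ∀ n → Finite (Fin n)
finite-Fin n = record { size = n ; enc = id ; dec = id ; dec∘enc = λ _ → refl }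

finite-Bool : Finite Bool
finite-Bool = record { size = 2 ; enc = λ { true → zero ; false → suc zero }
  ; dec = λ { zero → true ; (suc _) → false } ; dec∘enc = λ { true → refl ; false → refl } }

finite-⊎ : {A B : Set} → Finite A → Finite B → Finite (A ⊎ B)
finite-⊎ FA FB = record { size = size FA + size FB
  ; enc = λ x → join _ _ (Sum.map (enc FA) (enc FB) x)
  ; dec = λ i → Sum.map (dec FA) (dec FB) (splitAt (size FA) i)
  ; dec∘enc = λ { (inj₁ a) → trans (cong (Sum.map _ _) (Fin.splitAt-↑ˡ _ (enc FA a) _)) (cong inj₁ (dec∘enc FA a))
                ; (inj₂ b) → trans (cong (Sum.map _ _) (Fin.splitAt-↑ʳ (size FA) _ (enc FB b))) (cong inj₂ (dec∘enc FB b)) } }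

finite-× : {A B : Set} → Finite A → Finite B → Finite (A × B)
finite-× FA FB = record { size = size FA * size FB
  ; enc = λ (a , b) → combine (enc FA a) (enc FB b)
  ; dec = λ i → dec FA (proj₁ (remQuot (size FB) i)) , dec FB (proj₂ (remQuot {size FA} (size FB) i))
  ; dec∘enc = λ (a , b) → cong₂ _,_
      (trans (cong (dec FA ∘ proj₁) (Fin.remQuot-combine (enc FA a) (enc FB b))) (dec∘enc FA a))
      (trans (cong (dec FB ∘ proj₂) (Fin.remQuot-combine (enc FA a) (enc FB b))) (dec∘enc FB b)) }

finite-Vec : {A : Set} → Finite A → ∀ n → Finite (Vec A n)
finite-Vec F zero = record { size = 1 ; enc = λ _ → zero ; dec = λ _ → [] ; dec∘enc = λ { [] → refl } }
finite-Vec F (suc n) = finite-retract (finite-× F (finite-Vec F n))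
  (λ { (a ∷ v) → a , v }) (λ (a , v) → a ∷ v) (λ { (_ ∷ _) → refl })

-- Ramsey's theorem for lists

Homogeneous : {A : Set} → ℕ → (List A → Bool) → List A → Bool → Set
Homogeneous u c ys κ = ∀ zs → zs ⊆ ys → length zs ≡ u → c zs ≡ κ

EndHomogeneous : {A : Set} → ℕ → (List A → Bool) → List A → Set
EndHomogeneous u c []       = ⊤
EndHomogeneous u c (y ∷ ys) = (∃[ κ ] Homogeneous u (c ∘ (y ∷_)) ys κ) × EndHomogeneous u c ys

homogeneous-⊆ : ∀ {A : Set} {u c} {xs ys : List A} {κ} → xs ⊆ ys → Homogeneous u c ys κ → Homogeneous u c xs κ
homogeneous-⊆ s H zs zs⊆ = H zs (⊆-trans zs⊆ s)

homogeneous-[] : ∀ {A : Set} {u} {c : List A → Bool} {κ} → Homogeneous (suc u) c [] κ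
homogeneous-[] [] _ ()
homogeneous-[] (_ ∷ _) ()

homogeneous-∷ : ∀ {A : Set} {u} {c : List A → Bool} {y ys κ} →
  Homogeneous u (c ∘ (y ∷_)) ys κ → Homogeneous (suc u) c ys κ → Homogeneous (suc u) c (y ∷ ys) κ
homogeneous-∷ H K zs (y ∷ʳ s) e = K zs s e
homogeneous-∷ H K (_ ∷ zs) (refl ∷ s) e = H zs s (suc-injective e)

-- Each entry fixes one colour for all sublists that begin with it. Sorting the entries by that
-- colour leaves two homogeneous sublists, one of which has at least half of the entries.
split-colours : ∀ {A : Set} u (c : List A → Bool) ys → EndHomogeneous u c ys →
  ∃₂ λ as bs → as ⊆ ys × bs ⊆ ys × length as + length bs ≡ length ys ×
    Homogeneous (suc u) c as true × Homogeneous (suc u) c bs false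
split-colours u c [] _ = [] , [] , [] , [] , refl , homogeneous-[] , homogeneous-[]
split-colours u c (y ∷ ys) ((true , H) , E) with split-colours u c ys E
... | as , bs , sa , sb , e , Ha , Hb =
  y ∷ as , bs , refl ∷ sa , y ∷ʳ sb , cong suc e , homogeneous-∷ (homogeneous-⊆ sa H) Ha , Hb
split-colours u c (y ∷ ys) ((false , H) , E) with split-colours u c ys E
... | as , bs , sa , sb , e , Ha , Hb =
  as , y ∷ bs , y ∷ʳ sa , refl ∷ sb , trans (+-suc (length as) _) (cong suc e) , Ha , homogeneous-∷ (homogeneous-⊆ sb H) Hb

RamseyNumber : ℕ → ℕ → ℕ → Set₁
RamseyNumber u L N = ∀ {A : Set} (xs : List A) → N ≤ length xs → (c : List A → Bool) →
  ∃[ ys ] ys ⊆ xs × L ≤ length ys × ∃[ κ ] Homogeneous u c ys κ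

EndRamseyNumber : ℕ → ℕ → ℕ → Set₁
EndRamseyNumber u L N = ∀ {A : Set} (xs : List A) → N ≤ length xs → (c : List A → Bool) →
  ∃[ ys ] ys ⊆ xs × L ≤ length ys × EndHomogeneous u c ys

-- The head `x` is kept, Ramsey's theorem for `u`-sublists is applied to the tail with the colouring
-- `c ∘ (x ∷_)`, and the recursion goes on inside the homogeneous part, where the property of `x`
-- survives.
endRamsey : ∀ {u} → (∀ L → ∃ (RamseyNumber u L)) → ∀ L → ∃ (EndRamseyNumber u L)
endRamsey R zero = 0 , λ xs _ c → [] , minimum xs , z≤n , tt
endRamsey {u} R (suc L) with endRamsey R L
... | N₁ , E with R N₁
... | N₂ , F = suc N₂ , go
  where
  go : EndRamseyNumber u (suc L) (suc N₂)
  go (x ∷ xs) (s≤s p) c with F xs p (c ∘ (x ∷_))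
  ... | ys , ys⊆ , q , κ , H with E ys q c
  ... | zs , zs⊆ , r , K = x ∷ zs , refl ∷ ⊆-trans zs⊆ ys⊆ , s≤s r , (κ , homogeneous-⊆ zs⊆ H) , K

ramsey : ∀ u L → ∃ (RamseyNumber u L)
ramsey zero L = L , λ xs p c → xs , ⊆-refl , p , c [] , λ { [] _ _ → refl ; (_ ∷ _) _ () }
ramsey (suc u) L with endRamsey (ramsey u) (L + L)
... | N , E = N , go
  where
  go : RamseyNumber (suc u) L N
  go xs p c with E xs p c
  ... | ys , ys⊆ , q , K with split-colours u c ys K
  ... | as , bs , sa , sb , e , Ha , Hb with L ≤? length as
  ... | yes r = as , ⊆-trans sa ys⊆ , r , true , Ha
  ... | no r = bs , ⊆-trans sb ys⊆ , ≮⇒≥ (λ b< → <⇒≱ (+-mono-< (≰⇒> r) b<) (subst (L + L ≤_) (sym e) q)) , false , Hb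

ramsey-family : ∀ u r L → ∃[ N ] (∀ {A : Set} (xs : List A) → N ≤ length xs → (c : Fin r → List A → Bool) →
  ∃[ ys ] ys ⊆ xs × L ≤ length ys × Σ[ κ ∈ (Fin r → Bool) ] (∀ i → Homogeneous u (c i) ys (κ i)))
ramsey-family u zero L = L , λ xs p c → xs , ⊆-refl , p , (λ ()) , λ ()
ramsey-family u (suc r) L with ramsey-family u r L
... | N₁ , F with ramsey u N₁
... | N₂ , G = N₂ , λ xs p c →
  let ys , ys⊆ , q , κ , H = G xs p (c zero)
      zs , zs⊆ , q′ , κ′ , H′ = F ys q (c ∘ suc)
  in zs , ⊆-trans zs⊆ ys⊆ , q′ , (λ { zero → κ ; (suc i) → κ′ i }) ,
     λ { zero → homogeneous-⊆ zs⊆ H ; (suc i) → H′ i }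

-- Ramsey's theorem for increasing sequences of numbers

Increasing : ℕ → (ℕ → ℕ) → Set
Increasing u f = ∀ j → suc j < u → f j < f (suc j)

-- If `f 0` is 0 the heads match, otherwise the head `g 0` is skipped; either way the remaining
-- indices are positive and can be lowered by one.
applyUpTo-⊆ : ∀ {A : Set} (F g : ℕ → A) (f : ℕ → ℕ) u L → (∀ j → j < u → F j ≡ g (f j)) →
  Increasing u f → (∀ j → j < u → f j < L) → applyUpTo F u ⊆ applyUpTo g L
applyUpTo-⊆ F g f zero L e inc bd = minimum _
applyUpTo-⊆ F g f (suc u) zero e inc bd = contradiction (bd 0 (s≤s z≤n)) λ ()
applyUpTo-⊆ F g f (suc u) (suc L) e inc bd with f 0 in f0
... | zero = trans (e 0 (s≤s z≤n)) (cong g f0) ∷ applyUpTo-⊆ (F ∘ suc) (g ∘ suc) (pred ∘ f ∘ suc) u L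
  (λ j p → trans (e (suc j) (s≤s p)) (cong g (sym (suc-pred _ {{>-nonZero (pos j p)}}))))
  (λ j p → pred-mono-< {{>-nonZero (pos j (<-trans (n<1+n j) p))}} (inc (suc j) (s≤s p)))
  (λ j p → ≤-pred (subst (_< suc L) (sym (suc-pred _ {{>-nonZero (pos j p)}})) (bd (suc j) (s≤s p))))
  where
  pos : ∀ j → j < u → 0 < f (suc j)
  pos zero p = subst (_< f 1) f0 (inc 0 (s≤s p))
  pos (suc j) p = <-trans (pos j (<-trans (n<1+n j) p)) (inc (suc j) (s≤s p))
... | suc m = g 0 ∷ʳ applyUpTo-⊆ F (g ∘ suc) (pred ∘ f) (suc u) L
  (λ j p → trans (e j p) (cong g (sym (suc-pred _ {{>-nonZero (pos j p)}}))))
  (λ j p → pred-mono-< {{>-nonZero (pos j (<-trans (n<1+n j) p))}} (inc j p))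
  (λ j p → ≤-pred (subst (_< suc L) (sym (suc-pred _ {{>-nonZero (pos j p)}})) (bd j p)))
  where
  pos : ∀ j → j < suc u → 0 < f j
  pos zero p = subst (0 <_) (sym f0) (s≤s z≤n)
  pos (suc j) p = <-trans (pos j (<-trans (n<1+n j) p)) (inc j p)

-- nth is only meant for indices below the length; elsewhere it is 0
nth : List ℕ → ℕ → ℕ
nth []       _       = 0
nth (x ∷ xs) zero    = x
nth (x ∷ xs) (suc j) = nth xs j

nth-applyUpTo : ∀ f u j → j < u → nth (applyUpTo f u) j ≡ f j
nth-applyUpTo f (suc u) zero    p       = refl
nth-applyUpTo f (suc u) (suc j) (s≤s p) = nth-applyUpTo (f ∘ suc) u j p

applyUpTo-nth : ∀ ys → applyUpTo (nth ys) (length ys) ≡ ys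
applyUpTo-nth []       = refl
applyUpTo-nth (y ∷ ys) = cong (y ∷_) (applyUpTo-nth ys)

applyUpTo-cong : ∀ {A : Set} n {f g : ℕ → A} → (∀ i → f i ≡ g i) → applyUpTo f n ≡ applyUpTo g n
applyUpTo-cong zero    e = refl
applyUpTo-cong (suc n) e = cong₂ _∷_ (e 0) (applyUpTo-cong n (e ∘ suc))

nth-⊆-upTo : ∀ ys o n → ys ⊆ applyUpTo (o +_) n →
  (∀ j → j < length ys → o ≤ nth ys j × nth ys j < o + n) × (∀ i j → i < j → j < length ys → nth ys i < nth ys j)
nth-⊆-upTo [] o n s = (λ _ ()) , λ _ _ _ ()
nth-⊆-upTo (y ∷ ys) o zero ()
nth-⊆-upTo (y ∷ ys) o (suc n) (_ ∷ʳ s)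
  with B , M ← nth-⊆-upTo (y ∷ ys) (suc o) n (subst ((y ∷ ys) ⊆_) (applyUpTo-cong n (+-suc o)) s) =
  (λ j p → ≤-trans (n≤1+n o) (proj₁ (B j p)) , subst (nth (y ∷ ys) j <_) (sym (+-suc o n)) (proj₂ (B j p))) , M
nth-⊆-upTo (y ∷ ys) o (suc n) (refl ∷ s)
  with B , M ← nth-⊆-upTo ys (suc o) n (subst (ys ⊆_) (applyUpTo-cong n (+-suc o)) s) = bound , mono
  where
  bound : ∀ j → j < suc (length ys) → o ≤ nth (y ∷ ys) j × nth (y ∷ ys) j < o + suc n
  bound zero p = m≤m+n o 0 , +-monoʳ-< o (s≤s z≤n)
  bound (suc j) (s≤s p) = ≤-trans (n≤1+n o) (proj₁ (B j p)) , subst (nth ys j <_) (sym (+-suc o n)) (proj₂ (B j p))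
  mono : ∀ i j → i < j → j < suc (length ys) → nth (y ∷ ys) i < nth (y ∷ ys) j
  mono zero (suc j) q (s≤s p) = subst (_< nth ys j) (sym (+-identityʳ o)) (proj₁ (B j p))
  mono (suc i) (suc j) (s≤s q) (s≤s p) = M i j q p

module RamseyNumbers where
  abstract
    -- The form for applications: a tuple is given by increasing indices `f` into one homogeneous
    -- sequence `h`, so tuples with prescribed overlaps are written down by arithmetic with indices.
    ramsey-increasing : ∀ u r L → ∃[ N ] (∀ (c : Fin r → List ℕ → Bool) → Σ[ h ∈ (ℕ → ℕ) ]
      (∀ i j → i < j → j < L → h i < h j) × (∀ j → j < L → h j < N) ×
      Σ[ κ ∈ (Fin r → Bool) ] (∀ i f → Increasing u f → (∀ j → j < u → f j < L) → c i (applyUpTo (h ∘ f) u) ≡ κ i))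
    ramsey-increasing u r L with ramsey-family u r L
    ... | N , F = N , λ c →
      let ys , ys⊆ , q , κ , H = F (applyUpTo id N) (≤-reflexive (sym (List.length-applyUpTo id N))) c
          B , M = nth-⊆-upTo ys 0 N ys⊆
      in nth ys , (λ i j i<j j<L → M i j i<j (<-≤-trans j<L q)) , (λ j p → proj₂ (B j (<-≤-trans p q))) , κ ,
         λ i f inc bd → H i _ (subst (applyUpTo (nth ys ∘ f) u ⊆_) (applyUpTo-nth ys)
           (applyUpTo-⊆ (nth ys ∘ f) (nth ys) f u (length ys) (λ _ _ → refl) inc (λ j p → <-≤-trans (bd j p) q)))
           (List.length-applyUpTo (nth ys ∘ f) u)

open RamseyNumbers

-- Graphs, copies and decidability of the Ramsey property

module _ (G : Graph) where

  adj-intro : ∀ {u v} → u ≢ v → E G u v ≡ true ⊎ E G v u ≡ true → Adj G u v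
  adj-intro {u} {v} u≢v e with u Fin.≟ v
  ... | yes u≡v = contradiction u≡v u≢v
  adj-intro {u} {v} u≢v (inj₁ e) | no _ = cong (_∨ E G v u) e
  adj-intro {u} {v} u≢v (inj₂ e) | no _ = trans (cong (E G u v ∨_) e) (Bool.∨-zeroʳ (E G u v))

  adj-elim : ∀ {u v} → Adj G u v → u ≢ v × (E G u v ≡ true ⊎ E G v u ≡ true)
  adj-elim {u} {v} a with u Fin.≟ v | E G u v in e
  ... | no u≢v | true  = u≢v , inj₁ refl
  ... | no u≢v | false = u≢v , inj₂ a

  adj-sym : ∀ {u v} → Adj G u v → Adj G v u
  adj-sym a with u≢v , e ← adj-elim a = adj-intro (u≢v ∘ sym) (Sum.swap e)

  adj-irrefl : ∀ {u} → ¬ Adj G u u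
  adj-irrefl a = proj₁ (adj-elim a) refl

  adj? : ∀ u v → Dec (Adj G u v)
  adj? u v = adjB G u v Bool.≟ true

record Copy (H : Graph) {V : Set} (R : V → V → Set) : Set where
  constructor copy
  field
    vertex    : Fin (n H) → V
    injective : Injective _≡_ _≡_ vertex
    edge      : ∀ a b → Adj H a b → R (vertex a) (vertex b)

Coloured : ∀ {q} (G : Graph) → (Fin (n G) → Fin (n G) → Fin q) → Fin q → Fin (n G) → Fin (n G) → Set
Coloured G c i u v = Adj G u v × c u v ≡ i

fromMonoCopy : ∀ {q} G c {i : Fin q} {H} → MonoCopy G c i H → Copy H (Coloured G c i)
fromMonoCopy G c (φ , inj , e) = copy φ inj e

toMonoCopy : ∀ {q} G c {i : Fin q} {H} → Copy H (Coloured G c i) → MonoCopy G c i H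
toMonoCopy G c (copy φ inj e) = φ , inj , e

copy-map : ∀ {H} {V W : Set} {R : V → V → Set} {S : W → W → Set} (f : V → W) → Injective _≡_ _≡_ f →
  (∀ u v → R u v → S (f u) (f v)) → Copy H R → Copy H S
copy-map f inj rs (copy φ φ-inj φ-adj) = copy (f ∘ φ) (φ-inj ∘ inj) (λ a b e → rs _ _ (φ-adj a b e))

copy-mono : ∀ {H} {V : Set} {R S : V → V → Set} → (∀ u v → R u v → S u v) → Copy H R → Copy H S
copy-mono = copy-map id id

module _ {V : Set} (F : Finite V) where

  -- The search runs over vectors, because vertex maps can be enumerated only up to pointwise
  -- equality; a copy depends on the values of its map alone.
  copy? : ∀ H {R : V → V → Set} → (∀ u v → Dec (R u v)) → Dec (Copy H R)
  copy? H {R} R? = map′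
    (λ (t , inj , adj) → copy (Vec.lookup t) (λ {a} {b} → inj a b) adj)
    (λ (copy φ inj adj) → tabulate φ ,
      (λ a b e → inj (trans (sym (Vec.lookup∘tabulate φ a)) (trans e (Vec.lookup∘tabulate φ b)))) ,
      (λ a b e → subst₂ R (sym (Vec.lookup∘tabulate φ a)) (sym (Vec.lookup∘tabulate φ b)) (adj a b e)))
    (any-finite? (finite-Vec F (n H)) λ t →
      Fin.all? (λ a → Fin.all? λ b → ≟-finite F (Vec.lookup t a) (Vec.lookup t b) →-dec (a Fin.≟ b)) ×-dec
      Fin.all? (λ a → Fin.all? λ b → adj? H a b →-dec R? (Vec.lookup t a) (Vec.lookup t b)))

symmetrize : ∀ {m} {A : Set} → (Fin m → Fin m → A) → Fin m → Fin m → A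
symmetrize T u v = if ⌊ u Fin.≤? v ⌋ then T u v else T v u

symmetrize-sym : ∀ {m} {A : Set} (T : Fin m → Fin m → A) u v → symmetrize T u v ≡ symmetrize T v u
symmetrize-sym T u v with u Fin.≤? v | v Fin.≤? u
... | yes p | yes q = cong₂ T (Fin.≤-antisym p q) (Fin.≤-antisym q p)
... | yes p | no q  = refl
... | no p  | yes q = refl
... | no p  | no q  = contradiction (≰⇒≥ p) q

abstract
 -- Finitely many tables suffice: a table is made symmetric by reading its entries with `u ≤ v`, and
 -- every symmetric colouring agrees pointwise with what its own table yields.
 ramsey? : ∀ q (Hs : Fin q → Graph) G → Dec (IsRamsey q Hs G)
 ramsey? q Hs G = map′ to from (all-finite? (finite-Vec (finite-Vec (finite-Fin q) (n G)) (n G)) λ T →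
     Fin.any? λ i → copy? (finite-Fin (n G)) (Hs i) λ u v → adj? G u v ×-dec (colour T u v Fin.≟ i))
   where
   colour : Vec (Vec (Fin q) (n G)) (n G) → Fin (n G) → Fin (n G) → Fin q
   colour T = symmetrize (λ u v → Vec.lookup (Vec.lookup T u) v)
   to : (∀ T → ∃ λ i → Copy (Hs i) (Coloured G (colour T) i)) → IsRamsey q Hs G
   to f (c , s) with i , cp ← f (tabulate (λ u → tabulate (c u))) =
     i , toMonoCopy G c (copy-mono (λ u v (a , e) → a , trans (sym (same u v)) e) cp)
     where
     same : ∀ u v → colour (tabulate (λ u → tabulate (c u))) u v ≡ c u v
     same u v with u Fin.≤? v
     ... | yes _ = trans (cong (λ r → Vec.lookup r v) (Vec.lookup∘tabulate _ u)) (Vec.lookup∘tabulate (c u) v)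
     ... | no _ = trans (trans (cong (λ r → Vec.lookup r u) (Vec.lookup∘tabulate _ v)) (Vec.lookup∘tabulate (c v) u)) (s v u)
   from : IsRamsey q Hs G → ∀ T → ∃ λ i → Copy (Hs i) (Coloured G (colour T) i)
   from R T with i , cp ← R (colour T , symmetrize-sym _) = i , fromMonoCopy G (colour T) cp

ramsey-embedding : ∀ {q} (Hs : Fin q → Graph) G G′ (f : Fin (n G) → Fin (n G′)) → IsEmbedding G G′ f → IsRamsey q Hs G → IsRamsey q Hs G′
ramsey-embedding Hs G G′ f (inj , adj) R (c , s)
  with i , cp ← R ((λ u v → c (f u) (f v)) , λ u v → s (f u) (f v)) =
  i , toMonoCopy G′ c (copy-map f inj (λ u v (a , e) → adj u v a , e) (fromMonoCopy G (λ u v → c (f u) (f v)) {H = Hs i} cp))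

-- Minimal Ramsey subgraphs

deleteVertex : ∀ {m} → (Fin (suc m) → Fin (suc m) → Bool) → Fin (suc m) → Graph
deleteVertex {m} E v = record { n = m ; E = λ a b → E (punchIn v a) (punchIn v b) }

deleteVertex-adj : ∀ {m} (E : Fin (suc m) → Fin (suc m) → Bool) v {a b} →
  Adj (deleteVertex E v) a b → Adj (record { n = suc m ; E = E }) (punchIn v a) (punchIn v b)
deleteVertex-adj E v {a} {b} e with a≢b , e′ ← adj-elim (deleteVertex E v) e =
  adj-intro (record { n = _ ; E = E }) (a≢b ∘ Fin.punchIn-injective v a b) e′

deleteVertex-adj⁻ : ∀ {m} (E : Fin (suc m) → Fin (suc m) → Bool) v {a b} →
  Adj (record { n = suc m ; E = E }) (punchIn v a) (punchIn v b) → Adj (deleteVertex E v) a b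
deleteVertex-adj⁻ E v {a} {b} e with a≢b , e′ ← adj-elim (record { n = _ ; E = E }) e =
  adj-intro (deleteVertex E v) (a≢b ∘ cong (punchIn v)) e′

deleteEdge : (G : Graph) (u v : Fin (n G)) → Graph
deleteEdge G u v = record { n = n G ; E = λ a b → ⌊ adj? G a b ×-dec ¬? ((a Fin.≟ u ×-dec b Fin.≟ v) ⊎-dec (a Fin.≟ v ×-dec b Fin.≟ u)) ⌋ }

does⇒ : ∀ {P : Set} (P? : Dec P) → ⌊ P? ⌋ ≡ true → P
does⇒ (yes p) _ = p

⇒does : ∀ {P : Set} (P? : Dec P) → P → ⌊ P? ⌋ ≡ true
⇒does (yes _) _ = refl
⇒does (no ¬p) p = contradiction p ¬p

⇒¬does : ∀ {P : Set} (P? : Dec P) → ¬ P → ⌊ P? ⌋ ≡ false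
⇒¬does (yes p) ¬p = contradiction p ¬p
⇒¬does (no _)  _  = refl

deleteEdge-adj : ∀ G u v {a b} → Adj (deleteEdge G u v) a b → Adj G a b × ¬ (a ≡ u × b ≡ v)
deleteEdge-adj G u v {a} {b} e with adj-elim (deleteEdge G u v) e
... | _ , inj₁ e′ = let p , q = does⇒ (adj? G a b ×-dec _) e′ in p , q ∘ inj₁
... | _ , inj₂ e′ = let p , q = does⇒ (adj? G b a ×-dec _) e′ in adj-sym G p , λ (x , y) → q (inj₂ (y , x))

deleteEdge-adj⁻ : ∀ G u v {a b} → Adj G a b → ¬ (a ≡ u × b ≡ v) → ¬ (a ≡ v × b ≡ u) → Adj (deleteEdge G u v) a b
deleteEdge-adj⁻ G u v {a} {b} e p q = adj-intro (deleteEdge G u v) (proj₁ (adj-elim G e))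
  (inj₁ (⇒does (adj? G a b ×-dec _) (e , [ p , q ]′)))

module _ {A : Set} {P Q : A → Set} (P? : ∀ a → Dec (P a)) (Q? : ∀ a → Dec (Q a)) (P⇒Q : ∀ {a} → P a → Q a) where

  length-filter-≤ : ∀ xs → length (filter P? xs) ≤ length (filter Q? xs)
  length-filter-≤ [] = z≤n
  length-filter-≤ (x ∷ xs) with P? x | Q? x
  ... | yes p | yes q = s≤s (length-filter-≤ xs)
  ... | yes p | no ¬q = contradiction (P⇒Q p) ¬q
  ... | no ¬p | yes q = m≤n⇒m≤1+n (length-filter-≤ xs)
  ... | no ¬p | no ¬q = length-filter-≤ xs

  length-filter-< : ∀ {x xs} → x ∈ xs → ¬ P x → Q x → length (filter P? xs) < length (filter Q? xs)
  length-filter-< {x} {y ∷ xs} (here refl) ¬p q with P? x | Q? x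
  ... | yes p | _     = contradiction p ¬p
  ... | no _  | no ¬q = contradiction q ¬q
  ... | no _  | yes _ = s≤s (length-filter-≤ xs)
  length-filter-< {x} {y ∷ xs} (there m) ¬p q with P? y | Q? y
  ... | yes p | yes _ = s≤s (length-filter-< m ¬p q)
  ... | yes p | no ¬q = contradiction (P⇒Q p) ¬q
  ... | no _  | yes _ = m≤n⇒m≤1+n (length-filter-< m ¬p q)
  ... | no _  | no _  = length-filter-< m ¬p q

pairs : ∀ m → List (Fin m × Fin m)
pairs m = cartesianProduct (allFin m) (allFin m)

size₂ : Graph → ℕ
size₂ G = length (filter (uncurry (adj? G)) (pairs (n G)))

deleteEdge-size₂ : ∀ G u v → Adj G u v → size₂ (deleteEdge G u v) < size₂ G
deleteEdge-size₂ G u v e = length-filter-< (uncurry (adj? (deleteEdge G u v))) (uncurry (adj? G))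
  (λ {(a , b)} x → proj₁ (deleteEdge-adj G u v {a} {b} x))
  (Mem.∈-cartesianProduct⁺ (Mem.∈-allFin u) (Mem.∈-allFin v)) (λ x → proj₂ (deleteEdge-adj G u v {u} {v} x) (refl , refl)) e

embedding-refl : ∀ G → IsEmbedding G G id
embedding-refl G = id , λ _ _ → id

embedding-trans : ∀ G₁ G₂ G₃ {f g} → IsEmbedding G₁ G₂ f → IsEmbedding G₂ G₃ g → IsEmbedding G₁ G₃ (g ∘ f)
embedding-trans _ _ _ (i , a) (j , b) = i ∘ j , λ u v e → b _ _ (a u v e)

deleteVertex-embedding : ∀ {m} (E : Fin (suc m) → Fin (suc m) → Bool) v →
  IsEmbedding (deleteVertex E v) (record { n = suc m ; E = E }) (punchIn v)
deleteVertex-embedding E v = (λ {a} {b} → Fin.punchIn-injective v a b) , λ a b → deleteVertex-adj E v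

module _ {q : ℕ} {Hs : Fin q → Graph} where

  private
    no-vertices : ∀ G → n G ≡ 0 → IsRamsey q Hs G → IsRamseyMinimal q Hs G
    no-vertices _ refl R = R , λ { H f emb (inj₁ (() , _)) _ ; H f emb (inj₂ (() , _)) _ }

  -- A proper embedding misses a vertex or an edge of `G`, so it factors through a single deletion,
  -- to which the Ramsey property would be passed on.
  locally-minimal : ∀ {m} (E : Fin (suc m) → Fin (suc m) → Bool) → let G = record { n = suc m ; E = E } in
    (∀ v → ¬ IsRamsey q Hs (deleteVertex E v)) → (∀ u v → Adj G u v → ¬ IsRamsey q Hs (deleteEdge G u v)) →
    IsRamsey q Hs G → IsRamseyMinimal q Hs G
  locally-minimal {m} E noV noE R = R , minimal
    where
    G = record { n = suc m ; E = E }
    minimal : ∀ H f → IsEmbedding H G f → IsProper H G f → ¬ IsRamsey q Hs H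
    minimal H f (inj , adj) (inj₁ (v , miss)) RH = noV v (ramsey-embedding Hs H (deleteVertex E v) f′ emb RH)
      where
      f′ : Fin (n H) → Fin m
      f′ a = punchOut {i = v} {f a} (miss a ∘ sym)
      back : ∀ a → punchIn v (f′ a) ≡ f a
      back a = Fin.punchIn-punchOut (miss a ∘ sym)
      emb : IsEmbedding H (deleteVertex E v) f′
      emb = (λ {a} {b} e → inj (trans (sym (back a)) (trans (cong (punchIn v) e) (back b)))) ,
            λ a b e → deleteVertex-adj⁻ E v (subst₂ (Adj G) (sym (back a)) (sym (back b)) (adj a b e))
    minimal H f (inj , adj) (inj₂ (u , v , uv , miss)) RH =
      noE u v uv (ramsey-embedding Hs H (deleteEdge G u v) f (inj , λ a b e →
        deleteEdge-adj⁻ G u v (adj a b e) (λ (p , q) → miss a b e p q) (λ (p , q) → miss b a (adj-sym H e) q p)) RH)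

  abstract
   -- Lexicographic descent on the bound `m` for the vertices and the bound `e` for the ordered
   -- adjacent pairs. Edges are deleted while possible, then a vertex; where neither can go,
   -- `locally-minimal` applies.
   minimal-subgraph : ∀ m e G → n G ≤ m → size₂ G ≤ e → IsRamsey q Hs G →
     ∃[ G′ ] IsRamseyMinimal q Hs G′ × ∃ (IsEmbedding G′ G)
   minimal-subgraph m e G n≤m s≤e R
     with Fin.any? (λ u → Fin.any? (λ v → adj? G u v ×-dec ramsey? q Hs (deleteEdge G u v)))
   minimal-subgraph m zero G n≤m s≤e R | yes (u , v , uv , R′) =
     contradiction (<-≤-trans (deleteEdge-size₂ G u v uv) s≤e) λ ()
   minimal-subgraph m (suc e) G n≤m s≤e R | yes (u , v , uv , R′)
     with G′ , M , f , emb ← minimal-subgraph m e (deleteEdge G u v) n≤m (≤-pred (<-≤-trans (deleteEdge-size₂ G u v uv) s≤e)) R′ =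
     G′ , M , f , embedding-trans G′ (deleteEdge G u v) G emb (id , λ a b x → proj₁ (deleteEdge-adj G u v x))
   minimal-subgraph m e record { n = zero ; E = E } n≤m s≤e R | no noE =
     record { E = E } , no-vertices (record { E = E }) refl R , id , embedding-refl (record { E = E })
   minimal-subgraph (suc m) e record { n = suc k ; E = E } n≤m s≤e R | no noE
     with Fin.any? (λ v → ramsey? q Hs (deleteVertex E v))
   ... | no noV = record { E = E } , locally-minimal E (λ v x → noV (v , x)) (λ u v a x → noE (u , v , a , x)) R , id , embedding-refl (record { E = E })
   -- The bound on the edges starts anew, since `m` has decreased.
   ... | yes (v , R′) with G′ , M , f , emb ← minimal-subgraph m _ (deleteVertex E v) (≤-pred n≤m) ≤-refl R′ =
     G′ , M , _ , embedding-trans G′ (deleteVertex E v) (record { n = suc k ; E = E }) emb (deleteVertex-embedding E v)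

-- Degrees

unique-lookup : ∀ {A : Set} {xs : List A} → Unique xs → ∀ i j → lookup xs i ≡ lookup xs j → i ≡ j
unique-lookup (_ ∷ _) zero zero _ = refl
unique-lookup {xs = _ ∷ xs} (x∉ ∷ _) zero (suc j) e = contradiction e (All.lookup x∉ (Mem.∈-lookup {xs = xs} j))
unique-lookup {xs = _ ∷ xs} (x∉ ∷ _) (suc i) zero e = contradiction (sym e) (All.lookup x∉ (Mem.∈-lookup {xs = xs} i))
unique-lookup (_ ∷ u) (suc i) (suc j) e = cong suc (unique-lookup u i j e)

module _ (G : Graph) (x : Fin (n G)) where

  private
    nbrs : List (Fin (n G))
    nbrs = filter (λ v → adjB G x v Bool.≟ true) (allFin (n G))

  deg-≤ : ∀ {d} (Q : Fin (n G) → Fin d → Set) → (∀ y → Adj G x y → ∃ (Q y)) →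
    (∀ {y y′ i} → Adj G x y → Adj G x y′ → Q y i → Q y′ i → y ≡ y′) → deg G x ≤ d
  deg-≤ {d} Q ex un = Fin.injective⇒≤ {f = f} λ {i} {j} e →
    unique-lookup (Unique.filter⁺ (λ v → adjB G x v Bool.≟ true) (Unique.allFin⁺ _)) i j
      (un (is-adj i) (is-adj j) (proj₂ (ex _ (is-adj i))) (subst (Q (lookup nbrs j)) (sym e) (proj₂ (ex _ (is-adj j)))))
    where
    is-adj : ∀ i → Adj G x (lookup nbrs i)
    is-adj i = proj₂ (Mem.∈-filter⁻ (λ v → adjB G x v Bool.≟ true) {xs = allFin (n G)} (Mem.∈-lookup {xs = nbrs} i))
    f : Fin (deg G x) → Fin d
    f i = proj₁ (ex _ (is-adj i))

  deg-≥ : ∀ {d} (f : Fin d → Fin (n G)) → Injective _≡_ _≡_ f → (∀ i → Adj G x (f i)) → d ≤ deg G x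
  deg-≥ {d} f inj adj = Fin.injective⇒≤ {f = Any.index ∘ mem} λ {i} {j} e →
    inj (trans (lookup-index (mem i)) (trans (cong (lookup nbrs) e) (sym (lookup-index (mem j)))))
    where
    open import Data.List.Relation.Unary.Any.Properties using (lookup-index)
    mem : ∀ i → f i ∈ nbrs
    mem i = Mem.∈-filter⁺ (λ v → adjB G x v Bool.≟ true) (Mem.∈-allFin (f i)) (adj i)

-- Finite graphs on arbitrary finite types

module FiniteGraph {X : Set} (F : Finite X) {B : X → X → Set} (B? : ∀ x y → Dec (B x y))
  (B-sym : ∀ {x y} → B x y → B y x) (B-irrefl : ∀ {x} → ¬ B x x) where

  -- codes not of the form enc x are isolated vertices
  Valid : Fin (size F) → Set
  Valid i = enc F (dec F i) ≡ i

  edge? : ∀ i j → Dec (Valid i × Valid j × B (dec F i) (dec F j))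
  edge? i j = (_ Fin.≟ _) ×-dec (_ Fin.≟ _) ×-dec B? _ _

  abstract
    edgeB : Fin (size F) → Fin (size F) → Bool
    edgeB i j = ⌊ edge? i j ⌋

    edgeB-elim : ∀ i j → edgeB i j ≡ true → Valid i × Valid j × B (dec F i) (dec F j)
    edgeB-elim i j = does⇒ (edge? i j)

    edgeB-intro : ∀ i j → Valid i × Valid j × B (dec F i) (dec F j) → edgeB i j ≡ true
    edgeB-intro i j = ⇒does (edge? i j)

  graph : Graph
  graph = record { n = size F ; E = edgeB }

  graph-adj : ∀ {i j} → Adj graph i j → Valid i × Valid j × B (dec F i) (dec F j)
  graph-adj {i} {j} a with adj-elim graph a
  ... | _ , inj₁ e = edgeB-elim i j e
  ... | _ , inj₂ e = let p , q , b = edgeB-elim j i e in q , p , B-sym b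

  graph-adj⁻ : ∀ {x y} → B x y → Adj graph (enc F x) (enc F y)
  graph-adj⁻ {x} {y} b = adj-intro graph (λ e → B-irrefl (subst (B x) (sym (enc-injective F e)) b))
    (inj₁ (edgeB-intro (enc F x) (enc F y)
      (cong (enc F) (dec∘enc F x) , cong (enc F) (dec∘enc F y) , subst₂ B (sym (dec∘enc F x)) (sym (dec∘enc F y)) b)))

Attach : ∀ {V W : Set} {d} → (V → V → Set) → (W → Fin d → V) → V ⊎ W → V ⊎ W → Set
Attach A nb (inj₁ u) (inj₁ v) = A u v
Attach A nb (inj₁ v) (inj₂ w) = ∃[ i ] nb w i ≡ v
Attach A nb (inj₂ w) (inj₁ v) = ∃[ i ] nb w i ≡ v
Attach A nb (inj₂ _) (inj₂ _) = ⊥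

infix 4 _∧ᶜ_≐_
_∧ᶜ_≐_ : {V : Set} → (V → V → Set) → (V → V → Bool) → Bool → V → V → Set
(A ∧ᶜ c ≐ κ) u v = A u v × c u v ≡ κ

-- A base graph that is not Ramsey for (H₁ , H₂), but becomes Ramsey once an independent set W of
-- new vertices, each with at most d neighbours in the base, is attached.  Colour true stands for H₁.
record Gadget (H₁ H₂ : Graph) (d : ℕ) : Set₁ where
  field
    {V W}    : Set
    V-finite : Finite V
    W-finite : Finite W
    A        : V → V → Set
    A?       : ∀ u v → Dec (A u v)
    A-sym    : ∀ {u v} → A u v → A v u
    A-irrefl : ∀ {v} → ¬ A v v
    nb       : W → Fin d → V
    good     : V → V → Bool
    good-sym : ∀ u v → good u v ≡ good v u
    good₁    : ¬ Copy H₁ (A ∧ᶜ good ≐ true)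
    good₂    : ¬ Copy H₂ (A ∧ᶜ good ≐ false)
    forced   : ∀ (c : V ⊎ W → V ⊎ W → Bool) → (∀ x y → c x y ≡ c y x) →
               Copy H₁ (Attach A nb ∧ᶜ c ≐ true) ⊎ Copy H₂ (Attach A nb ∧ᶜ c ≐ false)

colour₂ : Bool → Fin 2
colour₂ true  = zero
colour₂ false = suc zero

isZero : Fin 2 → Bool
isZero zero    = true
isZero (suc _) = false

isZero-true : ∀ {i} → isZero i ≡ true → i ≡ zero
isZero-true {zero} _ = refl

isZero-false : ∀ {i} → isZero i ≡ false → i ≡ suc zero
isZero-false {suc zero} _ = refl

NoIsolated : Graph → Set
NoIsolated H = ∀ a → ∃[ b ] Adj H a b

module _ {H₁ H₂ : Graph} {d : ℕ} (U : Gadget H₁ H₂ d) where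
  open Gadget U

  private
    X-finite = finite-⊎ V-finite W-finite

    B = Attach A nb

    B? : ∀ x y → Dec (B x y)
    B? (inj₁ u) (inj₁ v) = A? u v
    B? (inj₁ v) (inj₂ w) = Fin.any? λ i → ≟-finite V-finite (nb w i) v
    B? (inj₂ w) (inj₁ v) = Fin.any? λ i → ≟-finite V-finite (nb w i) v
    B? (inj₂ _) (inj₂ _) = no λ ()

    B-sym : ∀ {x y} → B x y → B y x
    B-sym {inj₁ _} {inj₁ _} = A-sym
    B-sym {inj₁ _} {inj₂ _} = id
    B-sym {inj₂ _} {inj₁ _} = id

    B-irrefl : ∀ {x} → ¬ B x x
    B-irrefl {inj₁ _} = A-irrefl

    open FiniteGraph X-finite B? (λ {x} {y} → B-sym {x} {y}) (λ {x} → B-irrefl {x})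

    graph-ramsey : IsRamsey 2 (pair H₁ H₂) graph
    graph-ramsey (c , s)
      with forced (λ x y → isZero (c (enc X-finite x) (enc X-finite y))) (λ x y → cong isZero (s _ _))
    ... | inj₁ cp = zero , toMonoCopy graph c {H = H₁}
      (copy-map (enc X-finite) (enc-injective X-finite) (λ x y (b , e) → graph-adj⁻ {x} {y} b , isZero-true e) cp)
    ... | inj₂ cp = suc zero , toMonoCopy graph c {H = H₂}
      (copy-map (enc X-finite) (enc-injective X-finite) (λ x y (b , e) → graph-adj⁻ {x} {y} b , isZero-false e) cp)

    IsBase : Fin (size X-finite) → Set
    IsBase i = ∃[ v ] dec X-finite i ≡ inj₁ v

    base? : ∀ i → Dec (IsBase i)
    base? i with dec X-finite i
    ... | inj₁ v = yes (v , refl)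
    ... | inj₂ w = no λ ()

    module _ (no-iso₁ : NoIsolated H₁) (no-iso₂ : NoIsolated H₂) (H : Graph) (f : Fin (n H) → Fin (size X-finite)) (emb : IsEmbedding H graph f)
      (base : ∀ a → IsBase (f a)) where

      pos : Fin (n H) → V
      pos a = proj₁ (base a)

      -- A code that encodes nothing may decode to the same base vertex as another code. A vertex of
      -- the copy lies on an edge, so its code is valid, and this makes `pos ∘ φ` injective.
      to-base : ∀ K κ → NoIsolated K → Copy K (Coloured H (λ a b → colour₂ (good (pos a) (pos b))) (colour₂ κ)) →
        Copy K (A ∧ᶜ good ≐ κ)
      to-base K κ no-iso (copy φ inj e) = copy (pos ∘ φ)
        (λ {a} {b} eq → inj (proj₁ emb (trans (sym (valid a)) (trans (cong (enc X-finite)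
          (trans (proj₂ (base (φ a))) (trans (cong inj₁ eq) (sym (proj₂ (base (φ b))))))) (valid b)))))
        λ a b ab → let r , q = e a b ab in
          subst₂ B (proj₂ (base (φ a))) (proj₂ (base (φ b))) (proj₂ (proj₂ (graph-adj (proj₂ emb _ _ r)))) , colour₂-inj _ κ q
        where
        valid : ∀ a → Valid (f (φ a))
        valid a with b , ab ← no-iso a = proj₁ (graph-adj (proj₂ emb _ _ (proj₁ (e a b ab))))
        colour₂-inj : ∀ κ λ′ → colour₂ κ ≡ colour₂ λ′ → κ ≡ λ′
        colour₂-inj true  true  _ = refl
        colour₂-inj false false _ = refl

      not-ramsey : ¬ IsRamsey 2 (pair H₁ H₂) H
      not-ramsey R with R ((λ a b → colour₂ (good (pos a) (pos b))) , λ a b → cong colour₂ (good-sym _ _))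
      ... | zero , cp = good₁ (to-base H₁ true no-iso₁ (fromMonoCopy H _ {H = H₁} cp))
      ... | suc zero , cp = good₂ (to-base H₂ false no-iso₂ (fromMonoCopy H _ {H = H₂} cp))

    attached-deg : ∀ H (f : Fin (n H) → Fin (size X-finite)) → IsEmbedding H graph f →
      ∀ x → ¬ IsBase (f x) → deg H x ≤ d
    attached-deg H f (inj , adj) x ¬base with dec X-finite (f x) in ex
    ... | inj₁ v = contradiction (v , refl) ¬base
    ... | inj₂ w = deg-≤ H x (λ y i → dec X-finite (f y) ≡ inj₁ (nb w i))
      (λ y a → nbr y (subst (λ z → B z (dec X-finite (f y))) ex (proj₂ (proj₂ (graph-adj (adj x y a))))))
      (λ {y} {y′} a a′ q q′ → inj (trans (sym (proj₁ (proj₂ (graph-adj (adj x y a)))))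
         (trans (cong (enc X-finite) (trans q (sym q′))) (proj₁ (proj₂ (graph-adj (adj x y′ a′)))))))
      where
      nbr : ∀ y → B (inj₂ w) (dec X-finite (f y)) → ∃[ i ] dec X-finite (f y) ≡ inj₁ (nb w i)
      nbr y b with dec X-finite (f y)
      nbr y (i , refl) | inj₁ _ = i , refl

  minimal-of-degree-≤ : NoIsolated H₁ → NoIsolated H₂ →
    ∃[ G ] IsRamseyMinimal 2 (pair H₁ H₂) G × ∃[ x ] deg G x ≤ d
  minimal-of-degree-≤ no-iso₁ no-iso₂
    with G , M , f , emb ← minimal-subgraph {Hs = pair H₁ H₂} _ _ graph ≤-refl ≤-refl graph-ramsey
    with Fin.any? (λ x → ¬? (base? (f x)))
  ... | yes (x , ¬b) = G , M , x , attached-deg G f emb x ¬b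
  ... | no ¬∃ = contradiction (proj₁ M)
    (not-ramsey no-iso₁ no-iso₂ G f emb λ a → decidable-stable (base? (f a)) λ ¬b → ¬∃ (a , ¬b))

sIs-from : ∀ {H₁ H₂ d} → Gadget H₁ H₂ d → NoIsolated H₁ → NoIsolated H₂ →
  (∀ G → IsRamseyMinimal 2 (pair H₁ H₂) G → ∀ v → d ≤ deg G v) → sIs 2 (pair H₁ H₂) d
sIs-from U no-iso₁ no-iso₂ lower with G , M , x , d≥ ← minimal-of-degree-≤ U no-iso₁ no-iso₂ =
  (G , M , lower G M , x , ≤-antisym d≥ (lower G M x)) , lower

swap-gadget : ∀ {H₁ H₂ d} → Gadget H₁ H₂ d → Gadget H₂ H₁ d
swap-gadget {H₁} {H₂} U = record
  { V-finite = V-finite ; W-finite = W-finite ; A = A ; A? = A? ; A-sym = A-sym ; A-irrefl = A-irrefl ; nb = nb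
  ; good = λ u v → not (good u v) ; good-sym = λ u v → cong not (good-sym u v)
  ; good₁ = good₂ ∘ copy-mono (λ _ _ (a , e) → a , not-true e)
  ; good₂ = good₁ ∘ copy-mono (λ _ _ (a , e) → a , not-false e)
  ; forced = λ c s → Sum.swap (Sum.map (copy-mono λ _ _ (a , e) → a , not-true e) (copy-mono λ _ _ (a , e) → a , not-false e)
      (forced (λ x y → not (c x y)) (λ x y → cong not (s x y)))) }
  where
  open Gadget U
  not-true : ∀ {b} → not b ≡ true → b ≡ false
  not-true {false} _ = refl
  not-false : ∀ {b} → not b ≡ false → b ≡ true
  not-false {true} _ = refl

-- The partite lemma

two-colour-pigeonhole : ∀ a b m (κ : Fin m → Bool) → a + b ≤ m →
  (Σ[ q ∈ (Fin a → Fin m) ] Injective _≡_ _≡_ q × (∀ i → κ (q i) ≡ true)) ⊎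
  (Σ[ q ∈ (Fin b → Fin m) ] Injective _≡_ _≡_ q × (∀ i → κ (q i) ≡ false))
two-colour-pigeonhole zero b m κ p = inj₁ ((λ ()) , (λ { {()} }) , λ ())
two-colour-pigeonhole (suc a) zero m κ p = inj₂ ((λ ()) , (λ { {()} }) , λ ())
two-colour-pigeonhole (suc a) (suc b) (suc m) κ (s≤s p) with κ zero in κ0
... | true = Sum.map
  (λ (q , inj , e) → (λ { zero → zero ; (suc i) → suc (q i) }) ,
    (λ { {zero} {zero} _ → refl ; {suc i} {suc j} r → cong suc (inj (Fin.suc-injective r)) }) ,
    λ { zero → κ0 ; (suc i) → e i })
  (λ (q , inj , e) → suc ∘ q , (λ r → inj (Fin.suc-injective r)) , e)
  (two-colour-pigeonhole a (suc b) m (κ ∘ suc) p)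
... | false = Sum.map
  (λ (q , inj , e) → suc ∘ q , (λ r → inj (Fin.suc-injective r)) , e)
  (λ (q , inj , e) → (λ { zero → zero ; (suc i) → suc (q i) }) ,
    (λ { {zero} {zero} _ → refl ; {suc i} {suc j} r → cong suc (inj (Fin.suc-injective r)) }) ,
    λ { zero → κ0 ; (suc i) → e i })
  (two-colour-pigeonhole (suc a) b m (κ ∘ suc) (subst (_≤ m) (+-suc a b) p))

bit : Bool → ℕ
bit b = if b then 0 else 1

bit-≤ : ∀ b → bit b ≤ 1
bit-≤ true  = z≤n
bit-≤ false = ≤-refl

double+bit-injective : ∀ p q b → p + p + bit b ≡ q + q → b ≡ true × p ≡ q
double+bit-injective zero    zero    true  e = refl , refl
double+bit-injective zero    (suc q) false e = contradiction (trans (suc-injective e) (+-suc q q)) λ ()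
double+bit-injective (suc p) (suc q) b     e
  with b≡ , p≡ ← double+bit-injective p q b (suc-injective (subst₂ _≡_ (cong (_+ bit b) (+-suc p p)) (+-suc q q) (suc-injective e))) =
  b≡ , cong suc p≡

increasing⇒injective : ∀ {L} (h : ℕ → ℕ) → (∀ i j → i < j → j < L → h i < h j) →
  ∀ {i j} → i < L → j < L → h i ≡ h j → i ≡ j
increasing⇒injective h mono {i} {j} i<L j<L e with <-cmp i j
... | tri< i<j _ _ = contradiction e (<⇒≢ (mono i j i<j j<L))
... | tri≈ _ i≡j _ = i≡j
... | tri> _ _ j<i = contradiction (sym e) (<⇒≢ (mono j i j<i i<L))

clamp : ∀ N → ℕ → Fin (suc N)
clamp N k = k mod suc N

toℕ-clamp : ∀ {N k} → k < suc N → toℕ (clamp N k) ≡ k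
toℕ-clamp {N} {k} k< = trans (Fin.toℕ-fromℕ< (m%n<n k (suc N))) (m<n⇒m%n≡m k<)

infix 4 _∈ᵛ_
_∈ᵛ_ : ∀ {A : Set} {u} → A → Vec A u → Set
a ∈ᵛ S = ∃[ p ] Vec.lookup S p ≡ a

-- Every bipartite graph E has an induced copy with all edges of one colour in the membership
-- graph between points and u-tuples.
record InducedCopy {V : Set} (E : V → V → Set) {X Y : Set} (E′ : X → Y → Set) (c : X → Y → Bool) : Set where
  field
    f     : V → X
    g     : V → Y
    f-inj : ∀ {x y} → f x ≡ f y → x ≡ y
    g-inj : ∀ {x y} → g x ≡ g y → x ≡ y
    to    : ∀ x y → E x y → E′ (f x) (g y)
    from  : ∀ x y → E′ (f x) (g y) → E x y
    κ     : Bool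
    mono  : ∀ x y → E x y → c (f x) (g y) ≡ κ

module PartiteLemma {V : Set} (F : Finite V) {E : V → V → Set} (E? : ∀ x y → Dec (E x y)) where

  private
    m = size F
    -- Among the first `m + m` positions, `m` with equal colour are chosen for the vertices on the
    -- left; the last `m` give each vertex on the right a position of its own.
    u = (m + m) + m

  private
    -- Tuples get one colouring for each position, namely the colour between the tuple and its entry
    -- there; on a homogeneous sequence `h` it depends on the position only. A left vertex with
    -- position `p` becomes the number `h (2p)`. A right vertex becomes the tuple with `h (2p)` at
    -- the positions of its neighbours and the decoy `h (2p + 1)` at those of the others.
    partite-lemma-concrete : ∃₂ λ M w → ∀ (c : Fin M → Vec (Fin M) w → Bool) → InducedCopy E (_∈ᵛ_ {u = w}) c
    partite-lemma-concrete with ramsey-increasing u u (u + u)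
    ... | N , R = suc N , u , go
      where
      tuple : List ℕ → Vec (Fin (suc N)) u
      tuple zs = tabulate λ p → clamp N (nth zs (toℕ p))
      go : (c : Fin (suc N) → Vec (Fin (suc N)) u → Bool) → InducedCopy E _∈ᵛ_ c
      go c with R (λ p zs → c (clamp N (nth zs (toℕ p))) (tuple zs))
      ... | h , h-mono , h-bound , κ , hom = finish
        (two-colour-pigeonhole m m (m + m) (λ q → κ (q Fin.↑ˡ m)) ≤-refl)
        where
        h-inj : ∀ {i j} → i < u + u → j < u + u → clamp N (h i) ≡ clamp N (h j) → i ≡ j
        h-inj p q e = increasing⇒injective h h-mono p q
          (trans (sym (toℕ-clamp (m≤n⇒m≤1+n (h-bound _ p)))) (trans (cong toℕ e) (toℕ-clamp (m≤n⇒m≤1+n (h-bound _ q)))))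
        finish : _ → InducedCopy E _∈ᵛ_ c
        finish = [ (λ (q , inj , e) → build true q inj e) , (λ (q , inj , e) → build false q inj e) ]′
          where
          module Build (q : Fin m → Fin (m + m)) (q-inj : Injective _≡_ _≡_ q) where
            pos : V → Fin u
            pos x = q (enc F x) Fin.↑ˡ m
            -- The second alternative is the position reserved for `y`; it makes `g` injective.
            In : V → Fin u → Set
            In y p = (∃[ x ] pos x ≡ p × E x y) ⊎ p ≡ (m + m) Fin.↑ʳ enc F y
            In? : ∀ y p → Dec (In y p)
            In? y p = any-finite? F (λ x → (pos x Fin.≟ p) ×-dec E? x y) ⊎-dec (p Fin.≟ _)
            side : V → ℕ → ℕ
            side y j with j <? u
            ... | yes j<u = bit ⌊ In? y (fromℕ< j<u) ⌋
            ... | no _    = 0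
            side-≤ : ∀ y j → side y j ≤ 1
            side-≤ y j with j <? u
            ... | yes j<u = bit-≤ _
            ... | no _    = z≤n
            -- Position `j` owns the indices `2j` and `2j + 1`, so every selection of members and
            -- decoys is increasing.
            idx : V → ℕ → ℕ
            idx y j = j + j + side y j
            idx-inc : ∀ y → Increasing u (idx y)
            idx-inc y j _ = <-≤-trans (s≤s (+-monoʳ-≤ (j + j) (side-≤ y j)))
              (≤-trans (≤-reflexive (solve-∀′ j)) (m≤m+n (suc j + suc j) (side y (suc j))))
              where
              solve-∀′ : ∀ j → suc (j + j + 1) ≡ suc j + suc j
              solve-∀′ = solve-∀
            idx-bd : ∀ y j → j < u → idx y j < u + u
            idx-bd y j j<u = <-≤-trans (s≤s (+-monoʳ-≤ (j + j) (side-≤ y j)))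
              (≤-trans (≤-reflexive (solve-∀′ j)) (+-mono-≤ j<u j<u))
              where
              solve-∀′ : ∀ j → suc (j + j + 1) ≡ suc j + suc j
              solve-∀′ = solve-∀
            idx-Fin : ∀ y p → idx y (toℕ p) ≡ toℕ p + toℕ p + bit ⌊ In? y p ⌋
            idx-Fin y p with toℕ p <? u
            ... | yes j<u = cong (λ z → toℕ p + toℕ p + bit ⌊ In? y z ⌋) (Fin.fromℕ<-toℕ p j<u)
            ... | no ¬p = contradiction (Fin.toℕ<n p) ¬p
            code : V → List ℕ
            code y = applyUpTo (h ∘ idx y) u
            f : V → Fin (suc N)
            f x = clamp N (h (toℕ (pos x) + toℕ (pos x)))
            g : V → Vec (Fin (suc N)) u
            g y = tuple (code y)
            g-lookup : ∀ y p → Vec.lookup (g y) p ≡ clamp N (h (toℕ p + toℕ p + bit ⌊ In? y p ⌋))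
            g-lookup y p = trans (Vec.lookup∘tabulate _ p) (cong (clamp N)
              (trans (nth-applyUpTo (h ∘ idx y) u (toℕ p) (Fin.toℕ<n p)) (cong h (idx-Fin y p))))
            double-bd : ∀ (p : Fin u) → toℕ p + toℕ p < u + u
            double-bd p = +-mono-< (Fin.toℕ<n p) (Fin.toℕ<n p)
            bit-bd : ∀ (p : Fin u) b → toℕ p + toℕ p + bit b < u + u
            bit-bd p b = <-≤-trans (s≤s (+-monoʳ-≤ (toℕ p + toℕ p) (bit-≤ b)))
              (≤-trans (≤-reflexive (solve-∀′ (toℕ p))) (+-mono-≤ (Fin.toℕ<n p) (Fin.toℕ<n p)))
              where
              solve-∀′ : ∀ j → suc (j + j + 1) ≡ suc j + suc j
              solve-∀′ = solve-∀
            pos-inj : ∀ {x y} → pos x ≡ pos y → x ≡ y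
            pos-inj e = enc-injective F (q-inj (Fin.↑ˡ-injective m _ _ e))
            pos≢ : ∀ {x} {i : Fin m} → pos x ≢ (m + m) Fin.↑ʳ i
            pos≢ {x} {i} e = contradiction (trans (sym (Fin.splitAt-↑ˡ (m + m) (q (enc F x)) m))
              (trans (cong (splitAt (m + m)) e) (Fin.splitAt-↑ʳ (m + m) m i))) λ ()
            hit : ∀ y p → In y p → Vec.lookup (g y) p ≡ clamp N (h (toℕ p + toℕ p))
            hit y p i = trans (g-lookup y p) (cong (clamp N ∘ h)
              (trans (cong (λ b → toℕ p + toℕ p + bit b) (⇒does (In? y p) i)) (+-identityʳ _)))
            hit⁻ : ∀ y p r → Vec.lookup (g y) r ≡ clamp N (h (toℕ p + toℕ p)) → r ≡ p × In y r
            hit⁻ y p r e with b , p≡ ← double+bit-injective (toℕ r) (toℕ p) ⌊ In? y r ⌋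
                                (h-inj (bit-bd r _) (double-bd p) (trans (sym (g-lookup y r)) e)) =
              Fin.toℕ-injective p≡ , does⇒ (In? y r) b
          build : ∀ κ′ (q : Fin m → Fin (m + m)) → Injective _≡_ _≡_ q → (∀ i → κ (q i Fin.↑ˡ m) ≡ κ′) → InducedCopy E _∈ᵛ_ c
          build κ′ q q-inj q-col = record
            { f = f ; g = g
            ; f-inj = λ {x} {y} e → pos-inj (Fin.toℕ-injective (proj₂ (double+bit-injective (toℕ (pos x)) (toℕ (pos y)) true
                (trans (+-identityʳ _) (h-inj (double-bd (pos x)) (double-bd (pos y)) e)))))
            ; g-inj = λ {x} {y} e → id-pos (proj₂ (hit⁻ y (idp x) (idp x)
                (trans (sym (cong (λ v → Vec.lookup v (idp x)) e)) (hit x (idp x) (inj₂ refl)))))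
            ; to = λ x y e → pos x , hit y (pos x) (inj₁ (x , refl , e))
            ; from = λ x y (r , e) → from′ x y (hit⁻ y (pos x) r e)
            ; κ = κ′
            ; mono = λ x y e → trans (cong (λ z → c z (g y)) (trans (sym (hit y (pos x) (inj₁ (x , refl , e)))) (Vec.lookup∘tabulate _ (pos x))))
                (trans (hom (pos x) (idx y) (idx-inc y) (idx-bd y)) (q-col (enc F x)))
            }
            where
            open Build q q-inj
            idp : V → Fin u
            idp x = (m + m) Fin.↑ʳ enc F x
            id-pos : ∀ {x y} → In y (idp x) → x ≡ y
            id-pos (inj₁ (z , e , _)) = contradiction e pos≢
            id-pos (inj₂ e) = enc-injective F (Fin.↑ʳ-injective (m + m) _ _ e)
            from′ : ∀ x y {r} → r ≡ pos x × In y r → E x y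
            from′ x y (refl , inj₁ (z , e , p)) = subst (λ w → E w y) (pos-inj e) p
            from′ x y (refl , inj₂ e) = contradiction e pos≢

  abstract
    partite-lemma : ∃₂ λ M w → ∀ (c : Fin M → Vec (Fin M) w → Bool) → InducedCopy E (_∈ᵛ_ {u = w}) c
    partite-lemma = partite-lemma-concrete

open PartiteLemma

-- The partite construction of Nešetřil and Rödl

record Partite (I : Set) (T : I → I → Set) : Set₁ where
  field
    {V}    : Set
    finite : Finite V
    part   : V → I
    A      : V → V → Set
    A?     : ∀ u v → Dec (A u v)
    A-sym  : ∀ {u v} → A u v → A v u
    A-part : ∀ {u v} → A u v → T (part u) (part v)

CliqueFree : ∀ {I T} → ℕ → Partite I T → Set
CliqueFree t P = (φ : Fin t → V) → ¬ (∀ a b → a ≢ b → A (φ a) (φ b))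
  where open Partite P

record PartCopy {I T} (P D : Partite I T) : Set where
  private
    module P = Partite P
    module D = Partite D
  field
    φ      : P.V → D.V
    φ-inj  : ∀ {x y} → φ x ≡ φ y → x ≡ y
    φ-part : ∀ x → D.part (φ x) ≡ P.part x
    φ-edge : ∀ {x y} → P.A x y → D.A (φ x) (φ y)

-- Monochromaticity between parts is required for the listed pairs only, so that the list can grow
-- by one pair in each step of the induction.
Arrows : ∀ {I T} → List (I × I) → Partite I T → Partite I T → Set
Arrows {I} Ps D P = ∀ (c : D.V → D.V → Bool) → Σ[ C ∈ PartCopy P D ] Σ[ κ ∈ (I → I → Bool) ]
  (∀ x y → P.A x y → (P.part x , P.part y) ∈ Ps → c (PartCopy.φ C x) (PartCopy.φ C y) ≡ κ (P.part x) (P.part y))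
  where
  module P = Partite P
  module D = Partite D

module Amalgamation {I : Set} {T : I → I → Set} (_≟ᴵ_ : DecidableEquality I)
  (T-sym : ∀ {i j} → T i j → T j i) (T-irrefl : ∀ {i} → ¬ T i i) (P : Partite I T) {i j : I} (Tij : T i j) where

  open Partite P

  Between : V → V → Set
  Between x y = part x ≡ i × part y ≡ j × A x y

  between? : ∀ x y → Dec (Between x y)
  between? x y = (part x ≟ᴵ i) ×-dec (part y ≟ᴵ j) ×-dec A? x y

  i≢j : i ≢ j
  i≢j refl = T-irrefl Tij

  private
    M w : ℕ
    M = proj₁ (partite-lemma finite between?)
    w = proj₁ (proj₂ (partite-lemma finite between?))
    X Y Λ : Set
    X = Fin M
    Y = Vec (Fin M) w
    -- Candidates for an induced copy of the bipartite graph between parts `i` and `j`, as tables of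
    -- values. Each candidate gets private copies of the other parts; only valid ones are linked to
    -- `X` and `Y`.
    Λ = Vec X (size finite) × Vec Y (size finite)

    Λ-finite : Finite Λ
    Λ-finite = finite-× (finite-Vec (finite-Fin M) _) (finite-Vec (finite-Vec (finite-Fin M) w) _)

    f : Λ → V → X
    f l x = Vec.lookup (proj₁ l) (enc finite x)
    g : Λ → V → Y
    g l y = Vec.lookup (proj₂ l) (enc finite y)

    Valid : Λ → Set
    Valid l = (∀ x y → f l x ≡ f l y → x ≡ y) × (∀ x y → g l x ≡ g l y → x ≡ y) ×
              (∀ x y → Between x y → f l x ∈ᵛ g l y) × (∀ x y → f l x ∈ᵛ g l y → Between x y)

    mem? : ∀ (a : X) (S : Y) → Dec (a ∈ᵛ S)
    mem? a S = Fin.any? λ p → Vec.lookup S p Fin.≟ a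

    valid? : ∀ l → Dec (Valid l)
    valid? l = all² (λ x y → (f l x Fin.≟ f l y) →-dec ≟-finite finite x y) ×-dec
               all² (λ x y → ≟-finite (finite-Vec (finite-Fin M) w) (g l x) (g l y) →-dec ≟-finite finite x y) ×-dec
               all² (λ x y → between? x y →-dec mem? (f l x) (g l y)) ×-dec
               all² (λ x y → mem? (f l x) (g l y) →-dec between? x y)
      where
      all² : ∀ {Q : V → V → Set} → (∀ x y → Dec (Q x y)) → Dec (∀ x y → Q x y)
      all² Q? = all-finite? finite λ x → all-finite? finite λ y → Q? x y

    Free : V → Set
    Free v = part v ≢ i × part v ≢ j

    free? : ∀ v → Dec (Free v)
    free? v = ¬? (part v ≟ᴵ i) ×-dec ¬? (part v ≟ᴵ j)

    LinkX : X → Λ → V → Set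
    LinkX a l v = Valid l × Free v × ∃[ x ] part x ≡ i × f l x ≡ a × A x v
    LinkY : Y → Λ → V → Set
    LinkY S l v = Valid l × Free v × ∃[ y ] part y ≡ j × g l y ≡ S × A y v

    linkX? : ∀ a l v → Dec (LinkX a l v)
    linkX? a l v = valid? l ×-dec free? v ×-dec any-finite? finite λ x → (part x ≟ᴵ i) ×-dec (f l x Fin.≟ a) ×-dec A? x v
    linkY? : ∀ S l v → Dec (LinkY S l v)
    linkY? S l v = valid? l ×-dec free? v ×-dec any-finite? finite λ y →
      (part y ≟ᴵ j) ×-dec ≟-finite (finite-Vec (finite-Fin M) w) (g l y) S ×-dec A? y v

    pattern inX a   = inj₁ a
    pattern inY S   = inj₂ (inj₁ S)
    pattern inP l v = inj₂ (inj₂ (l , v))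

    V′ : Set
    V′ = X ⊎ Y ⊎ (Λ × V)

    part′ : V′ → I
    part′ (inX _)   = i
    part′ (inY _)   = j
    part′ (inP _ v) = part v

    -- A vertex `inP l v` with `v` in part `i` or `j` is isolated; in the copy of `P` its place is
    -- taken by `inX (f l v)` or `inY (g l v)`.
    A′ : V′ → V′ → Set
    A′ (inX a) (inX b) = ⊥
    A′ (inX a) (inY S) = a ∈ᵛ S
    A′ (inX a) (inP l v) = LinkX a l v
    A′ (inY S) (inX a) = a ∈ᵛ S
    A′ (inY S) (inY _) = ⊥
    A′ (inY S) (inP l v) = LinkY S l v
    A′ (inP l v) (inX a) = LinkX a l v
    A′ (inP l v) (inY S) = LinkY S l v
    A′ (inP l u) (inP k v) = l ≡ k × Free u × Free v × A u v

    A′? : ∀ u v → Dec (A′ u v)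
    A′? (inX a) (inX b) = no λ ()
    A′? (inX a) (inY S) = mem? a S
    A′? (inX a) (inP l v) = linkX? a l v
    A′? (inY S) (inX a) = mem? a S
    A′? (inY S) (inY _) = no λ ()
    A′? (inY S) (inP l v) = linkY? S l v
    A′? (inP l v) (inX a) = linkX? a l v
    A′? (inP l v) (inY S) = linkY? S l v
    A′? (inP l u) (inP k v) = ≟-finite Λ-finite l k ×-dec free? u ×-dec free? v ×-dec A? u v

    A′-sym : ∀ {u v} → A′ u v → A′ v u
    A′-sym {inX _} {inY _} = id
    A′-sym {inX _} {inP _ _} = id
    A′-sym {inY _} {inX _} = id
    A′-sym {inY _} {inP _ _} = id
    A′-sym {inP _ _} {inX _} = id
    A′-sym {inP _ _} {inY _} = id
    A′-sym {inP _ _} {inP _ _} (e , p , q , a) = sym e , q , p , A-sym a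

    A′-part : ∀ {u v} → A′ u v → T (part′ u) (part′ v)
    A′-part {inX _} {inY _} _ = Tij
    A′-part {inX _} {inP _ v} (_ , _ , x , px , _ , a) = subst (λ k → T k (part v)) px (A-part a)
    A′-part {inY _} {inX _} _ = T-sym Tij
    A′-part {inY _} {inP _ v} (_ , _ , y , py , _ , a) = subst (λ k → T k (part v)) py (A-part a)
    A′-part {inP _ v} {inX _} (_ , _ , x , px , _ , a) = T-sym (subst (λ k → T k (part v)) px (A-part a))
    A′-part {inP _ v} {inY _} (_ , _ , y , py , _ , a) = T-sym (subst (λ k → T k (part v)) py (A-part a))
    A′-part {inP _ _} {inP _ _} (_ , _ , _ , a) = A-part a

  amalgam : Partite I T
  amalgam = record
    { V = V′ ; finite = finite-⊎ (finite-Fin M) (finite-⊎ (finite-Vec (finite-Fin M) w) (finite-× Λ-finite finite))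
    ; part = part′ ; A = A′ ; A? = A′? ; A-sym = λ {u} {v} → A′-sym {u} {v} ; A-part = λ {u} {v} → A′-part {u} {v} }

  private
    module Embed (l : Λ) (valid : Valid l) where

      data Place (x : V) : V′ → Set where
        atX : part x ≡ i → Place x (inX (f l x))
        atY : part x ≡ j → Place x (inY (g l x))
        atP : Free x → Place x (inP l x)

      place : ∀ x → ∃ (Place x)
      place x with part x ≟ᴵ i | part x ≟ᴵ j
      ... | yes p | _     = _ , atX p
      ... | no _  | yes p = _ , atY p
      ... | no p  | no q  = _ , atP (p , q)

      place-inj : ∀ {x y z} → Place x z → Place y z → x ≡ y
      place-inj P₁ P₂ = go P₁ P₂ refl
        where
        go : ∀ {x y z z′} → Place x z → Place y z′ → z ≡ z′ → x ≡ y
        go (atX _) (atX _) e = proj₁ valid _ _ (inj₁-injective e)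
        go (atY _) (atY _) e = proj₁ (proj₂ valid) _ _ (inj₁-injective (inj₂-injective e))
        go (atP _) (atP _) e = cong proj₂ (inj₂-injective (inj₂-injective e))

      place-part : ∀ {x z} → Place x z → part′ z ≡ part x
      place-part (atX p) = sym p
      place-part (atY p) = sym p
      place-part (atP _) = refl

      place-edge : ∀ {x y z z′} → Place x z → Place y z′ → A x y → A′ z z′
      place-edge (atX p) (atX q) a = ⊥-elim (T-irrefl (subst₂ T p q (A-part a)))
      place-edge {x} {y} (atX p) (atY q) a = proj₁ (proj₂ (proj₂ valid)) x y (p , q , a)
      place-edge {x} (atX p) (atP q) a = valid , q , x , p , refl , a
      place-edge {x} {y} (atY p) (atX q) a = proj₁ (proj₂ (proj₂ valid)) y x (q , p , A-sym a)
      place-edge (atY p) (atY q) a = ⊥-elim (T-irrefl (subst₂ T p q (A-part a)))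
      place-edge {x} (atY p) (atP q) a = valid , q , x , p , refl , a
      place-edge {x} {y} (atP p) (atX q) a = valid , p , y , q , refl , A-sym a
      place-edge {x} {y} (atP p) (atY q) a = valid , p , y , q , refl , A-sym a
      place-edge (atP p) (atP q) a = refl , p , q , a

      partCopy : PartCopy P amalgam
      partCopy = record
        { φ = proj₁ ∘ place
        ; φ-inj = λ {x} {y} e → place-inj (proj₂ (place x)) (subst (Place y) (sym e) (proj₂ (place y)))
        ; φ-part = λ x → place-part (proj₂ (place x))
        ; φ-edge = λ {x} {y} → place-edge (proj₂ (place x)) (proj₂ (place y)) }

      place-X : ∀ {x} → part x ≡ i → proj₁ (place x) ≡ inX (f l x)
      place-X {x} p with place x
      ... | _ , atX _ = refl
      ... | _ , atY q = ⊥-elim (i≢j (trans (sym p) q))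
      ... | _ , atP (q , _) = ⊥-elim (q p)

      place-Y : ∀ {x} → part x ≡ j → proj₁ (place x) ≡ inY (g l x)
      place-Y {x} p with place x
      ... | _ , atX q = ⊥-elim (i≢j (trans (sym q) p))
      ... | _ , atY _ = refl
      ... | _ , atP (_ , q) = ⊥-elim (q p)

  -- The partite lemma for the colours between `X` and `Y` singles out one candidate `l`; the copy
  -- of `P` glued along it inherits the colour.
  amalgam-arrows : ∀ (c : V′ → V′ → Bool) → Σ[ C ∈ PartCopy P amalgam ] ∃[ κ ]
    (∀ x y → Between x y → c (PartCopy.φ C x) (PartCopy.φ C y) ≡ κ)
  amalgam-arrows c = Embed.partCopy l valid , I.κ , λ x y (p , q , a) →
    trans (cong₂ c (trans (Embed.place-X l valid p) (cong inj₁ (f≡ x))) (trans (Embed.place-Y l valid q) (cong (inj₂ ∘ inj₁) (g≡ y))))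
          (I.mono x y (p , q , a))
    where
    module I = InducedCopy (proj₂ (proj₂ (partite-lemma finite between?)) λ a S → c (inX a) (inY S))
    l : Λ
    l = tabulate (I.f ∘ dec finite) , tabulate (I.g ∘ dec finite)
    f≡ : ∀ x → f l x ≡ I.f x
    f≡ x = trans (Vec.lookup∘tabulate _ (enc finite x)) (cong I.f (dec∘enc finite x))
    g≡ : ∀ x → g l x ≡ I.g x
    g≡ x = trans (Vec.lookup∘tabulate _ (enc finite x)) (cong I.g (dec∘enc finite x))
    valid : Valid l
    valid = (λ x y e → I.f-inj (trans (sym (f≡ x)) (trans e (f≡ y)))) ,
            (λ x y e → I.g-inj (trans (sym (g≡ x)) (trans e (g≡ y)))) ,
            (λ x y e → subst₂ _∈ᵛ_ (sym (f≡ x)) (sym (g≡ y)) (I.to x y e)) ,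
            (λ x y e → I.from x y (subst₂ _∈ᵛ_ (f≡ x) (g≡ y) e))

  private
    no-three : ∀ {x y z} → (∀ l v → x ≢ inP l v) → (∀ l v → y ≢ inP l v) → (∀ l v → z ≢ inP l v) →
      A′ x y → A′ x z → A′ y z → ⊥
    no-three {inX _} {inY _} {inY _} _ _ _ _ _ ()
    no-three {inY _} {inX _} {inX _} _ _ _ _ _ ()
    no-three {inP _ _} p _ _ = λ _ _ _ → p _ _ refl
    no-three {_} {inP _ _} _ p _ = λ _ _ _ → p _ _ refl
    no-three {_} {_} {inP _ _} _ _ p = λ _ _ _ → p _ _ refl

  -- A clique meeting the private part of some copy of P lies in that copy; the others have at most two vertices.
  amalgam-cliqueFree : ∀ {t} → 3 ≤ t → CliqueFree t P → CliqueFree t amalgam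
  amalgam-cliqueFree {t} 3≤t free ψ clique with Fin.any? (λ a → private? (ψ a))
    where
    private? : ∀ z → Dec (∃₂ λ l v → z ≡ inP l v)
    private? (inX _) = no λ ()
    private? (inY _) = no λ ()
    private? (inP l v) = yes (l , v , refl)
  ... | yes (a₀ , l , v₀ , e₀) = free (proj₁ ∘ rep) λ a b a≢b → rep-edge (proj₂ (rep a)) (proj₂ (rep b)) (clique a b a≢b)
    where
    data Rep : V′ → V → Set where
      repX : ∀ {v} → Valid l → part v ≡ i → Rep (inX (f l v)) v
      repY : ∀ {v} → Valid l → part v ≡ j → Rep (inY (g l v)) v
      repP : ∀ {v} → Rep (inP l v) v
    rep-of : ∀ z → A′ z (inP l v₀) → ∃ (Rep z)
    rep-of (inX _) (vl , _ , x , px , refl , _) = x , repX vl px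
    rep-of (inY _) (vl , _ , y , py , refl , _) = y , repY vl py
    rep-of (inP _ v) (refl , _) = v , repP
    rep : ∀ a → ∃ (Rep (ψ a))
    rep a with a Fin.≟ a₀
    ... | yes refl = v₀ , subst (λ z → Rep z v₀) (sym e₀) repP
    ... | no a≢a₀ = rep-of (ψ a) (subst (A′ (ψ a)) e₀ (clique a a₀ a≢a₀))
    rep-edge : ∀ {z z′ u v} → Rep z u → Rep z′ v → A′ z z′ → A u v
    -- This is where the copies have to be induced: a membership between images must come from an
    -- edge of `P`.
    rep-edge (repX {u} vl _) (repY {v} _ _) m = proj₂ (proj₂ (proj₂ (proj₂ (proj₂ vl)) u v m))
    rep-edge {v = v} (repX vl _) repP (_ , _ , x , _ , e , a) = subst (λ z → A z v) (proj₁ vl _ _ e) a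
    rep-edge (repY {u} vl _) (repX {v} _ _) m = A-sym (proj₂ (proj₂ (proj₂ (proj₂ (proj₂ vl)) v u m)))
    rep-edge {v = v} (repY vl _) repP (_ , _ , y , _ , e , a) = subst (λ z → A z v) (proj₁ (proj₂ vl) _ _ e) a
    rep-edge {u = u} repP (repX vl _) (_ , _ , x , _ , e , a) = A-sym (subst (λ z → A z u) (proj₁ vl _ _ e) a)
    rep-edge {u = u} repP (repY vl _) (_ , _ , y , _ , e , a) = A-sym (subst (λ z → A z u) (proj₁ (proj₂ vl) _ _ e) a)
    rep-edge repP repP (_ , _ , _ , a) = a
  amalgam-cliqueFree (s≤s (s≤s (s≤s _))) free ψ clique | no ¬private =
    no-three (np zero) (np (suc zero)) (np (suc (suc zero)))
      (clique zero (suc zero) λ ()) (clique zero (suc (suc zero)) λ ()) (clique (suc zero) (suc (suc zero)) λ ())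
    where
    np : ∀ a l v → ψ a ≢ inP l v
    np a l v e = ¬private (a , l , v , e)

module _ {I : Set} {T : I → I → Set} (_≟ᴵ_ : DecidableEquality I)
  (T-sym : ∀ {i j} → T i j → T j i) (T-irrefl : ∀ {i} → ¬ T i i) (P : Partite I T) where

  -- The head of the list is amalgamated last. Inside the copy of `D` that has one colour between
  -- parts `i` and `j`, the arrow property of `D` handles the other pairs, and passing to a smaller
  -- copy does not disturb the first colour.
  partite-construction : ∀ (Ps : List (I × I)) → All (uncurry T) Ps →
    Σ[ D ∈ Partite I T ] Arrows Ps D P × (∀ t → 3 ≤ t → CliqueFree t P → CliqueFree t D)
  partite-construction [] _ = P , (λ c → record { φ = id ; φ-inj = id ; φ-part = λ _ → refl ; φ-edge = id } ,
    (λ _ _ → true) , λ _ _ _ ()) , λ _ _ → id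
  partite-construction ((i , j) ∷ Ps) (Tij ∷ Ts) with partite-construction Ps Ts
  ... | D , arr , free = amalgam , arr′ , λ t 3≤t → amalgam-cliqueFree 3≤t ∘ free t 3≤t
    where
    open Amalgamation _≟ᴵ_ T-sym T-irrefl D Tij
    module P = Partite P
    arr′ : Arrows ((i , j) ∷ Ps) amalgam P
    arr′ c with amalgam-arrows c
    ... | C , κ , mono with arr (λ x y → c (PartCopy.φ C x) (PartCopy.φ C y))
    ... | C′ , κ′ , mono′ = record
          { φ = C.φ ∘ C′.φ ; φ-inj = C′.φ-inj ∘ C.φ-inj
          ; φ-part = λ x → trans (C.φ-part (C′.φ x)) (C′.φ-part x) ; φ-edge = λ a → C.φ-edge (C′.φ-edge a) } , κ″ , hom
      where
      module C = PartCopy C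
      module C′ = PartCopy C′
      κ″ : I → I → Bool
      κ″ a b = if ⌊ (a ≟ᴵ i) ×-dec (b ≟ᴵ j) ⌋ then κ else κ′ a b
      hom : ∀ x y → P.A x y → (P.part x , P.part y) ∈ ((i , j) ∷ Ps) → c (C.φ (C′.φ x)) (C.φ (C′.φ y)) ≡ κ″ (P.part x) (P.part y)
      hom x y a m with (P.part x ≟ᴵ i) ×-dec (P.part y ≟ᴵ j) | m
      ... | yes (p , q) | _ = mono (C′.φ x) (C′.φ y) (trans (C′.φ-part x) p , trans (C′.φ-part y) q , C′.φ-edge a)
      ... | no ¬pq | here refl = contradiction (refl , refl) ¬pq
      ... | no _   | there m′ = mono′ x y a m′

-- Cycles, links and blow-ups

cycle-copy : ∀ {V : Set} {R : V → V → Set} → (∀ {u v} → R u v → R v u) → ∀ m (f : ℕ → V) →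
  (∀ {i j} → i ≤ m → j ≤ m → f i ≡ f j → i ≡ j) → (∀ i → i < m → R (f i) (f (suc i))) → R (f m) (f 0) →
  Copy (Cycle (suc m)) R
cycle-copy {R = R} R-sym m f inj step close = copy (f ∘ toℕ)
  (λ {a} {b} e → Fin.toℕ-injective (inj (bound a) (bound b) e))
  λ a b ab → case proj₂ (adj-elim (Cycle (suc m)) ab) of λ
    { (inj₁ e) → next a b (does⇒ (_ ≟ _) e) ; (inj₂ e) → R-sym (next b a (does⇒ (_ ≟ _) e)) }
  where
  bound : (a : Fin (suc m)) → toℕ a ≤ m
  bound a = ≤-pred (Fin.toℕ<n a)
  next : ∀ a b → toℕ b ≡ suc (toℕ a) % suc m → R (f (toℕ a)) (f (toℕ b))
  next a b e with m≤n⇒m<n∨m≡n (bound a)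
  ... | inj₁ a<m = subst (R (f (toℕ a)) ∘ f) (sym (trans e (m<n⇒m%n≡m (s≤s a<m)))) (step _ a<m)
  ... | inj₂ a≡m = subst₂ (λ x y → R (f x) (f y)) (sym a≡m) (sym (trans e (trans (cong (λ x → suc x % suc m) a≡m) (n%n≡0 (suc m))))) close

record ClosedWalk {V : Set} (R : V → V → Set) (k : ℕ) : Set where
  field
    at    : ℕ → V
    step  : ∀ i → i < k → R (at i) (at (suc i))
    close : at k ≡ at 0

toℕ-mod : ∀ m i → toℕ (clamp m i) ≡ i % suc m
toℕ-mod m i = Fin.toℕ-fromℕ< (m%n<n i (suc m))

cycle-next : ∀ m → 1 ≤ m → ∀ i → i < suc m → Adj (Cycle (suc m)) (clamp m i) (clamp m (suc i))
cycle-next m 1≤m i i< = adj-intro (Cycle (suc m)) (λ q → neq (trans (sym (toℕ-clamp i<)) (trans (cong toℕ q) (toℕ-mod m (suc i)))))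
  (inj₁ (⇒does (_ ≟ _) (trans (toℕ-mod m (suc i)) (cong (λ x → suc x % suc m) (sym (toℕ-clamp i<))))))
  where
  neq : i ≢ suc i % suc m
  neq q with m≤n⇒m<n∨m≡n (≤-pred i<)
  ... | inj₁ i<m = contradiction (trans q (m<n⇒m%n≡m (s≤s i<m))) (<⇒≢ (n<1+n i))
  ... | inj₂ refl = contradiction (trans q (n%n≡0 (suc m))) (<⇒≢ 1≤m ∘ sym)

cycle-walk : ∀ {V : Set} {R : V → V → Set} m → 1 ≤ m → Copy (Cycle (suc m)) R → ClosedWalk R (suc m)
cycle-walk {R = R} m 1≤m (copy φ inj e) = record
  { at = φ ∘ clamp m ; step = λ i i< → e _ _ (cycle-next m 1≤m i i<)
  ; close = cong φ (Fin.toℕ-injective (trans (toℕ-mod m (suc m)) (trans (n%n≡0 (suc m)) (sym (toℕ-mod m 0))))) }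

cycle-noIsolated : ∀ m → 1 ≤ m → NoIsolated (Cycle (suc m))
cycle-noIsolated m 1≤m a = clamp m (suc (toℕ a)) , subst (λ b → Adj (Cycle (suc m)) b (clamp m (suc (toℕ a))))
  (Fin.toℕ-injective (toℕ-clamp (Fin.toℕ<n a))) (cycle-next m 1≤m (toℕ a) (Fin.toℕ<n a))

complete-adj : ∀ {t} (a b : Fin t) → a ≢ b → Adj (Complete t) a b
complete-adj {t} a b a≢b = adj-intro (Complete t) a≢b (inj₁ refl)

complete-noIsolated : ∀ t → NoIsolated (Complete (2 + t))
complete-noIsolated t zero    = suc zero , complete-adj {2 + t} zero (suc zero) λ ()
complete-noIsolated t (suc a) = zero , complete-adj {2 + t} (suc a) zero λ ()

complete-copy : ∀ {V : Set} {R : V → V → Set} {t} → (∀ {v} → ¬ R v v) → (ψ : Fin t → V) →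
  (∀ a b → a ≢ b → R (ψ a) (ψ b)) → Copy (Complete t) R
complete-copy {R = R} {t} R-irrefl ψ e = copy ψ
  (λ {a} {b} q → decidable-stable (a Fin.≟ b) λ a≢b → R-irrefl (subst (R (ψ a)) (sym q) (e a b a≢b)))
  λ a b ab → e a b (proj₁ (adj-elim (Complete t) ab))

data Half : ℕ → Set where
  even : ∀ a → Half (a + a)
  odd  : ∀ a → Half (suc (a + a))

half : ∀ k → Half k
half zero = even 0
half (suc k) with half k
... | even a = odd a
... | odd a = subst Half (cong suc (+-suc a a)) (even (suc a))

double-< : ∀ {a m} → a + a < m + m → a < m
double-< {a} {m} p = ≰⇒> λ m≤a → <⇒≱ p (+-mono-≤ m≤a m≤a)

zig : {V : Set} → (ℕ → V) → (ℕ → V) → ℕ → V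
zig u v zero          = u 0
zig u v (suc zero)    = v 0
zig u v (suc (suc k)) = zig (u ∘ suc) (v ∘ suc) k

module _ {V : Set} where

  zig-even : ∀ (u v : ℕ → V) a → zig u v (a + a) ≡ u a
  zig-even u v zero = refl
  zig-even u v (suc a) = trans (cong (λ x → zig u v (suc x)) (+-suc a a)) (zig-even (u ∘ suc) (v ∘ suc) a)

  zig-odd : ∀ (u v : ℕ → V) a → zig u v (suc (a + a)) ≡ v a
  zig-odd u v zero = refl
  zig-odd u v (suc a) = trans (cong (λ x → zig u v (suc (suc x))) (+-suc a a)) (zig-odd (u ∘ suc) (v ∘ suc) a)

  zig-injective : ∀ (u v : ℕ → V) m → (∀ {a b} → a < m → b < m → u a ≡ u b → a ≡ b) →
    (∀ {a b} → a < m → b < m → v a ≡ v b → a ≡ b) → (∀ {a b} → a < m → b < m → u a ≢ v b) →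
    ∀ {i j} → i < m + m → j < m + m → zig u v i ≡ zig u v j → i ≡ j
  zig-injective u v m iu iv uv {i} {j} p q e with half i | half j
  ... | even a | even b = cong (λ x → x + x) (iu (double-< p) (double-< q) (trans (sym (zig-even u v a)) (trans e (zig-even u v b))))
  ... | even a | odd b = ⊥-elim (uv (double-< p) (double-< (<-trans (n<1+n _) q)) (trans (sym (zig-even u v a)) (trans e (zig-odd u v b))))
  ... | odd a | even b = ⊥-elim (uv (double-< q) (double-< (<-trans (n<1+n _) p)) (trans (sym (zig-even u v b)) (trans (sym e) (zig-odd u v a))))
  ... | odd a | odd b = cong (λ x → suc (x + x)) (iv (double-< (<-trans (n<1+n _) p)) (double-< (<-trans (n<1+n _) q))
    (trans (sym (zig-odd u v a)) (trans e (zig-odd u v b))))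

  zig-step : ∀ {R : V → V → Set} (u v : ℕ → V) m → (∀ a → a < m → R (u a) (v a)) → (∀ a → suc a < m → R (v a) (u (suc a))) →
    ∀ i → suc i < m + m → R (zig u v i) (zig u v (suc i))
  zig-step {R} u v m r s i p with half i
  ... | even a = subst₂ R (sym (zig-even u v a)) (sym (zig-odd u v a)) (r a (double-< (<-trans (n<1+n _) p)))
  ... | odd a = subst₂ R (sym (zig-odd u v a)) (sym (zig-even (u ∘ suc) (v ∘ suc) a))
    (s a (double-< {suc a} (subst (_< m + m) (cong suc (sym (+-suc a a))) p)))

record Link {V : Set} (R : V → V → Set) (h : ℕ) (x y : V) : Set where
  field
    at    : ℕ → V
    start : at 0 ≡ x
    end   : at h ≡ y
    inj   : ∀ {i j} → i ≤ h → j ≤ h → at i ≡ at j → i ≡ j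
    step  : ∀ i → i < h → R (at i) (at (suc i))

link-map : ∀ {V W : Set} {R : V → V → Set} {S : W → W → Set} (f : V → W) → (∀ {x y} → f x ≡ f y → x ≡ y) →
  (∀ {x y} → R x y → S (f x) (f y)) → ∀ {h x y} → Link R h x y → Link S h (f x) (f y)
link-map f f-inj rs L = record { at = f ∘ at ; start = cong f start ; end = cong f end
  ; inj = λ p q e → inj p q (f-inj e) ; step = λ i p → rs (step i p) }
  where open Link L

apex-cycle : ∀ {V : Set} {R : V → V → Set} → (∀ {u v} → R u v → R v u) → ∀ {h x y} (w : V) (L : Link R h x y) →
  R w x → R w y → (∀ i → i ≤ h → w ≢ Link.at L i) → Copy (Cycle (2 + h)) R
apex-cycle {V} {R} R-sym {h} w L wx wy w∉ = cycle-copy R-sym (suc h) f f-inj f-step (R-sym (subst (R w) (sym end) wy))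
  where
  open Link L
  f : ℕ → V
  f zero    = w
  f (suc i) = at i
  f-inj : ∀ {i j} → i ≤ suc h → j ≤ suc h → f i ≡ f j → i ≡ j
  f-inj {zero} {zero} _ _ _ = refl
  f-inj {zero} {suc j} _ (s≤s q) e = contradiction e (w∉ j q)
  f-inj {suc i} {zero} (s≤s p) _ e = contradiction (sym e) (w∉ i p)
  f-inj {suc i} {suc j} (s≤s p) (s≤s q) e = cong suc (inj p q e)
  f-step : ∀ i → i < suc h → R (f i) (f (suc i))
  f-step zero _ = subst (R w) (sym start) wx
  f-step (suc i) (s≤s p) = step i p

zig-link : ∀ {V : Set} {R : V → V → Set} (u v : ℕ → V) m → (∀ {a b} → a ≤ m → b ≤ m → u a ≡ u b → a ≡ b) →
  (∀ {a b} → a ≤ m → b ≤ m → v a ≡ v b → a ≡ b) → (∀ {a b} → a ≤ m → b ≤ m → u a ≢ v b) →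
  (∀ a → a ≤ m → R (u a) (v a)) → (∀ a → a < m → R (v a) (u (suc a))) → Link R (suc (m + m)) (u 0) (v m)
zig-link {R = R} u v m iu iv uv r s = record
  { at = zig u v ; start = refl ; end = zig-odd u v m
  ; inj = λ p q e → zig-injective u v (suc m) (λ p q → iu (≤-pred p) (≤-pred q)) (λ p q → iv (≤-pred p) (≤-pred q))
      (λ p q → uv (≤-pred p) (≤-pred q)) (bd p) (bd q) e
  ; step = λ i p → zig-step {R = R} u v (suc m) (λ a p → r a (≤-pred p)) (λ a p → s a (≤-pred p)) i (bd p) }
  where
  bd : ∀ {i} → i ≤ suc (m + m) → i < suc m + suc m
  bd p = s≤s (≤-trans p (≤-reflexive (sym (+-suc m m))))

link-cycle : ∀ {V : Set} {R : V → V → Set} → (∀ {u v} → R u v → R v u) → ∀ {h x y} → Link R h x y → R y x → Copy (Cycle (suc h)) R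
link-cycle {R = R} R-sym {h} L yx = cycle-copy R-sym h at inj step (subst₂ R (sym end) (sym start) yx)
  where open Link L

module _ {V W : Set} {d : ℕ} {A : V → V → Set} {nb : W → Fin d → V} (A-sym : ∀ {u v} → A u v → A v u)
  {c : V ⊎ W → V ⊎ W → Bool} (c-sym : ∀ x y → c x y ≡ c y x) {κ : Bool} where

  private
    R = Attach A nb ∧ᶜ c ≐ κ

  attach-sym : ∀ {x y} → R x y → R y x
  attach-sym {inj₁ _} {inj₁ _} (a , e) = A-sym a , trans (c-sym _ _) e
  attach-sym {inj₁ _} {inj₂ _} (a , e) = a , trans (c-sym _ _) e
  attach-sym {inj₂ _} {inj₁ _} (a , e) = a , trans (c-sym _ _) e

  linked-neighbours : ∀ {h} w i j → Link (A ∧ᶜ (λ u v → c (inj₁ u) (inj₁ v)) ≐ κ) h (nb w i) (nb w j) →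
    c (inj₂ w) (inj₁ (nb w i)) ≡ κ → c (inj₂ w) (inj₁ (nb w j)) ≡ κ → Copy (Cycle (2 + h)) R
  linked-neighbours w i j L ei ej = apex-cycle (λ {x} {y} → attach-sym {x} {y}) (inj₂ w)
    (link-map inj₁ inj₁-injective id L) ((i , refl) , ei) ((j , refl) , ej) λ _ _ ()

  -- the points p 0, …, p m, consecutive ones joined through distinct attached vertices
  alternating-cycle : ∀ m (p : ℕ → V) (w : ℕ → W) → (∀ {a b} → a ≤ m → b ≤ m → p a ≡ p b → a ≡ b) →
    (∀ {a b} → a ≤ m → b ≤ m → w a ≡ w b → a ≡ b) →
    (∀ a → a ≤ m → R (inj₂ (w a)) (inj₁ (p a))) → (∀ a → a < m → R (inj₂ (w a)) (inj₁ (p (suc a)))) →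
    R (inj₂ (w m)) (inj₁ (p 0)) → Copy (Cycle (suc m + suc m)) R
  alternating-cycle m p w ip iw r s close = subst (λ k → Copy (Cycle (suc k)) R) (sym (+-suc m m))
    (link-cycle (λ {x} {y} → attach-sym {x} {y})
      (zig-link (inj₁ ∘ p) (inj₂ ∘ w) m (λ p q e → ip p q (inj₁-injective e)) (λ p q e → iw p q (inj₂-injective e)) (λ _ _ ())
        (λ a q → attach-sym {inj₂ (w a)} {inj₁ (p a)} (r a q)) s) close)

module _ {I : Set} (I-finite : Finite I) {T : I → I → Set} (T? : ∀ i j → Dec (T i j))
  (T-sym : ∀ {i j} → T i j → T j i) (T-irrefl : ∀ {i} → ¬ T i i) (N : ℕ) where

  private
    blowup : Partite I T
    blowup = record { V = I × Fin (suc N) ; finite = finite-× I-finite (finite-Fin _) ; part = proj₁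
      ; A = λ x y → T (proj₁ x) (proj₁ y) ; A? = λ x y → T? _ _ ; A-sym = T-sym ; A-part = id }

    related : List (I × I)
    related = filter (uncurry T?) (cartesianProduct (elements I-finite) (elements I-finite))

    all-related : All (uncurry T) related
    all-related = All.tabulate λ m → proj₂ (Mem.∈-filter⁻ (uncurry T?) {xs = cartesianProduct (elements I-finite) (elements I-finite)} m)

  record BlowUp (D : Partite I T) (c : Partite.V D → Partite.V D → Bool) : Set where
    open Partite D
    field
      φ      : I → ℕ → V
      φ-inj  : ∀ {i j a b} → a ≤ N → b ≤ N → φ i a ≡ φ j b → i ≡ j × a ≡ b
      φ-edge : ∀ {i j} a b → T i j → A (φ i a) (φ j b)
      κ      : I → I → Bool
      mono   : ∀ {i j} a b → T i j → c (φ i a) (φ j b) ≡ κ i j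

  abstract
    -- The partite construction for the blow-up with `suc N` vertices in each part, all pairs of
    -- adjacent parts being listed.
    blow-up : Σ[ D ∈ Partite I T ] (∀ c → BlowUp D c)
    blow-up with partite-construction (≟-finite I-finite) T-sym T-irrefl blowup related all-related
    ... | D , arr , _ = D , λ c → let C , κ , mono = arr c in record
      { φ = λ i a → PartCopy.φ C (i , clamp N a)
      ; φ-inj = λ p q e → let e′ = PartCopy.φ-inj C e in cong proj₁ e′ ,
          trans (sym (toℕ-clamp (s≤s p))) (trans (cong (toℕ ∘ proj₂) e′) (toℕ-clamp (s≤s q)))
      ; φ-edge = λ a b t → PartCopy.φ-edge C t
      ; κ = κ
      ; mono = λ {i} {j} a b t → mono _ _ t
          (Mem.∈-filter⁺ (uncurry T?) (Mem.∈-cartesianProduct⁺ (∈-elements I-finite i) (∈-elements I-finite j)) t) }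

-- A gadget in which every d-tuple of base vertices is attached to some new vertex
record Base (H₁ H₂ : Graph) (d : ℕ) : Set₁ where
  field
    {V}      : Set
    V-finite : Finite V
    A        : V → V → Set
    A?       : ∀ u v → Dec (A u v)
    A-sym    : ∀ {u v} → A u v → A v u
    A-irrefl : ∀ {v} → ¬ A v v
    good     : V → V → Bool
    good-sym : ∀ u v → good u v ≡ good v u
    good₁    : ¬ Copy H₁ (A ∧ᶜ good ≐ true)
    good₂    : ¬ Copy H₂ (A ∧ᶜ good ≐ false)
  attached : V ⊎ Vec V d → V ⊎ Vec V d → Set
  attached = Attach A Vec.lookup
  field
    forced   : ∀ (c : V ⊎ Vec V d → V ⊎ Vec V d → Bool) → (∀ x y → c x y ≡ c y x) →
               Copy H₁ (attached ∧ᶜ c ≐ true) ⊎ Copy H₂ (attached ∧ᶜ c ≐ false)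

gadget : ∀ {H₁ H₂ d} → Base H₁ H₂ d → Gadget H₁ H₂ d
gadget {d = d} B = record { V-finite = V-finite ; W-finite = finite-Vec V-finite d ; A = A ; A? = A? ; A-sym = A-sym
  ; A-irrefl = A-irrefl ; nb = Vec.lookup ; good = good ; good-sym = good-sym ; good₁ = good₁ ; good₂ = good₂ ; forced = forced }
  where open Base B

not-false⇒true : ∀ {b} → b ≢ false → b ≡ true
not-false⇒true {true}  _ = refl
not-false⇒true {false} p = contradiction refl p

no-colour : ∀ {H} {V : Set} {A : V → V → Set} {c : V → V → Bool} {κ} → (∀ u v → c u v ≢ κ) → n H ≢ 0 → NoIsolated H →
  ¬ Copy H (A ∧ᶜ c ≐ κ)
no-colour {record { n = zero }} c≢ n≢0 _ _ = n≢0 refl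
no-colour {record { n = suc _ }} c≢ n≢0 no-iso (copy φ inj e) =
  let b , ab = no-iso zero in c≢ _ _ (proj₂ (e zero b ab))

-- The case of K_t and an even cycle

slot : ∀ {m} → Fin 2 → Fin m → Fin (2 * m)
slot {m} b i = combine {2} {m} b i

module _ {V : Set} {m : ℕ} where

  twoPerPart : (Fin 2 → Fin m → V) → Vec V (2 * m)
  twoPerPart F = tabulate (uncurry F ∘ remQuot m)

  lookup-twoPerPart : ∀ F b i → Vec.lookup (twoPerPart F) (slot b i) ≡ F b i
  lookup-twoPerPart F b i = trans (Vec.lookup∘tabulate _ (slot b i)) (cong (uncurry F) (Fin.remQuot-combine b i))

module CompleteEven (m M : ℕ) (1≤M : 1 ≤ M) where

  private
    T : Fin m → Fin m → Set
    T i j = i ≢ j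

    T? : ∀ i j → Dec (T i j)
    T? i j = ¬? (i Fin.≟ j)

    D = proj₁ (blow-up (finite-Fin m) T? (λ p → p ∘ sym) (λ p → p refl) M)
    D-blow-up = proj₂ (blow-up (finite-Fin m) T? (λ p → p ∘ sym) (λ p → p refl) M)
    ℓ = suc M + suc M

  open Partite D

  irrefl : ∀ {v} → ¬ A v v
  irrefl a = A-part a refl

  next : Fin (suc M) → ℕ
  next j = suc (toℕ j) % suc M

  module _ (c : V ⊎ Vec V (2 * m) → V ⊎ Vec V (2 * m) → Bool) (c-sym : ∀ x y → c x y ≡ c y x) where

    private
      cᵛ : V → V → Bool
      cᵛ u v = c (inj₁ u) (inj₁ v)
      R : Bool → V ⊎ Vec V (2 * m) → V ⊎ Vec V (2 * m) → Set
      R κ = Attach A Vec.lookup ∧ᶜ c ≐ κ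

    open BlowUp (D-blow-up cᵛ)

    blue-pair : ∀ {i j} → i ≢ j → κ i j ≡ false → Copy (Cycle ℓ) (R false)
    blue-pair {i} {j} i≢j e = subst (λ k → Copy (Cycle (suc k)) (R false)) (sym (+-suc M M))
      (link-cycle (λ {x} {y} → attach-sym A-sym c-sym {false} {x} {y}) (link-map inj₁ inj₁-injective id
        (zig-link (φ i) (φ j) M (λ p q r → proj₂ (φ-inj p q r)) (λ p q r → proj₂ (φ-inj p q r)) (λ p q r → i≢j (proj₁ (φ-inj p q r)))
          (λ a _ → edge a a) (λ a _ → R-sym (edge (suc a) a))))
        (R-sym (edge 0 M)))
      where
      edge : ∀ a b → (A ∧ᶜ cᵛ ≐ false) (φ i a) (φ j b)
      edge a b = φ-edge a b i≢j , trans (mono a b i≢j) e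
      R-sym : ∀ {u v} → (A ∧ᶜ cᵛ ≐ false) u v → (A ∧ᶜ cᵛ ≐ false) v u
      R-sym (a , e) = A-sym a , trans (c-sym _ _) e

    -- The points of part `i` form a circle, and such a `w` bridges point `j` and its successor in
    -- blue. Bridges at all `j` make up a blue cycle of length `ℓ`; a missing bridge means that no
    -- vertex attached there sees both points in blue.
    BluePair : Fin m → Fin (suc M) → Vec V (2 * m) → Set
    BluePair i j w = (Vec.lookup w (slot zero i) ≡ φ i (toℕ j) × c (inj₂ w) (inj₁ (φ i (toℕ j))) ≡ false) ×
                     (Vec.lookup w (slot (suc zero) i) ≡ φ i (next j) × c (inj₂ w) (inj₁ (φ i (next j))) ≡ false)

    bluePair? : ∀ i j → Dec (∃ (BluePair i j))
    bluePair? i j = any-finite? (finite-Vec finite (2 * m)) λ w →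
      (at? w zero (φ i (toℕ j)) ×-dec (_ Bool.≟ false)) ×-dec (at? w (suc zero) (φ i (next j)) ×-dec (_ Bool.≟ false))
      where
      at? : ∀ w b v → Dec (Vec.lookup w (slot b i) ≡ v)
      at? w b v = ≟-finite finite _ v

    blue-part : ∀ i → (∀ j → ∃ (BluePair i j)) → Copy (Cycle ℓ) (R false)
    blue-part i Q = alternating-cycle A-sym c-sym M (φ i) (λ a → proj₁ (Q (clamp M a)))
      (λ p q e → proj₂ (φ-inj p q e))
      -- The first slot of part `i` reveals which pair is bridged, so the bridges are distinct.
      (λ {a} {b} p q e → proj₂ (φ-inj p q (trans (sym (at₀ a p)) (trans (cong (λ v → Vec.lookup v (slot zero i)) e) (at₀ b q)))))
      (λ a p → (_ , at₀ a p) , subst (λ x → c (inj₂ (proj₁ (Q (clamp M a)))) (inj₁ (φ i x)) ≡ false) (toℕ-clamp (s≤s p)) (proj₂ (proj₁ (proj₂ (Q (clamp M a))))))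
      (λ a p → second a (suc a) (trans (cong (λ x → suc x % suc M) (toℕ-clamp (m≤n⇒m≤1+n p))) (m<n⇒m%n≡m (s≤s p))))
      (second M 0 (trans (cong (λ x → suc x % suc M) (toℕ-clamp (n<1+n M))) (n%n≡0 (suc M))))
      where
      at₀ : ∀ a → a ≤ M → Vec.lookup (proj₁ (Q (clamp M a))) (slot zero i) ≡ φ i a
      at₀ a p = trans (proj₁ (proj₁ (proj₂ (Q (clamp M a))))) (cong (φ i) (toℕ-clamp (s≤s p)))
      second : ∀ a b → next (clamp M a) ≡ b → R false (inj₂ (proj₁ (Q (clamp M a)))) (inj₁ (φ i b))
      second a _ refl = (_ , proj₁ (proj₂ (proj₂ (Q (clamp M a))))) , proj₂ (proj₂ (proj₂ (Q (clamp M a))))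

    -- The vertex whose tuple holds both ends of a missing bridge in every part sees at least one
    -- end of each in red. These ends lie in different parts and are joined in red.
    red-clique : (∀ i j → i ≢ j → κ i j ≡ true) → (f : Fin m → Fin (suc M)) → (∀ i → ¬ ∃ (BluePair i (f i))) →
      Copy (Complete (suc m)) (R true)
    red-clique κ-red f none = complete-copy (λ { {inj₁ v} (a , _) → irrefl a ; {inj₂ _} () }) ψ edge
      where
      F : Fin 2 → Fin m → V
      F zero    i = φ i (toℕ (f i))
      F (suc _) i = φ i (next (f i))
      w : Vec V (2 * m)
      w = twoPerPart F
      red : ∀ i → ∃[ b ] c (inj₂ w) (inj₁ (F b i)) ≡ true
      red i with c (inj₂ w) (inj₁ (F zero i)) in e₀ | c (inj₂ w) (inj₁ (F (suc zero) i)) in e₁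
      ... | true  | _     = zero , e₀
      ... | false | true  = suc zero , e₁
      ... | false | false = contradiction
        (w , (lookup-twoPerPart F zero i , e₀) , (lookup-twoPerPart F (suc zero) i , e₁)) (none i)
      copy-index : ∀ b i → ∃[ a ] F b i ≡ φ i a
      copy-index zero    i = _ , refl
      copy-index (suc _) i = _ , refl
      ψ : Fin (suc m) → V ⊎ Vec V (2 * m)
      ψ zero    = inj₂ w
      ψ (suc i) = inj₁ (F (proj₁ (red i)) i)
      w-edge : ∀ i → R true (inj₂ w) (inj₁ (F (proj₁ (red i)) i))
      w-edge i = (slot (proj₁ (red i)) i , lookup-twoPerPart F (proj₁ (red i)) i) , proj₂ (red i)
      edge : ∀ a b → a ≢ b → R true (ψ a) (ψ b)
      edge zero zero p = contradiction refl p
      edge zero (suc i) _ = w-edge i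
      edge (suc i) zero _ = attach-sym {A = A} {nb = Vec.lookup} (λ {u} {v} → A-sym {u} {v}) c-sym {true} {inj₂ w} {ψ (suc i)} (w-edge i)
      edge (suc i) (suc j) p with copy-index (proj₁ (red i)) i | copy-index (proj₁ (red j)) j
      ... | a , ea | b , eb = subst₂ (λ x y → R true (inj₁ x) (inj₁ y)) (sym ea) (sym eb)
        (φ-edge a b i≢j , trans (mono a b i≢j) (κ-red i j i≢j))
        where
        i≢j : i ≢ j
        i≢j = p ∘ cong suc

    forced : Copy (Complete (suc m)) (R true) ⊎ Copy (Cycle ℓ) (R false)
    forced with Fin.any? (λ i → Fin.any? λ j → T? i j ×-dec (κ i j Bool.≟ false))
    ... | yes (i , j , i≢j , e) = inj₂ (blue-pair i≢j e)
    ... | no ¬blue with Fin.any? (λ i → Fin.all? (bluePair? i))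
    ... | yes (i , Q) = inj₂ (blue-part i Q)
    ... | no ¬part = inj₁ (red-clique (λ i j p → not-false⇒true λ e → ¬blue (i , j , p , e)) (proj₁ ∘ miss) (proj₂ ∘ miss))
      where
      miss : ∀ i → ∃[ j ] ¬ ∃ (BluePair i j)
      miss i = Fin.¬∀⟶∃¬ (suc M) (∃ ∘ BluePair i) (bluePair? i) (λ Q → ¬part (i , Q))

  base : Base (Complete (suc m)) (Cycle ℓ) (2 * m)
  base = record { V-finite = finite ; A = A ; A? = A? ; A-sym = A-sym ; A-irrefl = irrefl
    ; good = λ _ _ → true ; good-sym = λ _ _ → refl
    ; good₁ = λ (copy ψ _ e) → 1+n≰n (Fin.injective⇒≤ {f = part ∘ ψ} λ {a} {b} q →
        decidable-stable (a Fin.≟ b) λ a≢b → A-part (proj₁ (e a b (complete-adj a b a≢b))) q)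
    ; good₂ = no-colour {Cycle ℓ} (λ _ _ ()) (λ ()) (cycle-noIsolated (M + suc M) (≤-trans 1≤M (m≤m+n M _)))
    ; forced = forced }

-- Even cycles through triples of points

tri : ℕ → ℕ → ℕ → ℕ → ℕ
tri a b c zero          = a
tri a b c (suc zero)    = b
tri a b c (suc (suc _)) = c

-- On a homogeneous sequence the colour of the edge from an increasing triple to one of its entries
-- depends on the position of the entry, so two of the three positions agree. Consecutive points of
-- the cycle are put at these two; the third entry makes the triples distinct.
module TripleCycle (M̂ : ℕ) where

  private
    L = 6 + 5 * M̂

  abstract
    points : ℕ
    points = proj₁ (ramsey-increasing 3 3 L)

    points-ramsey : ∀ (c : Fin 3 → List ℕ → Bool) → Σ[ h ∈ (ℕ → ℕ) ]
      (∀ i j → i < j → j < L → h i < h j) × (∀ j → j < L → h j < points) ×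
      Σ[ κ ∈ (Fin 3 → Bool) ] (∀ i f → Increasing 3 f → (∀ j → j < 3 → f j < L) → c i (applyUpTo (h ∘ f) 3) ≡ κ i)
    points-ramsey = proj₂ (ramsey-increasing 3 3 L)

  -- z is the position of the third index; x z < y z are the two other positions
  x y : Fin 3 → Fin 3
  x zero = suc zero
  x (suc _) = zero
  y zero = suc (suc zero)
  y (suc zero) = suc (suc zero)
  y (suc (suc _)) = suc zero

  arrange : Fin 3 → ℕ → ℕ → ℕ → ℕ → ℕ
  arrange zero          lo hi third = tri third lo hi
  arrange (suc zero)    lo hi third = tri lo third hi
  arrange (suc (suc _)) lo hi third = tri lo hi third

  equal-bits : (b : Fin 3 → Bool) → ∃[ z ] b (x z) ≡ b (y z)
  equal-bits b with b zero in e₀ | b (suc zero) in e₁ | b (suc (suc zero)) in e₂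
  ... | true  | true  | _     = suc (suc zero) , trans e₀ (sym e₁)
  ... | true  | false | true  = suc zero , trans e₀ (sym e₂)
  ... | true  | false | false = zero , trans e₁ (sym e₂)
  ... | false | false | _     = suc (suc zero) , trans e₀ (sym e₁)
  ... | false | true  | false = suc zero , trans e₀ (sym e₂)
  ... | false | true  | true  = zero , trans e₁ (sym e₂)

  arrange-x : ∀ z lo hi third → arrange z lo hi third (toℕ (x z)) ≡ lo
  arrange-x zero _ _ _ = refl
  arrange-x (suc zero) _ _ _ = refl
  arrange-x (suc (suc zero)) _ _ _ = refl

  arrange-y : ∀ z lo hi third → arrange z lo hi third (toℕ (y z)) ≡ hi
  arrange-y zero _ _ _ = refl
  arrange-y (suc zero) _ _ _ = refl
  arrange-y (suc (suc zero)) _ _ _ = refl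

  arrange-z : ∀ z lo hi third → arrange z lo hi third (toℕ z) ≡ third
  arrange-z zero _ _ _ = refl
  arrange-z (suc zero) _ _ _ = refl
  arrange-z (suc (suc zero)) _ _ _ = refl

  Ordered : Fin 3 → ℕ → ℕ → ℕ → Set
  Ordered zero          lo hi third = third < lo × lo < hi
  Ordered (suc zero)    lo hi third = lo < third × third < hi
  Ordered (suc (suc _)) lo hi third = lo < hi × hi < third

  tri-increasing : ∀ {a b c} → a < b → b < c → Increasing 3 (tri a b c)
  tri-increasing p q zero _ = p
  tri-increasing p q (suc zero) _ = q
  tri-increasing p q (suc (suc _)) (s≤s (s≤s (s≤s ())))

  arrange-increasing : ∀ z {lo hi third} → Ordered z lo hi third → Increasing 3 (arrange z lo hi third)
  arrange-increasing zero (p , q) = tri-increasing p q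
  arrange-increasing (suc zero) (p , q) = tri-increasing p q
  arrange-increasing (suc (suc zero)) (p , q) = tri-increasing p q

  tri-bound : ∀ {a b c K} → a < K → b < K → c < K → ∀ j → j < 3 → tri a b c j < K
  tri-bound p q r zero _ = p
  tri-bound p q r (suc zero) _ = q
  tri-bound p q r (suc (suc _)) _ = r

  arrange-bound : ∀ z {lo hi third K} → lo < K → hi < K → third < K → ∀ j → j < 3 → arrange z lo hi third j < K
  arrange-bound zero p q r = tri-bound r p q
  arrange-bound (suc zero) p q r = tri-bound p r q
  arrange-bound (suc (suc zero)) p q r = tri-bound p q r

  module _ {V : Set} {A : V → V → Set} (A-sym : ∀ {u v} → A u v → A v u)
    (c : V ⊎ Vec V 3 → V ⊎ Vec V 3 → Bool) (c-sym : ∀ x y → c x y ≡ c y x)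
    (q : ℕ → V) (q-inj : ∀ {i j} → i < points → j < points → q i ≡ q j → i ≡ j) where

    private
      R : Bool → V ⊎ Vec V 3 → V ⊎ Vec V 3 → Set
      R κ = Attach A Vec.lookup ∧ᶜ c ≐ κ

    -- One triple with two equally coloured edges: given a path of that colour between the two
    -- points, it closes an odd cycle as well.
    SamePair : Bool → Set
    SamePair κ = ∃₂ λ i j → i < points × j < points × i ≢ j × Σ[ w ∈ Vec V 3 ] ∃₂ λ a b →
      (Vec.lookup w a ≡ q i × c (inj₂ w) (inj₁ (q i)) ≡ κ) × (Vec.lookup w b ≡ q j × c (inj₂ w) (inj₁ (q j)) ≡ κ)

    triple-cycles : ∃[ κ ] SamePair κ × (∀ M → 1 ≤ M → M ≤ M̂ → Copy (Cycle (suc M + suc M)) (R κ))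
    triple-cycles = b (x z) , same , cycle
      where
      tuple : List ℕ → Vec V 3
      tuple zs = tabulate λ a → q (nth zs (toℕ a))
      ram = points-ramsey λ a zs → c (inj₂ (tuple zs)) (inj₁ (q (nth zs (toℕ a))))
      h = proj₁ ram
      h-mono = proj₁ (proj₂ ram)
      h-bound = proj₁ (proj₂ (proj₂ ram))
      b = proj₁ (proj₂ (proj₂ (proj₂ ram)))
      hom = proj₂ (proj₂ (proj₂ (proj₂ ram)))
      z = proj₁ (equal-bits b)
      bits = proj₂ (equal-bits b)
      h-inj : ∀ {i j} → i < L → j < L → h i ≡ h j → i ≡ j
      h-inj = increasing⇒injective h h-mono
      qh-inj : ∀ {i j} → i < L → j < L → q (h i) ≡ q (h j) → i ≡ j
      qh-inj p r e = h-inj p r (q-inj (h-bound _ p) (h-bound _ r) e)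
      vertex : (ℕ → ℕ) → Vec V 3
      vertex f = tuple (applyUpTo (h ∘ f) 3)
      at : ∀ f (a : Fin 3) → Vec.lookup (vertex f) a ≡ q (h (f (toℕ a)))
      at f a = trans (Vec.lookup∘tabulate (λ a → q (nth (applyUpTo (h ∘ f) 3) (toℕ a))) a) (cong q (nth-applyUpTo (h ∘ f) 3 (toℕ a) (Fin.toℕ<n a)))
      joined : ∀ {lo hi th} → Ordered z lo hi th → lo < L → hi < L → th < L → let w = vertex (arrange z lo hi th) in
        R (b (x z)) (inj₂ w) (inj₁ (q (h lo))) × R (b (x z)) (inj₂ w) (inj₁ (q (h hi)))
      joined {lo} {hi} {th} o p r s = edge (x z) lo (arrange-x z lo hi th) refl , edge (y z) hi (arrange-y z lo hi th) (sym bits)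
        where
        f = arrange z lo hi th
        edge : ∀ a v → f (toℕ a) ≡ v → b a ≡ b (x z) → R (b (x z)) (inj₂ (vertex f)) (inj₁ (q (h v)))
        edge a _ refl e = (a , at f a) , trans (cong (λ k → c (inj₂ (vertex f)) (inj₁ (q k)))
          (sym (nth-applyUpTo (h ∘ f) 3 (toℕ a) (Fin.toℕ<n a))))
          (trans (hom a f (arrange-increasing z o) (arrange-bound z p r s)) e)
      same : SamePair (b (x z))
      same = go z refl
        where
        sp : ∀ lo hi th → Ordered z lo hi th → lo < L → hi < L → th < L → lo ≢ hi → SamePair (b (x z))
        sp lo hi th o p r s lo≢hi = let ((a , ea) , ca) , ((a′ , eb) , cb) = joined o p r s in
          h lo , h hi , h-bound lo p , h-bound hi r , (λ e → lo≢hi (h-inj p r e)) , vertex (arrange z lo hi th) , a , a′ , (ea , ca) , (eb , cb)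
        lt : ∀ i → i ≤ 5 → i < L
        lt i i≤5 = s≤s (≤-trans i≤5 (m≤m+n 5 _))
        go : ∀ z′ → z ≡ z′ → SamePair (b (x z))
        go zero e = sp 1 2 0 (subst (λ s → Ordered s 1 2 0) (sym e) (s≤s z≤n , ≤-refl)) (lt 1 (s≤s z≤n)) (lt 2 (s≤s (s≤s z≤n))) (lt 0 z≤n) λ ()
        go (suc zero) e = sp 0 2 1 (subst (λ s → Ordered s 0 2 1) (sym e) (s≤s z≤n , ≤-refl)) (lt 0 z≤n) (lt 2 (s≤s (s≤s z≤n))) (lt 1 (s≤s z≤n)) λ ()
        go (suc (suc zero)) e = sp 0 1 2 (subst (λ s → Ordered s 0 1 2) (sym e) (s≤s z≤n , ≤-refl)) (lt 0 z≤n) (lt 1 (s≤s z≤n)) (lt 2 (s≤s (s≤s z≤n))) λ ()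
      cycle : ∀ M → 1 ≤ M → M ≤ M̂ → Copy (Cycle (suc M + suc M)) (R (b (x z)))
      cycle M 1≤M M≤ = alternating-cycle A-sym c-sym M (λ a → q (h (Q a))) w
        (λ p r e → Q-inj (qh-inj (Q-bd p) (Q-bd r) e)) w-inj
        (λ a p → proj₁ (proj₂ (edges a p))) (λ a p → proj₂ (proj₂ (edges a (<⇒≤ p))) p) (proj₁ (edges M ≤-refl) refl)
        where
        -- The offset leaves `suc M` smaller indices and the spacing 3 leaves two indices between
        -- neighbouring points, as room for the third entries.
        Q : ℕ → ℕ
        Q a = suc M + 3 * a
        lo hi : ℕ → ℕ
        lo s = if ⌊ s <? M ⌋ then Q s else Q 0
        hi s = if ⌊ s <? M ⌋ then Q (suc s) else Q M
        -- In the middle position the closing triple takes `Q 0 + 2`, because `Q 0 + 1` belongs to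
        -- the triple with `s = 0`.
        third : Fin 3 → ℕ → ℕ
        third zero          s = s
        third (suc zero)    s = if ⌊ s <? M ⌋ then suc (Q s) else suc (suc (Q 0))
        third (suc (suc _)) s = suc (Q M + s)
        w : ℕ → Vec V 3
        w s = vertex (arrange z (lo s) (hi s) (third z s))
        Q-inj : ∀ {a a′} → Q a ≡ Q a′ → a ≡ a′
        Q-inj e = *-cancelˡ-≡ _ _ 3 (+-cancelˡ-≡ (suc M) _ _ e)
        top : ∀ s → s ≤ M → suc (Q M + s) < L
        top s p = s≤s (≤-trans (s≤s (+-monoʳ-≤ (Q M) p))
          (≤-trans (≤-reflexive (eq M)) (+-mono-≤ {2} {5} (s≤s (s≤s z≤n)) (*-monoʳ-≤ 5 M≤))))
          where
          eq : ∀ M → suc (suc M + 3 * M + M) ≡ 2 + 5 * M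
          eq = solve-∀
        Q-bd : ∀ {a} → a ≤ M → Q a < L
        Q-bd p = ≤-<-trans (≤-trans (+-monoʳ-≤ (suc M) (*-monoʳ-≤ 3 p)) (≤-trans (m≤m+n (Q M) 0) (n≤1+n _))) (top 0 z≤n)
        Q-suc : ∀ a → Q (suc a) ≡ 3 + Q a
        Q-suc = λ a → eq M a
          where
          eq : ∀ M a → suc M + 3 * suc a ≡ 3 + (suc M + 3 * a)
          eq = solve-∀
        Q-mono : ∀ {a a′} → a < a′ → 3 + Q a ≤ Q a′
        Q-mono {a} p = ≤-trans (≤-reflexive (sym (Q-suc a))) (+-monoʳ-≤ (suc M) (*-monoʳ-≤ 3 p))
        third-bd : ∀ s → s ≤ M → third z s < L
        third-bd s p = go z
          where
          go : ∀ z → third z s < L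
          go zero = ≤-<-trans (≤-trans (m≤n+m s (Q M)) (n≤1+n _)) (top s p)
          go (suc zero) with s <? M
          ... | yes s<M = ≤-<-trans (≤-trans (s≤s (m≤n+m (Q s) 2)) (Q-mono s<M)) (Q-bd ≤-refl)
          ... | no _ = ≤-<-trans (≤-trans (n≤1+n _) (Q-mono 1≤M)) (Q-bd ≤-refl)
          go (suc (suc _)) = top s p
        ordered : ∀ s → s ≤ M → Ordered z (lo s) (hi s) (third z s)
        ordered s p = go z
          where
          go : ∀ z → Ordered z (lo s) (hi s) (third z s)
          go zero with s <? M
          ... | yes s<M = s≤s (≤-trans p (m≤m+n M _)) , ≤-trans (s≤s (m≤n+m (Q s) 2)) (Q-mono ≤-refl)
          ... | no _ = s≤s (≤-trans p (m≤m+n M _)) , ≤-trans (s≤s (m≤n+m (Q 0) 2)) (Q-mono 1≤M)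
          go (suc zero) with s <? M
          ... | yes s<M = ≤-refl , ≤-trans (n≤1+n _) (Q-mono ≤-refl)
          ... | no _ = n≤1+n _ , Q-mono 1≤M
          go (suc (suc _)) with s <? M
          ... | yes s<M = ≤-trans (s≤s (m≤n+m (Q s) 2)) (Q-mono ≤-refl) , s≤s (≤-trans (+-monoʳ-≤ (suc M) (*-monoʳ-≤ 3 s<M)) (m≤m+n _ s))
          ... | no _ = ≤-trans (s≤s (m≤n+m (Q 0) 2)) (Q-mono 1≤M) , s≤s (m≤m+n _ s)
        lo-bd : ∀ s → s ≤ M → lo s < L
        lo-bd s p with s <? M
        ... | yes _ = Q-bd p
        ... | no _ = Q-bd z≤n
        hi-bd : ∀ s → s ≤ M → hi s < L
        hi-bd s p with s <? M
        ... | yes s<M = Q-bd s<M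
        ... | no _ = Q-bd ≤-refl
        off-grid : ∀ s → Q s ≢ suc (Q 0)
        off-grid zero    = <⇒≢ (n<1+n (Q 0))
        off-grid (suc s) = <⇒≢ (≤-trans (n≤1+n _) (Q-mono {0} {suc s} (s≤s z≤n))) ∘ sym
        third-inj : ∀ {s s′} → s ≤ M → s′ ≤ M → third z s ≡ third z s′ → s ≡ s′
        third-inj {s} {s′} p p′ = go z
          where
          go : ∀ z → third z s ≡ third z s′ → s ≡ s′
          go zero e = e
          go (suc zero) e with s <? M | s′ <? M
          ... | yes _ | yes _ = Q-inj (suc-injective e)
          ... | yes _ | no _ = contradiction (suc-injective e) (off-grid s)
          ... | no _ | yes _ = contradiction (sym (suc-injective e)) (off-grid s′)
          ... | no ¬p | no ¬p′ = trans (≤-antisym p (≮⇒≥ ¬p)) (≤-antisym (≮⇒≥ ¬p′) p′)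
          go (suc (suc _)) e = +-cancelˡ-≡ (suc (Q M)) _ _ e
        w-inj : ∀ {s s′} → s ≤ M → s′ ≤ M → w s ≡ w s′ → s ≡ s′
        w-inj {s} {s′} p p′ e = third-inj p p′ (qh-inj (third-bd s p) (third-bd s′ p′)
          (trans (sym (at-third s)) (trans (cong (λ v → Vec.lookup v z) e) (at-third s′))))
          where
          at-third : ∀ s → Vec.lookup (w s) z ≡ q (h (third z s))
          at-third s = trans (at (arrange z (lo s) (hi s) (third z s)) z) (cong (q ∘ h) (arrange-z z (lo s) (hi s) (third z s)))
        Edge : ℕ → ℕ → Set
        Edge s v = R (b (x z)) (inj₂ (w s)) (inj₁ (q (h v)))
        edges : ∀ s → s ≤ M → (s ≡ M → Edge s (Q 0)) × Edge s (Q s) × (s < M → Edge s (Q (suc s)))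
        edges s p = [ before , last ]′ (m≤n⇒m<n∨m≡n p)
          where
          J = joined (ordered s p) (lo-bd s p) (hi-bd s p) (third-bd s p)
          before : s < M → (s ≡ M → Edge s (Q 0)) × Edge s (Q s) × (s < M → Edge s (Q (suc s)))
          before s<M = (λ e → contradiction e (<⇒≢ s<M)) ,
            subst (Edge s) (cong (λ t → if t then Q s else Q 0) (⇒does (s <? M) s<M)) (proj₁ J) ,
            λ _ → subst (Edge s) (cong (λ t → if t then Q (suc s) else Q M) (⇒does (s <? M) s<M)) (proj₂ J)
          last : s ≡ M → (s ≡ M → Edge s (Q 0)) × Edge s (Q s) × (s < M → Edge s (Q (suc s)))
          last e = (λ _ → subst (Edge s) (cong (λ t → if t then Q s else Q 0) (⇒¬does (s <? M) (<-irrefl e))) (proj₁ J)) ,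
            subst (Edge s) (trans (cong (λ t → if t then Q (suc s) else Q M) (⇒¬does (s <? M) (<-irrefl e))) (cong Q (sym e))) (proj₂ J) ,
            λ s<M → contradiction s<M (<-irrefl e)

-- Two even cycles

-- The base is a set of points without edges: whichever colour the two agreeing positions have, the
-- alternating cycles of that colour reach every even length up to the larger of the two, starting
-- from 4.
module EvenEven (M M′ : ℕ) (1≤M : 1 ≤ M) (1≤M′ : 1 ≤ M′) where

  open TripleCycle (M ⊔ M′)

  private
    A : Fin (suc points) → Fin (suc points) → Set
    A _ _ = ⊥

    no-edges : ∀ m → 1 ≤ m → ∀ {c κ} → ¬ Copy (Cycle (suc m)) (A ∧ᶜ c ≐ κ)
    no-edges m 1≤m cp = proj₁ (ClosedWalk.step (cycle-walk m 1≤m cp) 0 (s≤s z≤n))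

    q-inj : ∀ {i j} → i < points → j < points → clamp points i ≡ clamp points j → i ≡ j
    q-inj p q e = trans (sym (toℕ-clamp (m≤n⇒m≤1+n p))) (trans (cong toℕ e) (toℕ-clamp (m≤n⇒m≤1+n q)))

    forced : ∀ (c : Fin (suc points) ⊎ Vec (Fin (suc points)) 3 → Fin (suc points) ⊎ Vec (Fin (suc points)) 3 → Bool) →
      (∀ x y → c x y ≡ c y x) → Copy (Cycle (suc M + suc M)) (Attach A Vec.lookup ∧ᶜ c ≐ true) ⊎
        Copy (Cycle (suc M′ + suc M′)) (Attach A Vec.lookup ∧ᶜ c ≐ false)
    forced c c-sym = result (triple-cycles {A = A} (λ {u} {v} ()) c c-sym (clamp points) q-inj)
      where
      result : _ → _
      result (true  , _ , cycles) = inj₁ (cycles M 1≤M (m≤m⊔n M M′))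
      result (false , _ , cycles) = inj₂ (cycles M′ 1≤M′ (m≤n⊔m M M′))

  base : Base (Cycle (suc M + suc M)) (Cycle (suc M′ + suc M′)) 3
  base = record { V-finite = finite-Fin (suc points) ; A = A ; A? = λ _ _ → no λ () ; A-sym = λ {u} {v} () ; A-irrefl = λ ()
    ; good = λ _ _ → true ; good-sym = λ _ _ → refl
    ; good₁ = no-edges (M + suc M) (≤-trans 1≤M (m≤m+n M _)) ; good₂ = no-edges (M′ + suc M′) (≤-trans 1≤M′ (m≤m+n M′ _))
    ; forced = forced }

-- An even and an odd cycle

-- The number `b` clamped to the interval of radius `t` about `a`: the place reached after `t` unit
-- steps from `a` towards `b`, with rest on arrival.
towards : ℕ → ℕ → ℕ → ℕ
towards t a b = (a + t) ℕ.⊓ (b ⊔ (a ∸ t))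

towards-0 : ∀ a b → towards 0 a b ≡ a
towards-0 a b = trans (cong (ℕ._⊓ (b ⊔ a)) (+-identityʳ a)) (m≤n⇒m⊓n≡m (m≤n⊔m b a))

towards-end : ∀ t a b → b ≤ a + t → a ≤ b + t → towards t a b ≡ b
towards-end t a b p q = trans (cong ((a + t) ℕ.⊓_) (m≥n⇒m⊔n≡m (m≤n+o⇒m∸n≤o a t (≤-trans q (≤-reflexive (+-comm b t)))))) (m≥n⇒m⊓n≡n p)

towards-refl : ∀ t a → towards t a a ≡ a
towards-refl t a = towards-end t a a (m≤m+n a t) (m≤m+n a t)

towards-≤ : ∀ t a b K → a ≤ K → b ≤ K → towards t a b ≤ K
towards-≤ t a b K p q = ≤-trans (m⊓n≤n (a + t) _) (⊔-lub q (≤-trans (m∸n≤m a t) p))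

towards-up : ∀ t a b → towards (suc t) a b ≤ suc (towards t a b)
towards-up t a b = ⊓-mono-≤ (≤-reflexive (+-suc a t)) (≤-trans (⊔-monoʳ-≤ b (∸-monoʳ-≤ a (n≤1+n t))) (n≤1+n _))

towards-down : ∀ t a b → towards t a b ≤ suc (towards (suc t) a b)
towards-down t a b = ⊓-mono-≤ (≤-trans (+-monoʳ-≤ a (n≤1+n t)) (n≤1+n _))
  (⊔-lub (≤-trans (m≤m⊔n b _) (n≤1+n _)) (≤-trans (m∸n≤1+m∸[1+n] a t) (s≤s (m≤n⊔m b (a ∸ suc t)))))
  where
  m∸n≤1+m∸[1+n] : ∀ m n → m ∸ n ≤ suc (m ∸ suc n)
  m∸n≤1+m∸[1+n] zero n = ≤-trans (≤-reflexive (0∸n≡0 n)) z≤n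
  m∸n≤1+m∸[1+n] (suc m) zero = ≤-refl
  m∸n≤1+m∸[1+n] (suc m) (suc n) = m∸n≤1+m∸[1+n] m n

-- The walk may repeat elements of `I`; fresh copies in the blow-up make it a path, with ends known
-- in advance.
walk-link : ∀ {V I : Set} {R : V → V → Set} {N h} (φ : I → ℕ → V) →
  (∀ {i j a b} → a ≤ N → b ≤ N → φ i a ≡ φ j b → i ≡ j × a ≡ b) → h ≤ N → (x : ℕ → I) → x 0 ≢ x h →
  (∀ t a b → R (φ (x t) a) (φ (x (suc t)) b)) → Link R h (φ (x 0) 0) (φ (x h) 0)
walk-link {V} {I} {R} {N} {h} φ φ-inj h≤N x ends step = record
  { at = λ t → φ (x t) (idx t) ; start = cong (φ (x 0)) idx-0 ; end = cong (φ (x h)) idx-h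
  ; inj = λ p q e → let x≡ , a≡ = φ-inj (idx-≤ p) (idx-≤ q) e in idx-inj a≡ x≡
  ; step = λ t _ → step t (idx t) (idx (suc t)) }
  where
  -- the copies are numbered by t, except that both ends are copy 0
  idx : ℕ → ℕ
  idx t with t ≟ h
  ... | yes _ = 0
  ... | no _  = t
  idx-h : idx h ≡ 0
  idx-h with h ≟ h
  ... | yes _ = refl
  ... | no p  = contradiction refl p
  idx-0 : idx 0 ≡ 0
  idx-0 with 0 ≟ h
  ... | yes _ = refl
  ... | no _  = refl
  idx-≤ : ∀ {t} → t ≤ h → idx t ≤ N
  idx-≤ {t} p with t ≟ h
  ... | yes _ = z≤n
  ... | no _  = ≤-trans p h≤N
  idx-inj : ∀ {s t} → idx s ≡ idx t → x s ≡ x t → s ≡ t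
  idx-inj {s} {t} e w with s ≟ h | t ≟ h
  ... | yes p | yes p′ = trans p (sym p′)
  ... | yes p | no _ = ⊥-elim (ends (trans (cong x e) (trans (sym w) (cong x p))))
  ... | no _ | yes p = ⊥-elim (ends (trans (cong x (sym e)) (trans w (cong x p))))
  ... | no _ | no _ = e

-- T-adjacency means being almost antipodal in the sup norm, all points lying on a sphere of radius r about the
-- centre (r , … , r) of the cube [0 , 2r]^(N × N).  A closed walk of odd length would bring a point within that
-- length of its own antipode, at distance 2r.
module EvenOdd (M q : ℕ) (1≤M : 1 ≤ M) (1≤q : 1 ≤ q) where

  open TripleCycle M

  private
    N r K h : ℕ
    N = suc points
    -- Then `K` is `2q + 4`: a coordinate that starts at 0 is at most `2q + 2` after `2q + 2` steps,
    -- but the closing step back to 0 asks for at least `K - 1`.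
    r = 2 + q
    K = r + r
    h = suc (q + q)

    I : Set
    I = Vec (Vec (Fin (suc K)) N) N

    I-finite : Finite I
    I-finite = finite-Vec (finite-Vec (finite-Fin _) _) _

    coord : I → Fin N → Fin N → ℕ
    coord x a b = toℕ (Vec.lookup (Vec.lookup x a) b)

    Opposite : ℕ → ℕ → Set
    Opposite s t = K ≤ suc (s + t) × s + t ≤ suc K

    Near : I → I → Set
    Near x y = ∀ a b → Opposite (coord x a b) (coord y a b)

    Extreme : I → Set
    Extreme x = ∃₂ λ a b → coord x a b ≡ 0 ⊎ coord x a b ≡ K

    T : I → I → Set
    T x y = Near x y × Extreme x × Extreme y

    extreme? : ∀ x → Dec (Extreme x)
    extreme? x = Fin.any? λ a → Fin.any? λ b → (coord x a b ≟ 0) ⊎-dec (coord x a b ≟ K)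

    T? : ∀ x y → Dec (T x y)
    T? x y = (Fin.all? λ a → Fin.all? λ b → (K ≤? _) ×-dec (_ ≤? suc K)) ×-dec extreme? x ×-dec extreme? y

    T-sym : ∀ {x y} → T x y → T y x
    T-sym {x} {y} (n , ex , ey) = (λ a b → let p , p′ = n a b in
      subst (λ s → K ≤ suc s) (+-comm (coord x a b) _) p , subst (_≤ suc K) (+-comm (coord x a b) _) p′) , ey , ex

    T-irrefl : ∀ {x} → ¬ T x x
    T-irrefl {x} (n , (a , b , e) , _) with coord x a b | n a b
    T-irrefl (n , (a , b , inj₁ refl) , _) | _ | s≤s () , _
    T-irrefl (n , (a , b , inj₂ refl) , _) | _ | _ , p = <⇒≱ (+-monoˡ-< K {1} {K} (s≤s (s≤s z≤n))) p

    no-short-odd-walk : ¬ ClosedWalk T (2 + h)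
    no-short-odd-walk W = [ at-zero , at-K ]′ (proj₂ (proj₂ ext))
      where
      open ClosedWalk W
      ext = proj₁ (proj₂ (step 0 (s≤s z≤n)))
      s : ℕ → ℕ
      s t = coord (at t) (proj₁ ext) (proj₁ (proj₂ ext))
      opp : ∀ t → t < 2 + h → Opposite (s t) (s (suc t))
      opp t p = proj₁ (step t p) (proj₁ ext) (proj₁ (proj₂ ext))
      two-up : ∀ t → suc t < 2 + h → s (suc (suc t)) ≤ 2 + s t
      two-up t p = +-cancelˡ-≤ (s (suc t)) _ _ (≤-trans (proj₂ (opp (suc t) p))
        (≤-trans (s≤s (proj₁ (opp t (<-trans (n<1+n _) p)))) (≤-reflexive (eq (s t) (s (suc t))))))
        where
        eq : ∀ a b → suc (suc (a + b)) ≡ b + (2 + a)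
        eq = solve-∀
      two-down : ∀ t → suc t < 2 + h → s t ≤ 2 + s (suc (suc t))
      two-down t p = +-cancelʳ-≤ (s (suc t)) _ _ (≤-trans (proj₂ (opp t (<-trans (n<1+n _) p)))
        (≤-trans (s≤s (proj₁ (opp (suc t) p))) (≤-reflexive (eq (s (suc t)) (s (suc (suc t)))))))
        where
        eq : ∀ a b → suc (suc (a + b)) ≡ 2 + b + a
        eq = solve-∀
      drift : ∀ a → a + a ≤ suc h → s (a + a) ≤ s 0 + (a + a) × s 0 ≤ s (a + a) + (a + a)
      drift zero p = m≤m+n _ 0 , m≤m+n _ 0
      drift (suc a) p = subst (λ x → s (suc x) ≤ s 0 + (suc a + suc a) × s 0 ≤ s (suc x) + (suc a + suc a)) (sym (+-suc a a))
        (≤-trans (two-up (a + a) p′) (≤-trans (+-monoʳ-≤ 2 (proj₁ rec)) (≤-reflexive (eq (s 0) a))) ,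
         ≤-trans (proj₂ rec) (≤-trans (+-monoˡ-≤ (a + a) (two-down (a + a) p′)) (≤-reflexive (eq (s (suc (suc (a + a)))) a))))
        where
        eq : ∀ x a → 2 + (x + (a + a)) ≡ x + (suc a + suc a)
        eq = solve-∀
        p′ : suc (a + a) < 2 + h
        p′ = s≤s (≤-trans (≤-reflexive (sym (+-suc a a))) (≤-trans (n≤1+n _) p))
        rec = drift a (≤-trans (+-mono-≤ (n≤1+n a) (n≤1+n a)) p)
      2a : suc q + suc q ≡ suc h
      2a = cong suc (+-suc q q)
      d = drift (suc q) (≤-reflexive 2a)
      last : Opposite (s (suc q + suc q)) (s 0)
      last = subst₂ (λ x y → Opposite (s x) y) (sym 2a) (cong (λ x → coord x (proj₁ ext) (proj₁ (proj₂ ext))) close) (opp (suc h) ≤-refl)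
      at-zero : s 0 ≡ 0 → ⊥
      at-zero e = <⇒≱ (≤-reflexive (eq q)) (≤-trans (proj₁ last)
        (s≤s (≤-trans (≤-reflexive (trans (cong (s (suc q + suc q) +_) e) (+-identityʳ _))) (≤-trans (proj₁ d) (+-monoˡ-≤ _ (≤-reflexive e))))))
        where
        eq : ∀ q → suc (suc (suc q + suc q)) ≡ 2 + q + (2 + q)
        eq = solve-∀
      at-K : s 0 ≡ K → ⊥
      at-K e = <⇒≱ {2 + s (suc q + suc q)} {4} low high
        where
        s′ = s (suc q + suc q)
        high : 4 ≤ 2 + s′
        high = +-cancelʳ-≤ (q + q) _ _ (≤-trans (≤-reflexive (eq q)) (≤-trans (≤-reflexive (sym e)) (≤-trans (proj₂ d) (≤-reflexive (eq′ q s′)))))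
          where
          eq : ∀ q → 4 + (q + q) ≡ 2 + q + (2 + q)
          eq = solve-∀
          eq′ : ∀ q x → x + (suc q + suc q) ≡ 2 + x + (q + q)
          eq′ = solve-∀
        low : 2 + s′ < 4
        low = s≤s (s≤s (s≤s (+-cancelʳ-≤ K _ _ (≤-trans (≤-reflexive (cong (s′ +_) (sym e))) (proj₂ last)))))

    data Level : Set where
      low mid high : Level

    value : Level → ℕ
    value low  = 0
    value mid  = r
    value high = K

    opposite : Level → Level
    opposite low  = high
    opposite mid  = mid
    opposite high = low

    value-≤ : ∀ l → value l ≤ K
    value-≤ low  = z≤n
    value-≤ mid  = m≤m+n r r
    value-≤ high = ≤-refl

    value-opposite : ∀ l → K ∸ value (opposite l) ≡ value l
    value-opposite low  = n∸n≡0 K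
    value-opposite mid  = m+n∸n≡m r r
    value-opposite high = refl

    r≤h : r ≤ h
    r≤h = s≤s (+-monoˡ-≤ q 1≤q)

    -- The two excluded pairs are those at distance `K`. All others are at distance 0 or `r`, and
    -- `r ≤ h` since `q ≥ 1`.
    reach : ∀ l l′ → (l ≡ high → l′ ≢ high) → (l ≡ low → l′ ≢ low) →
      value (opposite l′) ≤ value l + h × value l ≤ value (opposite l′) + h
    reach low  low  _ ¬low = contradiction refl (¬low refl)
    reach low  mid  _ _ = r≤h , z≤n
    reach low  high _ _ = z≤n , z≤n
    reach mid  low  _ _ = +-monoʳ-≤ r r≤h , ≤-trans (m≤m+n r r) (m≤m+n K h)
    reach mid  mid  _ _ = m≤m+n r h , m≤m+n r h
    reach mid  high _ _ = z≤n , r≤h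
    reach high low  _ _ = m≤m+n K h , m≤m+n K h
    reach high mid  _ _ = ≤-trans (m≤m+n r r) (m≤m+n K h) , +-monoʳ-≤ r r≤h
    reach high high ¬high _ = contradiction refl (¬high refl)

    -- In the array of branch `i`, row `i` is high and column `i` is low, except on the diagonal. So
    -- two branches never share a high or a low entry, and at `(i , j)` branch `i` is high while
    -- branch `j` is low.
    level : Fin N → Fin N → Fin N → Level
    level i a b with a Fin.≟ i | b Fin.≟ i
    ... | yes _ | yes _ = mid
    ... | yes _ | no _  = high
    ... | no _  | yes _ = low
    ... | no _  | no _  = mid

    level-high : ∀ {i a b} → level i a b ≡ high → a ≡ i
    level-high {i} {a} {b} e with a Fin.≟ i | b Fin.≟ i
    ... | yes p | _     = p
    ... | no _  | yes _ = contradiction e λ ()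
    ... | no _  | no _  = contradiction e λ ()

    level-low : ∀ {i a b} → level i a b ≡ low → b ≡ i
    level-low {i} {a} {b} e with a Fin.≟ i | b Fin.≟ i
    ... | _     | yes p = p
    ... | yes _ | no _  = contradiction e λ ()
    ... | no _  | no _  = contradiction e λ ()

    level-row : ∀ {i j} → i ≢ j → level i i j ≡ high
    level-row {i} {j} i≢j with i Fin.≟ i | j Fin.≟ i
    ... | no p | _ = contradiction refl p
    ... | yes _ | yes q = contradiction (sym q) i≢j
    ... | yes _ | no _ = refl

    level-column : ∀ {i j} → i ≢ j → level j i j ≡ low
    level-column {i} {j} i≢j with i Fin.≟ j | j Fin.≟ j
    ... | yes p | _ = contradiction p i≢j
    ... | no _ | yes _ = refl
    ... | no _ | no q = contradiction refl q

    array : (Fin N → Fin N → ℕ) → I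
    array f = tabulate λ a → tabulate λ b → clamp K (f a b)

    coord-array : ∀ f → (∀ a b → f a b ≤ K) → ∀ a b → coord (array f) a b ≡ f a b
    coord-array f bd a b = trans (cong toℕ (trans (cong (λ v → Vec.lookup v b) (Vec.lookup∘tabulate (λ a → tabulate λ b → clamp K (f a b)) a))
      (Vec.lookup∘tabulate (λ b → clamp K (f a b)) b))) (toℕ-clamp (s≤s (bd a b)))

    array-cong : ∀ {f g} → (∀ a b → f a b ≡ g a b) → array f ≡ array g
    array-cong e = Vec.tabulate-cong λ a → Vec.tabulate-cong λ b → cong (clamp K) (e a b)

    branch : Fin N → I
    branch i = array λ a b → value (level i a b)

    branch-injective : ∀ {i j} → branch i ≡ branch j → i ≡ j
    branch-injective {i} {j} e = decidable-stable (i Fin.≟ j) λ i≢j → contradiction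
      (trans (sym (at i (level-row i≢j))) (trans (cong (λ x → coord x i j) e) (at j (level-column i≢j)))) λ ()
      where
      at : ∀ k {l} → level k i j ≡ l → coord (branch k) i j ≡ value l
      at k {l} e = trans (coord-array (λ a b → value (level k a b)) (λ a b → value-≤ (level k a b)) i j) (cong value e)

    parity : ℕ → Bool
    parity zero    = true
    parity (suc t) = not (parity t)

    parity-odd : ∀ a → parity (suc (a + a)) ≡ false
    parity-odd zero = refl
    parity-odd (suc a) = trans (cong (not ∘ not ∘ parity) (+-suc a a)) (trans (Bool.not-involutive _) (parity-odd a))

    flip : Bool → ℕ → ℕ
    flip true  s = s
    flip false s = K ∸ s

    flip-≤ : ∀ b {s} → s ≤ K → flip b s ≤ K
    flip-≤ true  p = p
    flip-≤ false {s} p = m∸n≤m K s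

    flip-opposite : ∀ b {s t} → s ≤ K → t ≤ K → s ≤ suc t → t ≤ suc s → Opposite (flip b s) (flip (not b) t)
    flip-opposite true {s} {t} p p′ q q′ = lower , upper
      where
      lower : K ≤ suc (s + (K ∸ t))
      lower = ≤-trans (≤-reflexive (sym (m+[n∸m]≡n p′))) (+-monoˡ-≤ (K ∸ t) q′)
      upper : s + (K ∸ t) ≤ suc K
      upper = ≤-trans (+-monoˡ-≤ (K ∸ t) q) (s≤s (≤-reflexive (m+[n∸m]≡n p′)))
    flip-opposite false {s} {t} p p′ q q′ with l , u ← flip-opposite true p′ p q′ q =
      subst (λ x → K ≤ suc x) (+-comm t _) l , subst (_≤ suc K) (+-comm t _) u

    module _ {i j : Fin N} (i≢j : i ≢ j) where

      -- A straight walk from branch `i` to the antipode of branch `j`. Reflecting it at odd times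
      -- turns unit steps into almost antipodal ones, and as `h` is odd it then ends at branch `j`
      -- itself.
      z : ℕ → Fin N → Fin N → ℕ
      z t a b = towards t (value (level i a b)) (value (opposite (level j a b)))

      z-≤ : ∀ t a b → z t a b ≤ K
      z-≤ t a b = towards-≤ t _ _ K (value-≤ (level i a b)) (value-≤ (opposite (level j a b)))

      walk : ℕ → I
      walk t = array λ a b → flip (parity t) (z t a b)

      walk-coord : ∀ t a b → coord (walk t) a b ≡ flip (parity t) (z t a b)
      walk-coord t = coord-array (λ a b → flip (parity t) (z t a b)) (λ a b → flip-≤ (parity t) (z-≤ t a b))

      walk-start : walk 0 ≡ branch i
      walk-start = array-cong λ a b → towards-0 (value (level i a b)) (value (opposite (level j a b)))

      walk-end : walk h ≡ branch j
      walk-end = array-cong λ a b → trans (cong₂ flip (parity-odd q)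
        (towards-end h (value (level i a b)) (value (opposite (level j a b))) (proj₁ (reachable a b)) (proj₂ (reachable a b)))) (value-opposite (level j a b))
        where
        reachable : ∀ a b → value (opposite (level j a b)) ≤ value (level i a b) + h × value (level i a b) ≤ value (opposite (level j a b)) + h
        reachable a b = reach (level i a b) (level j a b) (λ e e′ → i≢j (trans (sym (level-high {i} {a} {b} e)) (level-high {j} {a} {b} e′)))
          (λ e e′ → i≢j (trans (sym (level-low {i} {a} {b} e)) (level-low {j} {a} {b} e′)))

      -- The entry `(i , j)` is `K` at branch `i` and at the antipode of branch `j`, so it rests
      -- there before reflection and keeps the walk on the sphere.
      walk-extreme : ∀ t → Extreme (walk t)
      walk-extreme t = i , j , go (parity t) (trans (walk-coord t i j) (cong (flip (parity t)) fixed))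
        where
        fixed : z t i j ≡ K
        fixed = trans (cong₂ (λ l l′ → towards t (value l) (value (opposite l′))) (level-row i≢j) (level-column i≢j)) (towards-refl t K)
        go : ∀ b → coord (walk t) i j ≡ flip b K → coord (walk t) i j ≡ 0 ⊎ coord (walk t) i j ≡ K
        go true  e = inj₂ e
        go false e = inj₁ (trans e (n∸n≡0 K))

      walk-step : ∀ t → T (walk t) (walk (suc t))
      walk-step t = (λ a b → subst₂ Opposite (sym (walk-coord t a b)) (sym (walk-coord (suc t) a b))
        (flip-opposite (parity t) (z-≤ t a b) (z-≤ (suc t) a b) (towards-down t (value (level i a b)) (value (opposite (level j a b))))
          (towards-up t (value (level i a b)) (value (opposite (level j a b)))))) , walk-extreme t , walk-extreme (suc t)

    D = proj₁ (blow-up I-finite T? (λ {x} {y} → T-sym {x} {y}) (λ {x} → T-irrefl {x}) (h + M))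
    D-blow-up = proj₂ (blow-up I-finite T? (λ {x} {y} → T-sym {x} {y}) (λ {x} → T-irrefl {x}) (h + M))

  open Partite D

  private module _ (c : V ⊎ Vec V 3 → V ⊎ Vec V 3 → Bool) (c-sym : ∀ x y → c x y ≡ c y x) where

    cᵛ : V → V → Bool
    cᵛ u v = c (inj₁ u) (inj₁ v)
    R : Bool → V ⊎ Vec V 3 → V ⊎ Vec V 3 → Set
    R κ = Attach A Vec.lookup ∧ᶜ c ≐ κ

    open BlowUp (D-blow-up cᵛ)

    red-pair : ∀ {x y} → T x y → κ x y ≡ true → Copy (Cycle (suc M + suc M)) (R true)
    red-pair {x} {y} t e = subst (λ k → Copy (Cycle (suc k)) (R true)) (sym (+-suc M M))
      (link-cycle (λ {x} {y} → attach-sym A-sym c-sym {true} {x} {y}) (link-map inj₁ inj₁-injective id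
        (zig-link (φ x) (φ y) M (λ p q r → proj₂ (φ-inj (M≤ p) (M≤ q) r)) (λ p q r → proj₂ (φ-inj (M≤ p) (M≤ q) r))
          (λ p q r → T-irrefl {x} (subst (T x) (sym (proj₁ (φ-inj (M≤ p) (M≤ q) r))) t))
          (λ a _ → edge a a) (λ a _ → R-sym (edge (suc a) a))))
        (R-sym (edge 0 M)))
      where
      M≤ : ∀ {a} → a ≤ M → a ≤ h + M
      M≤ p = ≤-trans p (m≤n+m M h)
      edge : ∀ a b → (A ∧ᶜ cᵛ ≐ true) (φ x a) (φ y b)
      edge a b = φ-edge a b t , trans (mono a b t) e
      R-sym : ∀ {u v} → (A ∧ᶜ cᵛ ≐ true) u v → (A ∧ᶜ cᵛ ≐ true) v u
      R-sym (a , e) = A-sym a , trans (c-sym _ _) e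

    point : ℕ → V
    point i = φ (branch (clamp points i)) 0

    point-injective : ∀ {i j} → i < points → j < points → point i ≡ point j → i ≡ j
    point-injective p q e = trans (sym (toℕ-clamp (m≤n⇒m≤1+n p))) (trans (cong toℕ (branch-injective (proj₁ (φ-inj z≤n z≤n e)))) (toℕ-clamp (m≤n⇒m≤1+n q)))

    blue-link : (∀ {x y} → T x y → κ x y ≡ false) → ∀ {i j} → i ≢ j → Link (A ∧ᶜ cᵛ ≐ false) h (φ (branch i) 0) (φ (branch j) 0)
    blue-link blue {i} {j} i≢j = subst₂ (λ x y → Link (A ∧ᶜ cᵛ ≐ false) h (φ x 0) (φ y 0)) (walk-start i≢j) (walk-end i≢j)
      (walk-link φ φ-inj (m≤m+n h M) (walk i≢j)
        (λ e → i≢j (branch-injective (trans (sym (walk-start i≢j)) (trans e (walk-end i≢j)))))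
        (λ t a b → φ-edge a b (walk-step i≢j t) , trans (mono a b (walk-step i≢j t)) (blue (walk-step i≢j t))))

    -- One red pair of adjacent parts already contains the red even cycle. Otherwise every two
    -- branch points are joined by a blue path of length `h`, and the triples on them yield either
    -- the red cycle or two blue edges that close such a path.
    forced : Copy (Cycle (suc M + suc M)) (R true) ⊎ Copy (Cycle (2 + h)) (R false)
    forced = by-colour (any-finite? I-finite λ x → any-finite? I-finite λ y → T? x y ×-dec (κ x y Bool.≟ true))
      where
      by-pair : (∀ {x y} → T x y → κ x y ≡ false) → ∃[ κ ] SamePair {A = A} A-sym c c-sym point point-injective κ ×
        (∀ M′ → 1 ≤ M′ → M′ ≤ M → Copy (Cycle (suc M′ + suc M′)) (R κ)) → Copy (Cycle (suc M + suc M)) (R true) ⊎ Copy (Cycle (2 + h)) (R false)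
      by-pair blue (true , _ , cycles) = inj₁ (cycles M 1≤M ≤-refl)
      by-pair blue (false , (i , j , i< , j< , i≢j , w , a , b , (ea , ca) , (eb , cb)) , _) = inj₂
        (linked-neighbours A-sym c-sym w a b
          (subst₂ (Link (A ∧ᶜ cᵛ ≐ false) h) (sym ea) (sym eb) (blue-link blue
            (λ e → i≢j (trans (sym (toℕ-clamp (m≤n⇒m≤1+n i<))) (trans (cong toℕ e) (toℕ-clamp (m≤n⇒m≤1+n j<)))))))
          (trans (cong (λ v → c (inj₂ w) (inj₁ v)) ea) ca) (trans (cong (λ v → c (inj₂ w) (inj₁ v)) eb) cb))
      by-colour : Dec (∃₂ λ x y → T x y × κ x y ≡ true) → Copy (Cycle (suc M + suc M)) (R true) ⊎ Copy (Cycle (2 + h)) (R false)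
      by-colour (yes (x , y , t , e)) = inj₁ (red-pair t e)
      by-colour (no ¬red) = by-pair (λ {x} {y} t → Bool.¬-not λ e → ¬red (x , y , t , e))
        (triple-cycles A-sym c c-sym point point-injective)

  base : Base (Cycle (suc M + suc M)) (Cycle (2 + h)) 3
  base = record { V-finite = finite ; A = A ; A? = A? ; A-sym = A-sym ; A-irrefl = λ {v} a → T-irrefl {part v} (A-part a)
    ; good = λ _ _ → false ; good-sym = λ _ _ → refl
    ; good₁ = no-colour {Cycle (suc M + suc M)} (λ _ _ ()) (λ ()) (cycle-noIsolated (M + suc M) (≤-trans 1≤M (m≤m+n M _)))
    ; good₂ = λ cp → let W = cycle-walk (suc h) (s≤s z≤n) cp in no-short-odd-walk record
        { at = part ∘ ClosedWalk.at W ; step = λ i p → A-part (proj₁ (ClosedWalk.step W i p)) ; close = cong part (ClosedWalk.close W) }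
    ; forced = forced }

-- Lower bounds

module _ {m : ℕ} (E : Fin (suc m) → Fin (suc m) → Bool) (v : Fin (suc m)) where

  private
    G = record { n = suc m ; E = E }

  -- the extension of a colouring of G - v that gives the edge vx colour 1 and the other edges at v colour 0
  module Extend (c : Fin m → Fin m → Fin 2) (c-sym : ∀ a b → c a b ≡ c b a) (x : Fin (suc m)) where

    colourAt : Fin (suc m) → Fin 2
    colourAt b = if ⌊ b Fin.≟ x ⌋ then suc zero else zero

    ext : Fin (suc m) → Fin (suc m) → Fin 2
    ext a b with v Fin.≟ a | v Fin.≟ b
    ... | yes _  | _      = colourAt b
    ... | no _   | yes _  = colourAt a
    ... | no v≢a | no v≢b = c (punchOut v≢a) (punchOut v≢b)

    ext-sym : ∀ a b → ext a b ≡ ext b a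
    ext-sym a b with v Fin.≟ a | v Fin.≟ b
    ... | yes refl | yes refl = refl
    ... | yes _    | no _     = refl
    ... | no _     | yes _    = refl
    ... | no _     | no _     = c-sym _ _

    ext-v : ∀ b → ext v b ≡ colourAt b
    ext-v b with v Fin.≟ v | v Fin.≟ b
    ... | yes _ | _ = refl
    ... | no p  | _ = contradiction refl p

    ext-old : ∀ {a b} (v≢a : v ≢ a) (v≢b : v ≢ b) → ext a b ≡ c (punchOut v≢a) (punchOut v≢b)
    ext-old {a} {b} v≢a v≢b with v Fin.≟ a | v Fin.≟ b
    ... | yes p | _     = contradiction p v≢a
    ... | no _  | yes p = contradiction p v≢b
    ... | no _  | no _  = cong₂ c (Fin.punchOut-cong v refl) (Fin.punchOut-cong v refl)

    colourAt-1 : ∀ {b} → colourAt b ≡ suc zero → b ≡ x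
    colourAt-1 {b} e with b Fin.≟ x
    ... | yes p = p

    colourAt-0 : ∀ {b} → colourAt b ≡ zero → b ≢ x
    colourAt-0 {b} e with b Fin.≟ x
    ... | no p = p

    copy-avoiding : ∀ {H i} (C : Copy H (Coloured G ext i)) → (∀ a → Copy.vertex C a ≢ v) → Copy H (Coloured (deleteVertex E v) c i)
    copy-avoiding (copy φ inj e) φ≢v = copy (λ a → punchOut (φ≢v a ∘ sym)) (λ {a} {b} q → inj (Fin.punchOut-injective (φ≢v a ∘ sym) (φ≢v b ∘ sym) q))
      λ a b ab → let g , q = e a b ab in
        deleteVertex-adj⁻ E v (subst₂ (Adj G) (sym (Fin.punchIn-punchOut _)) (sym (Fin.punchIn-punchOut _)) g) ,
        trans (sym (ext-old (φ≢v a ∘ sym) (φ≢v b ∘ sym))) q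

  -- It suffices to choose, for each colouring of G - v, a vertex x such that the extended colouring has no new monochromatic copy.
  extend-ramsey : ∀ {H₁ H₂} → IsRamseyMinimal 2 (pair H₁ H₂) G →
    (∀ c (s : ∀ a b → c a b ≡ c b a) → (∃[ i ] Copy (pair H₁ H₂ i) (Coloured (deleteVertex E v) c i)) ⊎
      ∃[ x ] (∀ i (C : Copy (pair H₁ H₂ i) (Coloured G (Extend.ext c s x) i)) a → Copy.vertex C a ≢ v)) → ⊥
  extend-ramsey {H₁} {H₂} (R , minimal) choose = minimal (deleteVertex E v) (punchIn v) (deleteVertex-embedding E v)
    (inj₁ (v , Fin.punchInᵢ≢i v)) λ (c , s) → found c s (choose c s)
    where
    found : ∀ c (s : ∀ a b → c a b ≡ c b a) → _ ⊎ _ → ∃[ i ] MonoCopy (deleteVertex E v) c i (pair H₁ H₂ i)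
    found c s (inj₁ (i , C)) = i , toMonoCopy (deleteVertex E v) c {H = pair H₁ H₂ i} C
    found c s (inj₂ (x , avoid)) with R (Extend.ext c s x , Extend.ext-sym c s x)
    ... | i , mc = let C = fromMonoCopy G (Extend.ext c s x) {H = pair H₁ H₂ i} mc in
      i , toMonoCopy (deleteVertex E v) c {H = pair H₁ H₂ i} (Extend.copy-avoiding c s x C (avoid i C))

two-neighbours : ∀ m → 2 ≤ m → (a : Fin (suc m)) → ∃₂ λ b b′ → b ≢ b′ × Adj (Cycle (suc m)) a b × Adj (Cycle (suc m)) a b′
two-neighbours m 2≤m a = clamp m (suc (toℕ a)) , proj₁ (previous a) , proj₁ (proj₂ (previous a)) ,
  subst (λ b → Adj (Cycle (suc m)) b (clamp m (suc (toℕ a)))) clamp-a (cycle-next m 1≤m (toℕ a) (Fin.toℕ<n a)) , proj₂ (proj₂ (previous a))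
  where
  1≤m = <⇒≤ 2≤m
  clamp-a : ∀ {a : Fin (suc m)} → clamp m (toℕ a) ≡ a
  clamp-a {a} = Fin.toℕ-injective (toℕ-clamp (Fin.toℕ<n a))
  previous : ∀ a → ∃[ b ] clamp m (suc (toℕ a)) ≢ b × Adj (Cycle (suc m)) a b
  previous zero = clamp m m , (λ e → <⇒≢ 2≤m (trans (sym (toℕ-clamp {m} (s≤s 1≤m))) (trans (cong toℕ e) (toℕ-clamp (n<1+n m))))) ,
    adj-sym (Cycle (suc m)) {clamp m m} {zero} (subst (Adj (Cycle (suc m)) (clamp m m))
      (Fin.toℕ-injective (trans (toℕ-mod m (suc m)) (n%n≡0 (suc m)))) (cycle-next m 1≤m m (n<1+n m)))
  previous (suc j) = clamp m (toℕ j) , (λ e → distinct (trans (sym (toℕ-mod m (suc (suc (toℕ j))))) (trans (cong toℕ e) (toℕ-clamp j<)))) ,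
    adj-sym (Cycle (suc m)) {clamp m (toℕ j)} {suc j} (subst (Adj (Cycle (suc m)) (clamp m (toℕ j))) (clamp-a {suc j}) (cycle-next m 1≤m (toℕ j) j<))
    where
    j< : toℕ j < suc m
    j< = m≤n⇒m≤1+n (Fin.toℕ<n j)
    distinct : suc (suc (toℕ j)) % suc m ≢ toℕ j
    distinct e with m≤n⇒m<n∨m≡n (Fin.toℕ<n j)
    ... | inj₁ p = <⇒≢ (n≤1+n _) (trans (sym e) (m<n⇒m%n≡m (s≤s p)))
    ... | inj₂ p = <⇒≢ (≤-pred (≤-trans 2≤m (≤-reflexive (sym p)))) (trans (sym (n%n≡0 (suc m))) (trans (cong (λ x → suc x % suc m) (sym p)) e))

-- A cycle through `v` has two edges there. Colour 1 occurs at `v` at most on the edge to `x`, and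
-- two edges of colour 0 lead to two neighbours besides `x`, which makes three.
cycle-lower : ∀ k l → 2 ≤ k → 2 ≤ l → ∀ G → IsRamseyMinimal 2 (pair (Cycle (suc k)) (Cycle (suc l))) G → ∀ v → 3 ≤ deg G v
cycle-lower k l 2≤k 2≤l G@record { n = suc m ; E = E } M v = decidable-stable (3 ≤? deg G v) λ ¬3≤ → extend-ramsey E v M λ c s →
  inj₂ (x , λ i C a e → through ¬3≤ c s i C a e)
  where
  neighbour? : Dec (∃ (Adj G v))
  neighbour? = Fin.any? (adj? G v)
  pick : Dec (∃ (Adj G v)) → Fin (suc m)
  pick (yes (b , _)) = b
  -- Reached only for an isolated `v`, through which no cycle passes.
  pick (no _)        = v
  x = pick neighbour?
  x-adj : ∀ (d : Dec (∃ (Adj G v))) {b} → Adj G v b → Adj G v (pick d)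
  x-adj (yes (_ , a)) _ = a
  x-adj (no ¬a) a = contradiction (_ , a) ¬a
  module _ (¬3≤ : ¬ 3 ≤ deg G v) (c : Fin m → Fin m → Fin 2) (s : ∀ a b → c a b ≡ c b a) where
    open Extend E v c s x
    at-v : ∀ {H i} (C : Copy H (Coloured G ext i)) {a b} → Copy.vertex C a ≡ v → Adj H a b →
      Adj G v (Copy.vertex C b) × colourAt (Copy.vertex C b) ≡ i
    at-v C {a} {b} e ab with g , q ← Copy.edge C a b ab rewrite e = g , trans (sym (ext-v _)) q
    through′ : ∀ r i (C : Copy (Cycle (suc r)) (Coloured G ext i)) a → 2 ≤ r → Copy.vertex C a ≢ v
    through′ r i C a 2≤r e with b , b′ , b≢b′ , ab , ab′ ← two-neighbours r 2≤r a = by-colour i (at-v C e ab) (at-v C e ab′)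
      where
      φ = Copy.vertex C
      by-colour : ∀ i → Adj G v (φ b) × colourAt (φ b) ≡ i → Adj G v (φ b′) × colourAt (φ b′) ≡ i → ⊥
      by-colour (suc zero) (_ , p) (_ , p′) = b≢b′ (Copy.injective C (trans (colourAt-1 p) (sym (colourAt-1 p′))))
      by-colour zero (g , p) (g′ , p′) = ¬3≤ (deg-≥ G v three three-inj three-adj)
        where
        three : Fin 3 → Fin (suc m)
        three zero = x
        three (suc zero) = φ b
        three (suc (suc zero)) = φ b′
        three-adj : ∀ i → Adj G v (three i)
        three-adj zero = x-adj neighbour? g
        three-adj (suc zero) = g
        three-adj (suc (suc zero)) = g′
        three-inj : Injective _≡_ _≡_ three
        three-inj {zero} {zero} _ = refl
        three-inj {zero} {suc zero} q = contradiction (sym q) (colourAt-0 p)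
        three-inj {zero} {suc (suc zero)} q = contradiction (sym q) (colourAt-0 p′)
        three-inj {suc zero} {zero} q = contradiction q (colourAt-0 p)
        three-inj {suc zero} {suc zero} _ = refl
        three-inj {suc zero} {suc (suc zero)} q = contradiction (Copy.injective C q) b≢b′
        three-inj {suc (suc zero)} {zero} q = contradiction q (colourAt-0 p′)
        three-inj {suc (suc zero)} {suc zero} q = contradiction (sym (Copy.injective C q)) b≢b′
        three-inj {suc (suc zero)} {suc (suc zero)} _ = refl
    through : ∀ i (C : Copy (pair (Cycle (suc k)) (Cycle (suc l)) i) (Coloured G ext i)) a → Copy.vertex C a ≢ v
    through zero C a = through′ k zero C a 2≤k
    through (suc zero) C a = through′ l (suc zero) C a 2≤l

-- Hajnal's lemma on maximum cliques

module _ {n : ℕ} where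

  infix 4 _∋_ _⊑_
  _∋_ : Subset n → Fin n → Set
  p ∋ x = Vec.lookup p x ≡ true

  _⊑_ : Subset n → Subset n → Set
  p ⊑ q = ∀ x → p ∋ x → q ∋ x

  ∩-intro : ∀ p q {x} → p ∋ x → q ∋ x → p ∩ q ∋ x
  ∩-intro p q {x} a b = trans (Vec.lookup-zipWith _∧_ x p q) (cong₂ _∧_ a b)

  ∩-elim : ∀ p q {x} → p ∩ q ∋ x → p ∋ x × q ∋ x
  ∩-elim p q {x} a = Bool.∧-conicalˡ _ _ e , Bool.∧-conicalʳ _ _ e
    where e = trans (sym (Vec.lookup-zipWith _∧_ x p q)) a

  ∪-left : ∀ p q {x} → p ∋ x → p ∪ q ∋ x
  ∪-left p q {x} a = trans (Vec.lookup-zipWith _∨_ x p q) (cong (_∨ Vec.lookup q x) a)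

  ∪-elim : ∀ p q {x} → p ∪ q ∋ x → p ∋ x ⊎ q ∋ x
  ∪-elim p q {x} a with Vec.lookup p x | trans (sym (Vec.lookup-zipWith _∨_ x p q)) a
  ... | true  | _ = inj₁ refl
  ... | false | e = inj₂ e

inclusion-exclusion : ∀ {n} (p q : Subset n) → ∣ p ∪ q ∣ + ∣ p ∩ q ∣ ≡ ∣ p ∣ + ∣ q ∣
inclusion-exclusion [] [] = refl
inclusion-exclusion (true ∷ p) (true ∷ q) = cong suc (trans (+-suc _ _) (trans (cong suc (inclusion-exclusion p q)) (sym (+-suc _ _))))
inclusion-exclusion (true ∷ p) (false ∷ q) = cong suc (inclusion-exclusion p q)
inclusion-exclusion (false ∷ p) (true ∷ q) = trans (cong suc (inclusion-exclusion p q)) (sym (+-suc _ _))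
inclusion-exclusion (false ∷ p) (false ∷ q) = inclusion-exclusion p q

enum : ∀ {n} (p : Subset n) → Fin ∣ p ∣ → Fin n
enum (true ∷ p)  zero    = zero
enum (true ∷ p)  (suc i) = suc (enum p i)
enum (false ∷ p) i       = suc (enum p i)

enum-injective : ∀ {n} (p : Subset n) → Injective _≡_ _≡_ (enum p)
enum-injective (true ∷ p)  {zero}  {zero}  _ = refl
enum-injective (true ∷ p)  {suc _} {suc _} e = cong suc (enum-injective p (Fin.suc-injective e))
enum-injective (false ∷ p) e = enum-injective p (Fin.suc-injective e)

enum-∋ : ∀ {n} (p : Subset n) i → p ∋ enum p i
enum-∋ (true ∷ p)  zero    = refl
enum-∋ (true ∷ p)  (suc i) = enum-∋ p i
enum-∋ (false ∷ p) i       = enum-∋ p i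

rank : ∀ {n} (p : Subset n) x → p ∋ x → ∃[ i ] enum p i ≡ x
rank (true ∷ p)  zero    _ = zero , refl
rank (true ∷ p)  (suc x) a = let i , e = rank p x a in suc i , cong suc e
rank (false ∷ p) (suc x) a = let i , e = rank p x a in i , cong suc e

injection-≤ : ∀ {n s} (p : Subset n) (ψ : Fin s → Fin n) → Injective _≡_ _≡_ ψ → (∀ a → p ∋ ψ a) → s ≤ ∣ p ∣
injection-≤ p ψ inj m = Fin.injective⇒≤ {f = λ a → proj₁ (rank p (ψ a) (m a))} λ {a} {b} e →
  inj (trans (sym (proj₂ (rank p (ψ a) (m a)))) (trans (cong (enum p) e) (proj₂ (rank p (ψ b) (m b)))))

⊑-card : ∀ {n} (p q : Subset n) → p ⊑ q → ∣ p ∣ ≤ ∣ q ∣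
⊑-card p q s = injection-≤ q (enum p) (enum-injective p) (λ a → s _ (enum-∋ p a))

image : ∀ {n s} → (Fin s → Fin n) → Subset n
image ψ = tabulate λ x → ⌊ Fin.any? (λ a → ψ a Fin.≟ x) ⌋

image-∋ : ∀ {n s} (ψ : Fin s → Fin n) a → image ψ ∋ ψ a
image-∋ ψ a = trans (Vec.lookup∘tabulate _ (ψ a)) (⇒does (Fin.any? (λ b → ψ b Fin.≟ ψ a)) (a , refl))

image-elim : ∀ {n s} (ψ : Fin s → Fin n) x → image ψ ∋ x → ∃[ a ] ψ a ≡ x
image-elim ψ x m = does⇒ (Fin.any? (λ a → ψ a Fin.≟ x)) (trans (sym (Vec.lookup∘tabulate _ x)) m)

image-card : ∀ {n s} (ψ : Fin s → Fin n) → Injective _≡_ _≡_ ψ → ∣ image ψ ∣ ≡ s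
image-card {s = s} ψ inj = ≤-antisym
  (Fin.injective⇒≤ {f = λ i → proj₁ (pre i)} λ {i} {j} e → enum-injective (image ψ) (trans (sym (proj₂ (pre i))) (trans (cong ψ e) (proj₂ (pre j)))))
  (injection-≤ (image ψ) ψ inj (image-∋ ψ))
  where
  pre : ∀ i → ∃[ a ] ψ a ≡ enum (image ψ) i
  pre i = image-elim ψ _ (enum-∋ (image ψ) i)

module Hajnal {n : ℕ} (R : Fin n → Fin n → Set) (R? : ∀ a b → Dec (R a b)) (R-sym : ∀ {a b} → R a b → R b a)
  (P : Fin n → Set) (P? : ∀ a → Dec (P a)) (s : ℕ) where

  Clique : Subset n → Set
  Clique p = (∀ a b → p ∋ a → p ∋ b → a ≢ b → R a b) × (∀ a → p ∋ a → P a)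

  Maximum : Subset n → Set
  Maximum p = Clique p × ∣ p ∣ ≡ s

  maximum? : ∀ p → Dec (Maximum p)
  maximum? p = ((Fin.all? λ a → Fin.all? λ b → (_ Bool.≟ _) →-dec ((_ Bool.≟ _) →-dec (¬? (a Fin.≟ b) →-dec R? a b))) ×-dec
    (Fin.all? λ a → (_ Bool.≟ _) →-dec P? a)) ×-dec (∣ p ∣ ≟ s)

  module _ (bounded : ∀ p → Clique p → ∣ p ∣ ≤ s) where

    -- invariant: I is joined to all of U, where I and U are the intersection and union of the cliques so far
    record State (Ks : List (Subset n)) : Set where
      field
        I U    : Subset n
        I⊑U    : I ⊑ U
        I⊑Ks   : ∀ K → K ∈ Ks → I ⊑ K
        U-P    : ∀ a → U ∋ a → P a
        joined : ∀ a b → I ∋ a → U ∋ b → a ≢ b → R a b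
        large  : s + s ≤ ∣ I ∣ + ∣ U ∣

    -- The set `Q` is a clique, as `I` is joined to `U` and `U ∩ K` lies in the clique `K`; so `Q`
    -- has at most `s` elements. By inclusion and exclusion for `I`, `U ∩ K` and for `U`, `K`, the
    -- sizes of intersection and union do not decrease in sum.
    extend : ∀ {Ks K} → Maximum K → State Ks → State (K ∷ Ks)
    extend {Ks} {K} ((K-clique , K-P) , K-size) S = record
      { I = I ∩ K ; U = U ∪ K
      ; I⊑U = λ x a → ∪-left U K (I⊑U x (proj₁ (∩-elim I K a)))
      ; I⊑Ks = λ { L (here refl) x a → proj₂ (∩-elim I K a) ; L (there m) x a → I⊑Ks L m x (proj₁ (∩-elim I K a)) }
      ; U-P = λ x a → [ U-P x , K-P x ]′ (∪-elim U K a)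
      ; joined = λ a b ia ub a≢b → let p , q = ∩-elim I K ia in [ (λ u → joined a b p u a≢b) , (λ k → K-clique a b q k a≢b) ]′ (∪-elim U K ub)
      ; large = ≤-trans large (+-cancelʳ-≤ (s + ∣ U ∩ K ∣) _ _ count) }
      where
      open State S
      Q = I ∪ (U ∩ K)
      Q-clique : Clique Q
      meet : ∀ {a} → U ∩ K ∋ a → U ∋ a × K ∋ a
      meet = ∩-elim U K
      Q-clique = pairwise , λ a qa → [ U-P a ∘ I⊑U a , K-P a ∘ proj₂ ∘ meet ]′ (∪-elim I (U ∩ K) qa)
        where
        pairwise : ∀ a b → Q ∋ a → Q ∋ b → a ≢ b → R a b
        pairwise a b qa qb a≢b with ∪-elim I (U ∩ K) qa | ∪-elim I (U ∩ K) qb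
        ... | inj₁ ia | inj₁ ib = joined a b ia (I⊑U b ib) a≢b
        ... | inj₁ ia | inj₂ kb = joined a b ia (proj₁ (meet kb)) a≢b
        ... | inj₂ ka | inj₁ ib = R-sym (joined b a ib (proj₁ (meet ka)) (a≢b ∘ sym))
        ... | inj₂ ka | inj₂ kb = K-clique a b (proj₂ (meet ka)) (proj₂ (meet kb)) a≢b
      count : ∣ I ∣ + ∣ U ∣ + (s + ∣ U ∩ K ∣) ≤ ∣ I ∩ K ∣ + ∣ U ∪ K ∣ + (s + ∣ U ∩ K ∣)
      count = begin
        ∣ I ∣ + ∣ U ∣ + (s + ∣ U ∩ K ∣)                          ≡⟨ e₁ (∣ I ∣) (∣ U ∣) s (∣ U ∩ K ∣) ⟩
        ∣ I ∣ + ∣ U ∩ K ∣ + (∣ U ∣ + s)                          ≡⟨ cong₂ _+_ (sym (inclusion-exclusion I (U ∩ K)))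
                                                                     (trans (cong (∣ U ∣ +_) (sym K-size)) (sym (inclusion-exclusion U K))) ⟩
        ∣ Q ∣ + ∣ I ∩ (U ∩ K) ∣ + (∣ U ∪ K ∣ + ∣ U ∩ K ∣)        ≤⟨ +-monoˡ-≤ _ (+-mono-≤ (bounded Q Q-clique) (⊑-card (I ∩ (U ∩ K)) (I ∩ K)
                                                                     λ x a → ∩-intro I K (proj₁ (∩-elim I _ a)) (proj₂ (∩-elim U K (proj₂ (∩-elim I _ a)))))) ⟩
        s + ∣ I ∩ K ∣ + (∣ U ∪ K ∣ + ∣ U ∩ K ∣)                  ≡⟨ e₂ s (∣ I ∩ K ∣) (∣ U ∪ K ∣) (∣ U ∩ K ∣) ⟩
        ∣ I ∩ K ∣ + ∣ U ∪ K ∣ + (s + ∣ U ∩ K ∣)                  ∎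
        where
        open ≤-Reasoning
        e₁ : ∀ a b c d → a + b + (c + d) ≡ a + d + (b + c)
        e₁ = solve-∀
        e₂ : ∀ a b c d → a + b + (c + d) ≡ b + c + (a + d)
        e₂ = solve-∀

    state : ∀ K Ks → Maximum K → (∀ L → L ∈ Ks → Maximum L) → State (K ∷ Ks)
    state K Ks K-max max = go Ks max
      where
      start : State (K ∷ [])
      start = record { I = K ; U = K ; I⊑U = λ _ → id ; I⊑Ks = λ { _ (here refl) _ → id } ; U-P = proj₂ (proj₁ K-max)
        ; joined = proj₁ (proj₁ K-max) ; large = ≤-reflexive (sym (cong₂ _+_ (proj₂ K-max) (proj₂ K-max))) }
      go : ∀ Ks → (∀ L → L ∈ Ks → Maximum L) → State (K ∷ Ks)
      go [] _ = start
      go (L ∷ Ks) max with extend {K = L} (max L (here refl)) (go Ks (λ L m → max L (there m)))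
      ... | S = record { State S ; I⊑Ks = λ { _ (here refl) → State.I⊑Ks S _ (there (here refl)) ; _ (there (here refl)) → State.I⊑Ks S _ (here refl)
                                            ; _ (there (there m)) → State.I⊑Ks S _ (there (there m)) } }

    -- In the final state the sizes of `I` and `U` add up to at least `s + s`, while `U` is smaller
    -- than that; what remains for `I` is positive.
    common-vertex : (∀ U → (∀ a → U ∋ a → P a) → ∣ U ∣ < s + s) → Fin n → ∃[ x ] (∀ p → Maximum p → p ∋ x)
    common-vertex small x₀ = from-list Ms refl
      where
      Ms : List (Subset n)
      Ms = filter maximum? (elements (finite-Vec finite-Bool n))
      Ms-complete : ∀ p → Maximum p → p ∈ Ms
      Ms-complete p m = Mem.∈-filter⁺ maximum? (∈-elements (finite-Vec finite-Bool n) p) m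
      Ms-sound : ∀ p → p ∈ Ms → Maximum p
      Ms-sound p m = proj₂ (Mem.∈-filter⁻ maximum? {xs = elements (finite-Vec finite-Bool n)} m)
      from-list : ∀ Ks → Ms ≡ Ks → ∃[ x ] (∀ p → Maximum p → p ∋ x)
      -- If there is no maximum clique, any vertex qualifies.
      from-list [] e = x₀ , λ p m → contradiction (subst (p ∈_) e (Ms-complete p m)) λ ()
      from-list (K ∷ Ks) e = enum I i₀ , λ p m → I⊑Ks p (subst (p ∈_) e (Ms-complete p m)) _ (enum-∋ I i₀)
        where
        sound : ∀ L → L ∈ (K ∷ Ks) → Maximum L
        sound L m = Ms-sound L (subst (L ∈_) (sym e) m)
        open State (state K Ks (sound K (here refl)) (λ L m → sound L (there m)))
        positive : 0 < ∣ I ∣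
        positive = +-cancelʳ-< (∣ U ∣) 0 (∣ I ∣) (<-≤-trans (small U U-P) large)
        i₀ : Fin ∣ I ∣
        i₀ = fromℕ< positive

-- If the neighbours of `v` contain a red clique with more than `t` vertices, it is a red copy in
-- `G - v`. Otherwise `t` bounds these cliques and Hajnal's lemma supplies `x`: a new red copy
-- through `v` would leave a clique of size `t` without `x`, and a blue cycle through `v` would need
-- two blue edges there.
complete-cycle-lower : ∀ t l → 2 ≤ t → 2 ≤ l → ∀ G → IsRamseyMinimal 2 (pair (Complete (suc t)) (Cycle (suc l))) G →
  ∀ v → 2 * t ≤ deg G v
complete-cycle-lower t l 2≤t 2≤l G@record { n = suc m ; E = E } M v = decidable-stable (2 * t ≤? deg G v) λ small → extend-ramsey E v M (choose small)
  where
  module _ (small : ¬ 2 * t ≤ deg G v) (c : Fin m → Fin m → Fin 2) (s : ∀ a b → c a b ≡ c b a) where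
    -- The colouring `c` carried over to the vertices of `G`. Edges at `v` get a placeholder colour;
    -- the cliques considered consist of neighbours of `v` and so avoid `v`.
    old : Fin (suc m) → Fin (suc m) → Fin 2
    old = Extend.ext E v c s v

    R : Fin (suc m) → Fin (suc m) → Set
    R a b = Adj G a b × old a b ≡ zero

    R? : ∀ a b → Dec (R a b)
    R? a b = adj? G a b ×-dec (_ Fin.≟ zero)

    R-sym : ∀ {a b} → R a b → R b a
    R-sym (g , q) = adj-sym G g , trans (Extend.ext-sym E v c s v _ _) q

    open Hajnal R R? R-sym (Adj G v) (adj? G v) t

    big-clique : ∀ p → Clique p → ¬ ∣ p ∣ ≤ t → ∃[ i ] Copy (pair (Complete (suc t)) (Cycle (suc l)) i) (Coloured (deleteVertex E v) c i)
    big-clique p (pairs , nbrs) big = zero , Extend.copy-avoiding E v c s v {Complete (suc t)}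
      (complete-copy (λ (g , _) → adj-irrefl G g) ψ λ a b a≢b → pairs _ _ (enum-∋ p _) (enum-∋ p _) (a≢b ∘ Fin.inject≤-injective lt lt a b ∘ enum-injective p))
      λ a e → adj-irrefl G (subst (Adj G v) e (nbrs _ (enum-∋ p _)))
      where
      lt : suc t ≤ ∣ p ∣
      lt = ≰⇒> big
      ψ : Fin (suc t) → Fin (suc m)
      ψ a = enum p (Fin.inject≤ a lt)

    avoiding : ∀ x → (∀ p → Maximum p → p ∋ x) → ∀ i (C : Copy (pair (Complete (suc t)) (Cycle (suc l)) i) (Coloured G (Extend.ext E v c s x) i)) a →
      Copy.vertex C a ≢ v
    avoiding x common i C a e = by-colour i C a e
      where
      open Extend E v c s x
      by-colour : ∀ i (C : Copy (pair (Complete (suc t)) (Cycle (suc l)) i) (Coloured G ext i)) a → Copy.vertex C a ≢ v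
      by-colour (suc zero) C a e with b , b′ , b≢b′ , ab , ab′ ← two-neighbours l 2≤l a =
        b≢b′ (Copy.injective C (trans (is-x ab) (sym (is-x ab′))))
        where
        is-x : ∀ {b} → Adj (Cycle (suc l)) a b → Copy.vertex C b ≡ x
        is-x {b} ab = colourAt-1 (trans (sym (ext-v (Copy.vertex C b))) (trans (cong (λ z → ext z (Copy.vertex C b)) (sym e)) (proj₂ (Copy.edge C a b ab))))
      by-colour zero C a e = contradiction (image-elim ψ x (common (image ψ) (clique , image-card ψ ψ-inj))) λ (j , q) → proj₂ (at-v j) q
        where
        φ = Copy.vertex C
        ψ : Fin t → Fin (suc m)
        ψ j = φ (punchIn a j)
        ψ-inj : Injective _≡_ _≡_ ψ
        ψ-inj q = Fin.punchIn-injective a _ _ (Copy.injective C q)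
        at-v : ∀ j → Adj G v (ψ j) × ψ j ≢ x
        at-v j with g , q ← Copy.edge C a (punchIn a j) (complete-adj a (punchIn a j) (Fin.punchInᵢ≢i a j ∘ sym)) =
          subst (λ z → Adj G z (ψ j)) e g , colourAt-0 (trans (sym (ext-v (ψ j))) (trans (cong (λ z → ext z (ψ j)) (sym e)) q))
        v≢ : ∀ j → v ≢ ψ j
        v≢ j q = adj-irrefl G (subst (Adj G v) (sym q) (proj₁ (at-v j)))
        clique : Clique (image ψ)
        clique = pairwise , λ a p → let j , q = image-elim ψ a p in subst (Adj G v) q (proj₁ (at-v j))
          where
          pairwise : ∀ a b → image ψ ∋ a → image ψ ∋ b → a ≢ b → R a b
          pairwise y z p p′ y≢z with image-elim ψ y p | image-elim ψ z p′
          ... | j , refl | k , refl with g , q ← Copy.edge C (punchIn a j) (punchIn a k)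
                  (complete-adj (punchIn a j) (punchIn a k) (λ r → y≢z (cong φ r))) =
            g , trans (Extend.ext-old E v c s v (v≢ j) (v≢ k)) (trans (sym (ext-old (v≢ j) (v≢ k))) q)

    choose : (∃[ i ] Copy (pair (Complete (suc t)) (Cycle (suc l)) i) (Coloured (deleteVertex E v) c i)) ⊎
      ∃[ x ] (∀ i (C : Copy (pair (Complete (suc t)) (Cycle (suc l)) i) (Coloured G (Extend.ext E v c s x) i)) a → Copy.vertex C a ≢ v)
    choose = by-size (any-finite? (finite-Vec finite-Bool (suc m)) λ p → clique? p ×-dec ¬? (∣ p ∣ ≤? t))
      where
      clique? : ∀ p → Dec (Clique p)
      clique? p = (Fin.all? λ a → Fin.all? λ b → (_ Bool.≟ _) →-dec ((_ Bool.≟ _) →-dec (¬? (a Fin.≟ b) →-dec R? a b))) ×-dec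
        (Fin.all? λ a → (_ Bool.≟ _) →-dec adj? G v a)
      by-size : Dec (∃[ p ] Clique p × ¬ ∣ p ∣ ≤ t) → _
      by-size (yes (p , cl , big)) = inj₁ (big-clique p cl big)
      by-size (no ¬big) = let x , common = common-vertex (λ p cl → decidable-stable (∣ p ∣ ≤? t) λ big → ¬big (p , cl , big))
                                (λ U U-P → ≤-<-trans (deg-≥ G v (enum U) (enum-injective U) (λ i → U-P _ (enum-∋ U i)))
                                  (subst (deg G v <_) (cong (t +_) (+-identityʳ t)) (≰⇒> small))) v
                          in inj₂ (x , avoiding x common)

-- K_3 and an odd cycle

module _ {V : Set} {R : V → V → Set} (P Q : ℕ → V) (m : ℕ)
  (P-inj : ∀ {a b} → a ≤ m → b ≤ m → P a ≡ P b → a ≡ b) (Q-inj : ∀ {a b} → a ≤ m → b ≤ m → Q a ≡ Q b → a ≡ b)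
  (PQ : ∀ {a b} → a ≤ m → b ≤ m → P a ≢ Q b) (R-PQ : ∀ a b → a ≤ m → b ≤ m → R (P a) (Q b) × R (Q b) (P a)) where

  -- With `Q` traversed backwards, the path visits all `2m + 2` vertices and still ends at `Q 0`.
  bipartite-link : Link R (suc (m + m)) (P 0) (Q 0)
  bipartite-link = record { at = zig P (λ a → Q (m ∸ a)) ; start = refl ; end = trans (Link.end L) (cong Q (n∸n≡0 m))
    ; inj = Link.inj L ; step = Link.step L }
    where
    L = zig-link {R = R} P (λ a → Q (m ∸ a)) m P-inj
      (λ {a} {b} p q e → ∸-cancelˡ-≡ p q (Q-inj (m∸n≤m m a) (m∸n≤m m b) e)) (λ {a} {b} p q → PQ p (m∸n≤m m b))
      (λ a p → proj₁ (R-PQ a (m ∸ a) p (m∸n≤m m a))) (λ a p → proj₂ (R-PQ (suc a) (m ∸ a) p (m∸n≤m m a)))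

  bipartite-apex : (∀ {u v} → R u v → R v u) → ∀ x → R x (P 0) → R x (Q 0) → (∀ a → x ≢ P a × x ≢ Q a) → Copy (Cycle (3 + (m + m))) R
  bipartite-apex R-sym x xP xQ fresh = apex-cycle R-sym x bipartite-link xP xQ off
    where
    off : ∀ t → t ≤ suc (m + m) → x ≢ zig P (λ a → Q (m ∸ a)) t
    off t _ e with half t
    ... | even a = proj₁ (fresh a) (trans e (zig-even P (λ a → Q (m ∸ a)) a))
    ... | odd a  = proj₂ (fresh (m ∸ a)) (trans e (zig-odd P (λ a → Q (m ∸ a)) a))

  -- The path `x, P 0, Q 0, P 1, …, Q (m - 1), y`: as long as the direct one, but with both ends
  -- outside the two classes.
  detour-link : 1 ≤ m → ∀ {x y} → x ≢ y → (∀ a → a ≤ m → x ≢ P a × x ≢ Q a × y ≢ P a × y ≢ Q a) →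
    (∀ a → a ≤ m → R x (P a)) → (∀ a → a ≤ m → R (Q a) y) → Link R (suc (m + m)) x y
  detour-link 1≤m {x} {y} x≢y fresh xP Qy = subst (Link R (suc (m + m)) x) v-end (zig-link u v m u-inj v-inj uv uv-step vu-step)
    where
    u v : ℕ → V
    u zero    = x
    u (suc a) = Q a
    v a = if ⌊ a ≟ m ⌋ then y else P a
    v-end : v m ≡ y
    v-end = cong (λ b → if b then y else P m) (⇒does (m ≟ m) refl)
    v-view : ∀ a → (a ≡ m × v a ≡ y) ⊎ (a ≢ m × v a ≡ P a)
    v-view a with a ≟ m
    ... | yes p = inj₁ (p , refl)
    ... | no p  = inj₂ (p , refl)
    u-inj : ∀ {a b} → a ≤ m → b ≤ m → u a ≡ u b → a ≡ b
    u-inj {zero} {zero} _ _ _ = refl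
    u-inj {zero} {suc b} _ q e = contradiction e (proj₁ (proj₂ (fresh b (<⇒≤ q))))
    u-inj {suc a} {zero} p _ e = contradiction (sym e) (proj₁ (proj₂ (fresh a (<⇒≤ p))))
    u-inj {suc a} {suc b} p q e = cong suc (Q-inj (<⇒≤ p) (<⇒≤ q) e)
    v-inj : ∀ {a b} → a ≤ m → b ≤ m → v a ≡ v b → a ≡ b
    v-inj {a} {b} p q e with v-view a | v-view b
    ... | inj₁ (r , _) | inj₁ (s , _) = trans r (sym s)
    ... | inj₁ (_ , r) | inj₂ (_ , s) = contradiction (trans (sym r) (trans e s)) (proj₁ (proj₂ (proj₂ (fresh b q))))
    ... | inj₂ (_ , r) | inj₁ (_ , s) = contradiction (trans (sym s) (trans (sym e) r)) (proj₁ (proj₂ (proj₂ (fresh a p))))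
    ... | inj₂ (_ , r) | inj₂ (_ , s) = P-inj p q (trans (sym r) (trans e s))
    uv : ∀ {a b} → a ≤ m → b ≤ m → u a ≢ v b
    uv {zero} {b} p q e with v-view b
    ... | inj₁ (_ , s) = x≢y (trans e s)
    ... | inj₂ (_ , s) = proj₁ (fresh b q) (trans e s)
    uv {suc a} {b} p q e with v-view b
    ... | inj₁ (_ , s) = proj₂ (proj₂ (proj₂ (fresh a (<⇒≤ p)))) (sym (trans e s))
    ... | inj₂ (_ , s) = PQ q (<⇒≤ p) (sym (trans e s))
    uv-step : ∀ a → a ≤ m → R (u a) (v a)
    uv-step zero p with v-view 0
    ... | inj₁ (s , _) = contradiction s (<⇒≢ 1≤m)
    ... | inj₂ (_ , s) = subst (R x) (sym s) (xP 0 p)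
    uv-step (suc a) p with v-view (suc a)
    ... | inj₁ (_ , s) = subst (R (Q a)) (sym s) (Qy a (<⇒≤ p))
    ... | inj₂ (_ , s) = subst (R (Q a)) (sym s) (proj₂ (R-PQ (suc a) a p (<⇒≤ p)))
    vu-step : ∀ a → a < m → R (v a) (u (suc a))
    vu-step a p with v-view a
    ... | inj₁ (s , _) = contradiction s (<⇒≢ p)
    ... | inj₂ (_ , s) = subst (λ z → R z (Q a)) (sym s) (proj₁ (R-PQ a a (<⇒≤ p) (<⇒≤ p)))

no-odd-alternation : ∀ {V : Set} {R : V → V → Set} (f : V → Bool) → (∀ {u v} → R u v → f u ≢ f v) → ∀ a → ¬ ClosedWalk R (suc (a + a))
no-odd-alternation f alt a W = Bool.not-¬ {f (at 0)} refl
  (trans (cong f (sym close)) (trans (flips (a + a) ≤-refl) (cong not (evens a ≤-refl))))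
  where
  open ClosedWalk W
  flips : ∀ i → i ≤ a + a → f (at (suc i)) ≡ not (f (at i))
  flips i p = Bool.¬-not λ e → alt (step i (s≤s p)) (sym e)
  evens : ∀ b → b ≤ a → f (at (b + b)) ≡ f (at 0)
  evens zero _ = refl
  evens (suc b) p = trans (cong (f ∘ at ∘ suc) (+-suc b b)) (trans (flips (suc (b + b)) (≤-trans (≤-reflexive (sym (+-suc b b))) (+-mono-≤ (<⇒≤ p) p)))
    (trans (cong not (flips (b + b) (+-mono-≤ (<⇒≤ p) (<⇒≤ p)))) (trans (Bool.not-involutive _) (evens b (<⇒≤ p)))))

data Split (β : Fin 4 → Bool) : Set where
  three : ∀ κ i j k → i ≢ j → i ≢ k → j ≢ k → β i ≡ κ → β j ≡ κ → β k ≡ κ → Split β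
  two   : ∀ a b c d → a ≢ b → a ≢ c → a ≢ d → b ≢ c → b ≢ d → c ≢ d →
          β a ≡ true → β b ≡ true → β c ≡ false → β d ≡ false → Split β

split : ∀ β → Split β
split β = go (β zero) (β (suc zero)) (β (suc (suc zero))) (β (suc (suc (suc zero)))) refl refl refl refl
  where
  pattern 0F = zero
  pattern 1F = suc zero
  pattern 2F = suc (suc zero)
  pattern 3F = suc (suc (suc zero))
  go : ∀ p q r s → β 0F ≡ p → β 1F ≡ q → β 2F ≡ r → β 3F ≡ s → Split β
  go true  true  true  _     p q r s = three true 0F 1F 2F (λ ()) (λ ()) (λ ()) p q r
  go true  true  false true  p q r s = three true 0F 1F 3F (λ ()) (λ ()) (λ ()) p q s
  go true  true  false false p q r s = two 0F 1F 2F 3F (λ ()) (λ ()) (λ ()) (λ ()) (λ ()) (λ ()) p q r s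
  go true  false true  true  p q r s = three true 0F 2F 3F (λ ()) (λ ()) (λ ()) p r s
  go true  false true  false p q r s = two 0F 2F 1F 3F (λ ()) (λ ()) (λ ()) (λ ()) (λ ()) (λ ()) p r q s
  go true  false false true  p q r s = two 0F 3F 1F 2F (λ ()) (λ ()) (λ ()) (λ ()) (λ ()) (λ ()) p s q r
  go true  false false false p q r s = three false 1F 2F 3F (λ ()) (λ ()) (λ ()) q r s
  go false true  true  true  p q r s = three true 1F 2F 3F (λ ()) (λ ()) (λ ()) q r s
  go false true  true  false p q r s = two 1F 2F 0F 3F (λ ()) (λ ()) (λ ()) (λ ()) (λ ()) (λ ()) q r p s
  go false true  false true  p q r s = two 1F 3F 0F 2F (λ ()) (λ ()) (λ ()) (λ ()) (λ ()) (λ ()) q s p r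
  go false true  false false p q r s = three false 0F 2F 3F (λ ()) (λ ()) (λ ()) p r s
  go false false true  true  p q r s = two 2F 3F 0F 1F (λ ()) (λ ()) (λ ()) (λ ()) (λ ()) (λ ()) r s p q
  go false false true  false p q r s = three false 0F 1F 3F (λ ()) (λ ()) (λ ()) p q s
  go false false false _     p q r s = three false 0F 1F 2F (λ ()) (λ ()) (λ ()) p q r

triangle : ∀ {X : Set} {R : X → X → Set} → (∀ {x} → ¬ R x x) → (∀ {x y} → R x y → R y x) → ∀ {x y z} →
  R x y → R x z → R y z → Copy (Complete 3) R
triangle {X} {R} irrefl R-sym {x} {y} {z} xy xz yz = complete-copy irrefl ψ edge
  where
  ψ : Fin 3 → X
  ψ zero             = x
  ψ (suc zero)       = y
  ψ (suc (suc zero)) = z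
  edge : ∀ a b → a ≢ b → R (ψ a) (ψ b)
  edge zero zero p = contradiction refl p
  edge zero (suc zero) _ = xy
  edge zero (suc (suc zero)) _ = xz
  edge (suc zero) zero _ = R-sym xy
  edge (suc zero) (suc zero) p = contradiction refl p
  edge (suc zero) (suc (suc zero)) _ = yz
  edge (suc (suc zero)) zero _ = R-sym xz
  edge (suc (suc zero)) (suc zero) _ = R-sym yz
  edge (suc (suc zero)) (suc (suc zero)) p = contradiction refl p

attach-irrefl : ∀ {V W : Set} {d} {A : V → V → Set} {nb : W → Fin d → V} → (∀ {v} → ¬ A v v) → ∀ {c κ x} → ¬ (Attach A nb ∧ᶜ c ≐ κ) x x
attach-irrefl irr {x = inj₁ _} (a , _) = irr a
attach-irrefl irr {x = inj₂ _} ()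

-- the base graph is 4-partite: colouring red between the pairs of parts {0,1} and {2,3}, and blue inside them, is good
module TriangleOdd (m : ℕ) (1≤m : 1 ≤ m) where

  private
    h : ℕ
    h = suc (m + m)

    T : Fin 4 → Fin 4 → Set
    T i j = i ≢ j

    D = proj₁ (blow-up (finite-Fin 4) {T} (λ i j → ¬? (i Fin.≟ j)) (λ p → p ∘ sym) (λ p → p refl) m)
    D-blow-up = proj₂ (blow-up (finite-Fin 4) {T} (λ i j → ¬? (i Fin.≟ j)) (λ p → p ∘ sym) (λ p → p refl) m)

    group side : Fin 4 → Bool
    group zero          = true
    group (suc zero)    = true
    group (suc (suc _)) = false
    side zero                   = true
    side (suc zero)             = false
    side (suc (suc zero))       = true
    side (suc (suc (suc _)))    = false

    same-part : ∀ i j → group i ≡ group j → side i ≡ side j → i ≡ j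
    same-part i j e e′ = trans (sym (recover i)) (trans (cong₂ part-of e e′) (recover j))
      where
      part-of : Bool → Bool → Fin 4
      part-of true  true  = zero
      part-of true  false = suc zero
      part-of false true  = suc (suc zero)
      part-of false false = suc (suc (suc zero))
      recover : ∀ i → part-of (group i) (side i) ≡ i
      recover zero                   = refl
      recover (suc zero)             = refl
      recover (suc (suc zero))       = refl
      recover (suc (suc (suc zero))) = refl

    differ : Bool → Bool → Bool
    differ true  b = not b
    differ false b = b

    differ-sym : ∀ a b → differ a b ≡ differ b a
    differ-sym true  true  = refl
    differ-sym true  false = refl
    differ-sym false true  = refl
    differ-sym false false = refl

    differ-true : ∀ a b → differ a b ≡ true → a ≢ b
    differ-true true  false _ ()
    differ-true false true  _ ()

    differ-false : ∀ a b → differ a b ≡ false → a ≡ b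
    differ-false true  true  _ = refl
    differ-false false false _ = refl

  open Partite D

  irrefl : ∀ {v} → ¬ A v v
  irrefl a = A-part a refl

  private module _ (c : V ⊎ Vec V 4 → V ⊎ Vec V 4 → Bool) (c-sym : ∀ x y → c x y ≡ c y x) where

    cᵛ : V → V → Bool
    cᵛ u v = c (inj₁ u) (inj₁ v)
    R : Bool → V ⊎ Vec V 4 → V ⊎ Vec V 4 → Set
    R κ = Attach A Vec.lookup ∧ᶜ c ≐ κ

    R-sym : ∀ κ {x y} → R κ x y → R κ y x
    R-sym κ {x} {y} = attach-sym {A = A} {nb = Vec.lookup} A-sym c-sym {κ} {x} {y}

    open BlowUp (D-blow-up cᵛ)

    κ-sym : ∀ {i j} → i ≢ j → κ i j ≡ κ j i
    κ-sym {i} {j} p = trans (sym (mono 0 0 p)) (trans (c-sym _ _) (mono 0 0 (p ∘ sym)))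

    edge : ∀ {i j b} → i ≢ j → κ i j ≡ b → ∀ x y → (A ∧ᶜ cᵛ ≐ b) (φ i x) (φ j y) × (A ∧ᶜ cᵛ ≐ b) (φ j y) (φ i x)
    edge p e x y = (φ-edge x y p , trans (mono x y p) e) , (φ-edge y x (p ∘ sym) , trans (mono y x (p ∘ sym)) (trans (sym (κ-sym p)) e))

    apart : ∀ {i j a b} → i ≢ j → a ≤ m → b ≤ m → φ i a ≢ φ j b
    apart p q r e = p (proj₁ (φ-inj q r e))

    direct : ∀ {i j} → i ≢ j → κ i j ≡ false → Link (A ∧ᶜ cᵛ ≐ false) h (φ i 0) (φ j 0)
    direct {i} {j} p e = bipartite-link (φ i) (φ j) m (λ q r s → proj₂ (φ-inj q r s)) (λ q r s → proj₂ (φ-inj q r s))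
      (apart p) (λ x y _ _ → edge p e x y)

    detour : ∀ {i a b j} → i ≢ a → i ≢ b → a ≢ b → a ≢ j → b ≢ j → i ≢ j → κ i a ≡ false → κ a b ≡ false → κ b j ≡ false →
      Link (A ∧ᶜ cᵛ ≐ false) h (φ i 0) (φ j 0)
    detour {i} {a} {b} {j} ia ib ab aj bj ij e₁ e₂ e₃ = detour-link (φ a) (φ b) m (λ q r s → proj₂ (φ-inj q r s))
      (λ q r s → proj₂ (φ-inj q r s)) (apart ab) (λ x y _ _ → edge ab e₂ x y) 1≤m (apart ij z≤n z≤n)
      (λ x p → apart ia z≤n p , apart ib z≤n p , apart (aj ∘ sym) z≤n p , apart (bj ∘ sym) z≤n p)
      (λ x _ → proj₁ (edge ia e₁ 0 x)) (λ x _ → proj₁ (edge bj e₃ x 0))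

    Result : Set
    Result = Copy (Complete 3) (R true) ⊎ Copy (Cycle (2 + h)) (R false)

    mono-triple : ∀ b {i j k} → i ≢ j → i ≢ k → j ≢ k → κ i j ≡ b → κ i k ≡ b → κ j k ≡ b → Result
    mono-triple true ij ik jk e₁ e₂ e₃ = inj₁ (triangle (λ {x} → attach-irrefl {A = A} {nb = Vec.lookup} irrefl {c} {true} {x}) (λ {x} {y} → R-sym true {x} {y})
      {inj₁ _} {inj₁ _} {inj₁ _} (proj₁ (edge ij e₁ 0 0)) (proj₁ (edge ik e₂ 0 0)) (proj₁ (edge jk e₃ 0 0)))
    mono-triple false {i} {j} {k} ij ik jk e₁ e₂ e₃ = inj₂ (copy-map inj₁ inj₁-injective (λ _ _ → id)
      (bipartite-apex (φ j) (φ k) m (λ q r s → proj₂ (φ-inj q r s)) (λ q r s → proj₂ (φ-inj q r s)) (apart jk)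
        (λ x y _ _ → edge jk e₃ x y) (λ (a , e) → A-sym a , trans (c-sym _ _) e) (φ i 0) (proj₁ (edge ij e₁ 0 0)) (proj₁ (edge ik e₂ 0 0))
        λ a → apart′ ij , apart′ ik))
      where
      apart′ : ∀ {i j a b} → i ≢ j → φ i a ≢ φ j b
      apart′ {i} {j} {a} {b} p e = irrefl (subst (A (φ i a)) (sym e) (φ-edge a b p))

    w : Vec V 4
    w = tabulate λ i → φ i 0

    β : Fin 4 → Bool
    β i = c (inj₂ w) (inj₁ (φ i 0))

    w-edge : ∀ {i b} → β i ≡ b → R b (inj₂ w) (inj₁ (φ i 0))
    w-edge {i} e = (i , Vec.lookup∘tabulate (λ i → φ i 0) i) , e

    red-pair : ∀ {i j} → i ≢ j → κ i j ≡ true → β i ≡ true → β j ≡ true → Result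
    red-pair p e ei ej = inj₁ (triangle (λ {x} → attach-irrefl {A = A} {nb = Vec.lookup} irrefl {c} {true} {x}) (λ {x} {y} → R-sym true {x} {y})
      {inj₂ w} {inj₁ _} {inj₁ _} (w-edge ei) (w-edge ej) (proj₁ (edge p e 0 0)))

    blue-pair : ∀ {i j} → Link (A ∧ᶜ cᵛ ≐ false) h (φ i 0) (φ j 0) → β i ≡ false → β j ≡ false → Result
    blue-pair {i} {j} L ei ej = inj₂ (apex-cycle (λ {x} {y} → R-sym false {x} {y}) (inj₂ w)
      (link-map inj₁ inj₁-injective id L) (w-edge ei) (w-edge ej) λ _ _ ())

    same-pair : ∀ b {i j} → i ≢ j → κ i j ≡ b → β i ≡ b → β j ≡ b → Result
    same-pair true  p e = red-pair p e
    same-pair false p e = blue-pair (direct p e)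

    -- Either a pair of the three parts has the colour of the edges at `w` and closes up with `w`,
    -- or all three pairs have the other colour.
    same-triple : ∀ b {i j k} → i ≢ j → i ≢ k → j ≢ k → β i ≡ b → β j ≡ b → β k ≡ b → Result
    same-triple b {i} {j} {k} ij ik jk ei ej ek = go (κ i j Bool.≟ b) (κ i k Bool.≟ b) (κ j k Bool.≟ b)
      where
      go : Dec (κ i j ≡ b) → Dec (κ i k ≡ b) → Dec (κ j k ≡ b) → Result
      go (yes e) _ _ = same-pair b ij e ei ej
      go (no _) (yes e) _ = same-pair b ik e ei ek
      go (no _) (no _) (yes e) = same-pair b jk e ej ek
      go (no p) (no q) (no r) = mono-triple (not b) ij ik jk (Bool.¬-not p) (Bool.¬-not q) (Bool.¬-not r)

    forced : Result
    forced = go (split β)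
      where
      go : Split β → Result
      go (three b i j k ij ik jk ei ej ek) = same-triple b ij ik jk ei ej ek
      go (two a b c d ab ac ad bc bd cd ea eb ec ed) = colours (κ a b) (κ c d) (κ c a) (κ c b) (κ a d) (κ b d) refl refl refl refl refl refl
        where
        -- What is left has `ab` blue and `cd` red. Unless three parts are joined in one colour, a
        -- blue path leads from `c` to `d` through both `a` and `b`, and the detour follows it.
        colours : ∀ x y p q r s → κ a b ≡ x → κ c d ≡ y → κ c a ≡ p → κ c b ≡ q → κ a d ≡ r → κ b d ≡ s → Result
        colours true _ _ _ _ _ e _ _ _ _ _ = red-pair ab e ea eb
        colours false false _ _ _ _ _ e _ _ _ _ = blue-pair (direct cd e) ec ed
        colours false true false false _ _ e _ e₁ e₂ _ _ = mono-triple false (ac ∘ sym) (bc ∘ sym) ab e₁ e₂ e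
        colours false true false true _ true _ e _ e₁ _ e₂ = mono-triple true (bc ∘ sym) cd bd e₁ e e₂
        colours false true false true _ false e₀ _ e₁ _ _ e₂ = blue-pair (detour (ac ∘ sym) (bc ∘ sym) ab ad bd cd e₁ e₀ e₂) ec ed
        colours false true true _ true _ _ e e₁ _ e₂ _ = mono-triple true (ac ∘ sym) cd ad e₁ e e₂
        colours false true true _ false false e _ _ _ e₁ e₂ = mono-triple false ab ad bd e e₁ e₂
        colours false true true true false true _ e _ e₁ _ e₂ = mono-triple true (bc ∘ sym) cd bd e₁ e e₂
        colours false true true false false true e₀ _ _ e₁ e₂ _ =
          blue-pair (detour (bc ∘ sym) (ac ∘ sym) (ab ∘ sym) bd ad cd e₁ (trans (κ-sym (ab ∘ sym)) e₀) e₂) ec ed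

  base : Base (Complete 3) (Cycle (2 + h)) 4
  base = record { V-finite = finite ; A = A ; A? = A? ; A-sym = A-sym ; A-irrefl = irrefl
    ; good = good ; good-sym = λ u v → differ-sym (group (part u)) (group (part v))
    ; good₁ = no-red ; good₂ = λ cp → no-odd-alternation {R = A ∧ᶜ good ≐ false} (side ∘ part)
        (λ {u} {v} (a , e) s → A-part a (same-part _ _ (differ-false _ _ e) s)) (suc m)
        (subst (λ k → ClosedWalk (A ∧ᶜ good ≐ false) (suc (suc k))) (sym (+-suc m m)) (cycle-walk (suc h) (s≤s z≤n) cp))
    ; forced = forced }
    where
    good : V → V → Bool
    good u v = differ (group (part u)) (group (part v))
    no-red : ¬ Copy (Complete 3) (A ∧ᶜ good ≐ true)
    no-red (copy ψ _ e) = third (g zero) (g (suc zero)) (g (suc (suc zero))) (red zero (suc zero) λ ()) (red zero (suc (suc zero)) λ ()) (red (suc zero) (suc (suc zero)) λ ())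
      where
      g : Fin 3 → Bool
      g a = group (part (ψ a))
      red : ∀ a b → a ≢ b → g a ≢ g b
      red a b p = differ-true _ _ (proj₂ (e a b (complete-adj a b p)))
      third : ∀ x y z → x ≢ y → x ≢ z → y ≢ z → ⊥
      third true  true  _     p _ _ = p refl
      third true  false true  _ p _ = p refl
      third true  false false _ _ p = p refl
      third false false _     p _ _ = p refl
      third false true  false _ p _ = p refl
      third false true  true  _ _ p = p refl

-- K_t and an odd cycle, t ≥ 4

two-others : ∀ {m} → 3 ≤ m → (i : Fin m) → ∃₂ λ j k → i ≢ j × i ≢ k × j ≢ k
two-others (s≤s (s≤s (s≤s _))) zero          = suc zero , suc (suc zero) , (λ ()) , (λ ()) , λ ()
two-others (s≤s (s≤s (s≤s _))) (suc zero)    = zero , suc (suc zero) , (λ ()) , (λ ()) , λ ()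
two-others (s≤s (s≤s (s≤s _))) (suc (suc _)) = zero , suc zero , (λ ()) , (λ ()) , λ ()

-- r-edges join hubs of different classes, both classes having two sides.  Intended colouring: r-edges red, all
-- other pairs across the two sides blue.
module CompleteOdd (m p : ℕ) (3≤m : 3 ≤ m) (1≤p : 1 ≤ p) where

  private
    h L N : ℕ
    h = suc (p + p)
    L = m + m
    N = proj₁ (ramsey-increasing 2 3 L)

    ramseyᴺ : ∀ (c : Fin 3 → List ℕ → Bool) → Σ[ f ∈ (ℕ → ℕ) ] (∀ i j → i < j → j < L → f i < f j) × (∀ j → j < L → f j < N) ×
      Σ[ κ ∈ (Fin 3 → Bool) ] (∀ i g → Increasing 2 g → (∀ j → j < 2 → g j < L) → c i (applyUpTo (f ∘ g) 2) ≡ κ i)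
    ramseyᴺ = proj₂ (ramsey-increasing 2 3 L)

    I : Set
    I = Fin (suc N) × Bool

    I-finite : Finite I
    I-finite = finite-× (finite-Fin _) finite-Bool

    T : I → I → Set
    T i j = i ≢ j

    T? : ∀ i j → Dec (T i j)
    T? i j = ¬? (≟-finite I-finite i j)

    Placement Hub : Set
    Placement = Bool → Fin m → Fin (suc N)
    Hub = Fin m × Bool × Fin (suc p)

    Table : Set
    Table = Vec (Fin (suc N)) m × Vec (Fin (suc N)) m

    place : Table → Placement
    place (s , _) true  i = Vec.lookup s i
    place (_ , t) false i = Vec.lookup t i

    PV : Set
    PV = Table × Hub

    PV-finite : Finite PV
    PV-finite = finite-× (finite-× (finite-Vec (finite-Fin _) m) (finite-Vec (finite-Fin _) m)) (finite-× (finite-Fin m) (finite-× finite-Bool (finite-Fin _)))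

    class : PV → Fin m
    class (_ , i , _) = i

    pattern-part : PV → I
    pattern-part (t , i , σ , _) = place t σ i , σ

    -- One `m`-partite graph for each placement of the classes among the parts, all disjoint, so
    -- that the classes bound the cliques. Every placement is included because the suitable one
    -- depends on the colouring.
    PA : PV → PV → Set
    PA x y = proj₁ x ≡ proj₁ y × class x ≢ class y × pattern-part x ≢ pattern-part y

    P : Partite I T
    P = record { V = PV ; finite = PV-finite ; part = pattern-part ; A = PA
      ; A? = λ x y → ≟-finite (finite-× (finite-Vec (finite-Fin _) m) (finite-Vec (finite-Fin _) m)) _ _ ×-dec ¬? (class x Fin.≟ class y) ×-dec T? _ _
      ; A-sym = λ (e , c , q) → sym e , c ∘ sym , q ∘ sym ; A-part = λ (_ , _ , q) → q }

    P-cliqueFree : CliqueFree (suc m) P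
    P-cliqueFree φ clique = 1+n≰n (Fin.injective⇒≤ {f = class ∘ φ} λ {a} {b} e →
      decidable-stable (a Fin.≟ b) λ a≢b → proj₁ (proj₂ (clique a b a≢b)) e)

    abstract
      all-pairs : List (I × I)
      all-pairs = filter (uncurry T?) (cartesianProduct (elements I-finite) (elements I-finite))

      all-pairs-T : All (uncurry T) all-pairs
      all-pairs-T = All.tabulate λ q → proj₂ (Mem.∈-filter⁻ (uncurry T?) {xs = cartesianProduct (elements I-finite) (elements I-finite)} q)

      ∈-all-pairs : ∀ {i j} → T i j → (i , j) ∈ all-pairs
      ∈-all-pairs {i} {j} t = Mem.∈-filter⁺ (uncurry T?) (Mem.∈-cartesianProduct⁺ (∈-elements I-finite i) (∈-elements I-finite j)) t

    abstract
      construction : Σ[ D ∈ Partite I T ] Arrows all-pairs D P × CliqueFree (suc m) D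
      construction = let D , arr , free = partite-construction (≟-finite I-finite) (λ q → q ∘ sym) (λ q → q refl) P all-pairs all-pairs-T
                     in D , arr , free (suc m) (≤-trans 3≤m (n≤1+n m)) P-cliqueFree

    D = proj₁ construction

  open Partite D renaming (A to r; A? to r?; A-sym to r-sym; A-part to r-part)

  private
    side : V → Bool
    side v = proj₂ (part v)

    A : V → V → Set
    A u v = r u v ⊎ side u ≢ side v

    A-sym : ∀ {u v} → A u v → A v u
    A-sym (inj₁ e) = inj₁ (r-sym e)
    A-sym (inj₂ s) = inj₂ (s ∘ sym)

    A-irrefl : ∀ {v} → ¬ A v v
    A-irrefl (inj₁ e) = r-part e refl
    A-irrefl (inj₂ s) = s refl

    good : V → V → Bool
    good u v = ⌊ r? u v ⌋

    good-sym : ∀ u v → good u v ≡ good v u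
    good-sym u v = by-dec (r? u v)
      where
      by-dec : Dec (r u v) → good u v ≡ good v u
      by-dec (yes e) = trans (⇒does (r? u v) e) (sym (⇒does (r? v u) (r-sym e)))
      by-dec (no ¬e) = trans (⇒¬does (r? u v) ¬e) (sym (⇒¬does (r? v u) (¬e ∘ r-sym)))

    no-red : ¬ Copy (Complete (suc m)) (A ∧ᶜ good ≐ true)
    no-red (copy ψ _ e) = proj₂ (proj₂ construction) ψ λ a b q → does⇒ (r? (ψ a) (ψ b)) (proj₂ (e a b (complete-adj a b q)))

    no-blue : ¬ Copy (Cycle (2 + h)) (A ∧ᶜ good ≐ false)
    no-blue cp = no-odd-alternation {R = A ∧ᶜ good ≐ false} side alternates (suc p)
      (subst (λ k → ClosedWalk (A ∧ᶜ good ≐ false) (suc (suc k))) (sym (+-suc p p)) (cycle-walk (suc h) (s≤s z≤n) cp))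
      where
      alternates : ∀ {u v} → (A ∧ᶜ good ≐ false) u v → side u ≢ side v
      alternates {u} {v} (inj₁ e , q) = contradiction (trans (sym (⇒does (r? u v) e)) q) λ ()
      alternates (inj₂ s , _) = s

    -- The outcome of two Ramsey steps: in a suitable copy the partite construction makes the colour
    -- of an `r`-edge depend on its parts, and Ramsey's theorem for pairs then makes it depend on
    -- the two sides alone.
    record Hubs (c : V → V → Bool) : Set where
      field
        H     : Fin m → Bool → ℕ → V
        H-inj : ∀ {i j σ τ a b} → a ≤ p → b ≤ p → H i σ a ≡ H j τ b → i ≡ j × σ ≡ τ × a ≡ b
        H-side : ∀ i σ a → side (H i σ a) ≡ σ
        H-edge : ∀ {i j} → i ≢ j → ∀ σ τ a b → r (H i σ a) (H j τ b)
        κ      : Bool → Bool → Bool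
        κ-sym  : ∀ σ τ → κ σ τ ≡ κ τ σ
        H-mono : ∀ {i j} → i ≢ j → ∀ σ τ a b → c (H i σ a) (H j τ b) ≡ κ σ τ

    hubs-concrete : ∀ c → (∀ u v → c u v ≡ c v u) → Hubs c
    hubs-concrete c c-sym = go (proj₁ (proj₂ construction) c)
      where
      go : Σ[ C ∈ PartCopy P D ] Σ[ κ ∈ (I → I → Bool) ] (∀ x y → PA x y → (pattern-part x , pattern-part y) ∈ all-pairs →
             c (PartCopy.φ C x) (PartCopy.φ C y) ≡ κ (pattern-part x) (pattern-part y)) → Hubs c
      go (C , κ , mono) = record { H = H ; H-inj = H-inj ; H-side = λ i σ a → cong proj₂ (φ-part (hub i σ a)) ; H-edge = λ i≢j σ τ a b → φ-edge (adjacent i≢j σ τ a b)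
        ; κ = K ; κ-sym = K-sym ; H-mono = H-mono }
        where
        open PartCopy C
        bits : Fin 3 → List ℕ → Bool
        bits zero             zs = κ (clamp N (nth zs 0) , true) (clamp N (nth zs 1) , true)
        bits (suc zero)       zs = κ (clamp N (nth zs 0) , false) (clamp N (nth zs 1) , false)
        bits (suc (suc zero)) zs = κ (clamp N (nth zs 0) , true) (clamp N (nth zs 1) , false)
        ram = ramseyᴺ bits
        f = proj₁ ram
        f-mono = proj₁ (proj₂ ram)
        f-bound = proj₁ (proj₂ (proj₂ ram))
        K₃ = proj₁ (proj₂ (proj₂ (proj₂ ram)))
        hom = proj₂ (proj₂ (proj₂ (proj₂ ram)))
        -- Side `true` takes the lower half of the indices, so across the sides its number is always
        -- the smaller one, which is the order in which the third colouring reads a pair.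
        index : Bool → Fin m → ℕ
        index true  i = toℕ i
        index false i = m + toℕ i
        index-bd : ∀ σ i → index σ i < L
        index-bd true  i = <-≤-trans (Fin.toℕ<n i) (m≤m+n m m)
        index-bd false i = +-monoʳ-< m (Fin.toℕ<n i)
        index-inj : ∀ σ {i j} → index σ i ≡ index σ j → i ≡ j
        index-inj true  e = Fin.toℕ-injective e
        index-inj false e = Fin.toℕ-injective (+-cancelˡ-≡ m _ _ e)
        spot : Bool → Fin m → Fin (suc N)
        spot σ i = clamp N (f (index σ i))
        spot-inj : ∀ σ {i j} → spot σ i ≡ spot σ j → i ≡ j
        spot-inj σ {i} {j} e = index-inj σ (increasing⇒injective f f-mono (index-bd σ i) (index-bd σ j)
          (trans (sym (toℕ-clamp (m≤n⇒m≤1+n (f-bound _ (index-bd σ i))))) (trans (cong toℕ e) (toℕ-clamp (m≤n⇒m≤1+n (f-bound _ (index-bd σ j)))))))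
        table : Table
        table = tabulate (spot true) , tabulate (spot false)
        placed : ∀ σ i → place table σ i ≡ spot σ i
        placed true  i = Vec.lookup∘tabulate (spot true) i
        placed false i = Vec.lookup∘tabulate (spot false) i
        hub : Fin m → Bool → ℕ → PV
        hub i σ a = table , i , σ , clamp p a
        hub-part : ∀ i σ a → pattern-part (hub i σ a) ≡ (spot σ i , σ)
        hub-part i σ a = cong (_, σ) (placed σ i)
        adjacent : ∀ {i j} → i ≢ j → ∀ σ τ a b → PA (hub i σ a) (hub j τ b)
        adjacent {i} {j} i≢j σ τ a b = refl , i≢j , apart σ τ
          where
          apart : ∀ σ τ → pattern-part (hub i σ a) ≢ pattern-part (hub j τ b)
          apart true  true  e = i≢j (spot-inj true (trans (sym (placed true i)) (trans (cong proj₁ e) (placed true j))))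
          apart false false e = i≢j (spot-inj false (trans (sym (placed false i)) (trans (cong proj₁ e) (placed false j))))
          apart true  false e = contradiction (cong proj₂ e) λ ()
          apart false true  e = contradiction (cong proj₂ e) λ ()
        H : Fin m → Bool → ℕ → V
        H i σ a = φ (hub i σ a)
        H-inj : ∀ {i j σ τ a b} → a ≤ p → b ≤ p → H i σ a ≡ H j τ b → i ≡ j × σ ≡ τ × a ≡ b
        H-inj q q′ e = let e′ = cong proj₂ (φ-inj e) in cong proj₁ e′ , cong (proj₁ ∘ proj₂) e′ ,
          trans (sym (toℕ-clamp (s≤s q))) (trans (cong (toℕ ∘ proj₂ ∘ proj₂) e′) (toℕ-clamp (s≤s q′)))
        K : Bool → Bool → Bool
        K true  true  = K₃ zero
        K false false = K₃ (suc zero)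
        K true  false = K₃ (suc (suc zero))
        K false true  = K₃ (suc (suc zero))
        K-sym : ∀ σ τ → K σ τ ≡ K τ σ
        K-sym true  true  = refl
        K-sym false false = refl
        K-sym true  false = refl
        K-sym false true  = refl
        κ-spot : ∀ {i j} → i ≢ j → ∀ σ τ a b → c (H i σ a) (H j τ b) ≡ κ (spot σ i , σ) (spot τ j , τ)
        κ-spot {i} {j} i≢j σ τ a b = trans (mono (hub i σ a) (hub j τ b) adj (∈-all-pairs (proj₂ (proj₂ adj)))) (cong₂ κ (hub-part i σ a) (hub-part j τ b))
          where adj = adjacent i≢j σ τ a b
        pair-bits : ∀ b x y → x < y → y < L → bits b (f x ∷ f y ∷ []) ≡ K₃ b
        pair-bits b x y x<y y<L = hom b (λ { zero → x ; (suc _) → y }) (λ { zero _ → x<y ; (suc j) (s≤s (s≤s ())) })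
          λ { zero _ → <-trans x<y y<L ; (suc _) _ → y<L }
        same-side : ∀ σ b → (∀ {x y} → bits b (x ∷ y ∷ []) ≡ κ (clamp N x , σ) (clamp N y , σ)) →
          (∀ {i j : Fin m} → toℕ i < toℕ j → index σ i < index σ j) →
          ∀ {i j} → i ≢ j → ∀ a a′ → c (H i σ a) (H j σ a′) ≡ K₃ b
        same-side σ b def mono-index {i} {j} i≢j a a′ = by-order (<-cmp (toℕ i) (toℕ j))
          where
          ordered : ∀ {i j} → i ≢ j → toℕ i < toℕ j → ∀ a a′ → c (H i σ a) (H j σ a′) ≡ K₃ b
          ordered {i} {j} i≢j q a a′ = trans (κ-spot i≢j σ σ a a′) (trans (sym def) (pair-bits b (index σ i) (index σ j) (mono-index q) (index-bd σ j)))
          by-order : _ → c (H i σ a) (H j σ a′) ≡ K₃ b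
          by-order (tri< q _ _) = ordered i≢j q a a′
          by-order (tri≈ _ q _) = contradiction (Fin.toℕ-injective q) i≢j
          by-order (tri> _ _ q) = trans (c-sym (H i σ a) (H j σ a′)) (ordered (i≢j ∘ sym) q a′ a)
        H-mono : ∀ {i j} → i ≢ j → ∀ σ τ a b → c (H i σ a) (H j τ b) ≡ K σ τ
        H-mono i≢j true true a b = same-side true zero refl id i≢j a b
        H-mono i≢j false false a b = same-side false (suc zero) refl (+-monoʳ-< m) i≢j a b
        H-mono {i} {j} i≢j true false a b = trans (κ-spot i≢j true false a b)
          (pair-bits (suc (suc zero)) (index true i) (index false j) (<-≤-trans (Fin.toℕ<n i) (m≤m+n m (toℕ j))) (index-bd false j))
        H-mono {i} {j} i≢j false true a b = trans (c-sym (H i false a) (H j true b)) (H-mono {j} {i} (i≢j ∘ sym) true false b a)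

    abstract
      hubs : ∀ c → (∀ u v → c u v ≡ c v u) → Hubs c
      hubs = hubs-concrete

  private module _ (c : V ⊎ Vec V (2 * m) → V ⊎ Vec V (2 * m) → Bool) (c-sym : ∀ x y → c x y ≡ c y x) where

    cᵛ : V → V → Bool
    cᵛ u v = c (inj₁ u) (inj₁ v)
    R : Bool → V ⊎ Vec V (2 * m) → V ⊎ Vec V (2 * m) → Set
    R κ = Attach A Vec.lookup ∧ᶜ c ≐ κ

    R-sym : ∀ κ {x y} → R κ x y → R κ y x
    R-sym κ {x} {y} = attach-sym {A = A} {nb = Vec.lookup} (λ {u} {v} → A-sym {u} {v}) c-sym {κ} {x} {y}

    R-irrefl : ∀ κ {x} → ¬ R κ x x
    R-irrefl κ {x} = attach-irrefl {A = A} {nb = Vec.lookup} (λ {v} → A-irrefl {v}) {c} {κ} {x}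

    open Hubs (hubs cᵛ (λ u v → c-sym (inj₁ u) (inj₁ v)))

    Blue : V → V → Set
    Blue = A ∧ᶜ cᵛ ≐ false

    Blue-sym : ∀ {u v} → Blue u v → Blue v u
    Blue-sym {u} {v} (a , e) = A-sym {u} {v} a , trans (c-sym _ _) e

    Result : Set
    Result = Copy (Complete (suc m)) (R true) ⊎ Copy (Cycle (2 + h)) (R false)

    edge : ∀ {i j} → i ≢ j → ∀ {σ τ κ₀} → κ σ τ ≡ κ₀ → ∀ a b → (A ∧ᶜ cᵛ ≐ κ₀) (H i σ a) (H j τ b)
    edge i≢j e a b = inj₁ (H-edge i≢j _ _ a b) , trans (H-mono i≢j _ _ a b) e

    edges : ∀ {i j} → i ≢ j → ∀ {σ τ} → κ σ τ ≡ false → ∀ a b → a ≤ p → b ≤ p → Blue (H i σ a) (H j τ b) × Blue (H j τ b) (H i σ a)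
    edges {i} {j} i≢j {σ} {τ} e a b _ _ = edge i≢j e a b , edge (i≢j ∘ sym) (trans (κ-sym τ σ) e) b a

    copy-inj : ∀ {i σ a b} → a ≤ p → b ≤ p → H i σ a ≡ H i σ b → a ≡ b
    copy-inj q q′ e = proj₂ (proj₂ (H-inj q q′ e))

    apart : ∀ {i j} → i ≢ j → ∀ σ τ {a b} → H i σ a ≢ H j τ b
    apart {i} {j} i≢j σ τ {a} {b} e = r-part (subst (r (H i σ a)) (sym e) (H-edge i≢j σ τ a b)) refl

    apart-sides : ∀ {i j a b} → H i true a ≢ H j false b
    apart-sides {i} {j} {a} {b} e = contradiction (trans (sym (H-side i true a)) (trans (cong side e) (H-side j false b))) λ ()

    -- Three classes on one side, pairwise joined in blue, contain the odd cycle; this uses `m ≥ 3`.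
    blue-side : ∀ σ → κ σ σ ≡ false → Result
    blue-side σ e with two-others 3≤m (fromℕ< (≤-trans (s≤s z≤n) 3≤m))
    ... | j , k , i≢j , i≢k , j≢k = inj₂ (copy-map inj₁ inj₁-injective (λ _ _ → id)
      (bipartite-apex (H _ σ) (H j σ) p copy-inj copy-inj (λ _ _ → apart i≢j σ σ) (edges i≢j e)
        (λ {u} {v} → Blue-sym {u} {v}) (H k σ 0) (edge (i≢k ∘ sym) e 0 0) (edge (j≢k ∘ sym) e 0 0) λ a → apart (i≢k ∘ sym) σ σ , apart (j≢k ∘ sym) σ σ))

    F : Fin 2 → Fin m → V
    F zero    i = H i true 0
    F (suc _) i = H i false 0

    w : Vec V (2 * m)
    w = twoPerPart F

    w-edge : ∀ {b i κ₀} → c (inj₂ w) (inj₁ (F b i)) ≡ κ₀ → R κ₀ (inj₂ w) (inj₁ (F b i))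
    w-edge {b} {i} e = (slot b i , lookup-twoPerPart F b i) , e

    linked : ∀ {i j} → Link Blue h (F zero i) (F (suc zero) j) → c (inj₂ w) (inj₁ (F zero i)) ≡ false → c (inj₂ w) (inj₁ (F (suc zero) j)) ≡ false → Result
    linked {i} {j} ℓ ei ej = inj₂ (apex-cycle (λ {x} {y} → R-sym false {x} {y}) (inj₂ w)
      (link-map inj₁ inj₁-injective id ℓ) (w-edge {zero} {i} ei) (w-edge {suc zero} {j} ej) λ _ _ ())

    module AllRed (red : ∀ σ → κ σ σ ≡ true) where

      F-edge : ∀ {i j} → i ≢ j → ∀ b → R true (inj₁ (F b i)) (inj₁ (F b j))
      F-edge i≢j zero    = edge i≢j (red true) 0 0
      F-edge i≢j (suc _) = edge i≢j (red false) 0 0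

      w-clique : (β : Fin m → Fin 2) → (∀ i → c (inj₂ w) (inj₁ (F (β i) i)) ≡ true) →
        (∀ {i j} → i ≢ j → R true (inj₁ (F (β i) i)) (inj₁ (F (β j) j))) → Result
      w-clique β e pairs = inj₁ (complete-copy (λ {x} → R-irrefl true {x}) ψ ψ-edge)
        where
        ψ : Fin (suc m) → V ⊎ Vec V (2 * m)
        ψ zero    = inj₂ w
        ψ (suc i) = inj₁ (F (β i) i)
        ψ-edge : ∀ a b → a ≢ b → R true (ψ a) (ψ b)
        ψ-edge zero zero q = contradiction refl q
        ψ-edge zero (suc i) _ = w-edge {β i} {i} (e i)
        ψ-edge (suc i) zero _ = R-sym true {inj₂ w} {ψ (suc i)} (w-edge {β i} {i} (e i))
        ψ-edge (suc i) (suc j) q = pairs (q ∘ cong suc)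

      -- If `w` sends only red edges to one side, it forms a red clique with that side. Otherwise it
      -- has a blue edge to each side, and a blue path of length `h` joins their ends, by a detour
      -- through two other classes if they share a class.
      blue-across : κ true false ≡ false → Result
      blue-across e = go (Fin.any? (λ i → c (inj₂ w) (inj₁ (F zero i)) Bool.≟ false)) (Fin.any? (λ i → c (inj₂ w) (inj₁ (F (suc zero) i)) Bool.≟ false))
        where
        e′ : κ false true ≡ false
        e′ = trans (κ-sym false true) e
        link : ∀ i j → Link Blue h (F zero i) (F (suc zero) j)
        link i j = by-class (i Fin.≟ j)
          where
          by-class : Dec (i ≡ j) → Link Blue h (F zero i) (F (suc zero) j)
          by-class (no i≢j) = bipartite-link (H i true) (H j false) p copy-inj copy-inj (λ _ _ → apart-sides) (edges i≢j e)
          by-class (yes refl) with two-others 3≤m i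
          ... | j , k , i≢j , i≢k , j≢k = detour-link (H j false) (H k true) p copy-inj copy-inj (λ _ _ → apart-sides ∘ sym)
            (edges j≢k e′) 1≤p apart-sides
            (λ a _ → apart i≢j true false , apart i≢k true true , apart i≢j false false , apart i≢k false true)
            (λ a _ → edge i≢j e 0 a) (λ a _ → edge (i≢k ∘ sym) e a 0)
        go : Dec _ → Dec _ → Result
        go (no ¬b) _ = w-clique (λ _ → zero) (λ i → not-false⇒true λ q → ¬b (i , q)) (λ i≢j → F-edge i≢j zero)
        go (yes _) (no ¬b) = w-clique (λ _ → suc zero) (λ i → not-false⇒true λ q → ¬b (i , q)) (λ i≢j → F-edge i≢j (suc zero))
        go (yes (i , ei)) (yes (j , ej)) = linked {i} {j} (link i j) ei ej

      module _ (across : κ true false ≡ true) where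

        κ-red : ∀ σ τ → κ σ τ ≡ true
        κ-red true  true  = red true
        κ-red false false = red false
        κ-red true  false = across
        κ-red false true  = trans (κ-sym false true) across

        -- a red edge inside a class extends to a red clique by one vertex from each other class
        inner-clique : ∀ i a b → cᵛ (H i true a) (H i false b) ≡ true → Result
        inner-clique i a b e = inj₁ (complete-copy (λ {x} → R-irrefl true {x}) (inj₁ ∘ ψ) ψ-edge)
          where
          pick : Fin m → ℕ
          pick j = if ⌊ j Fin.≟ i ⌋ then a else 0
          ψ : Fin (suc m) → V
          ψ zero    = H i false b
          ψ (suc j) = H j true (pick j)
          first : ∀ j → Dec (j ≡ i) → R true (inj₁ (ψ zero)) (inj₁ (ψ (suc j)))
          first j (yes refl) = subst (λ x → R true (inj₁ (H i false b)) (inj₁ (H i true x))) (sym (cong (λ t → if t then a else 0) (⇒does (i Fin.≟ i) refl)))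
            (inj₂ (λ s → contradiction (trans (sym (H-side i false b)) (trans s (H-side i true a))) λ ()) , trans (c-sym _ _) e)
          first j (no j≢i) = edge (j≢i ∘ sym) (κ-red false true) b (pick j)
          ψ-edge : ∀ x y → x ≢ y → R true (inj₁ (ψ x)) (inj₁ (ψ y))
          ψ-edge zero zero q = contradiction refl q
          ψ-edge zero (suc j) _ = first j (j Fin.≟ i)
          ψ-edge (suc j) zero _ = R-sym true {inj₁ (ψ zero)} {inj₁ (ψ (suc j))} (first j (j Fin.≟ i))
          ψ-edge (suc j) (suc k) q = edge (q ∘ cong suc) (κ-red true true) _ _

        -- The two sides of a class span a blue complete bipartite graph, so two blue edges from `w`
        -- into one class close a cycle. Otherwise `w` has a red neighbour in every class, and these
        -- form a clique.
        blue-inside : (∀ i a b → a ≤ p → b ≤ p → cᵛ (H i true a) (H i false b) ≡ false) → Result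
        blue-inside blue = go (Fin.any? λ i → (c (inj₂ w) (inj₁ (F zero i)) Bool.≟ false) ×-dec (c (inj₂ w) (inj₁ (F (suc zero) i)) Bool.≟ false))
          where
          inner : ∀ i a b → a ≤ p → b ≤ p → Blue (H i true a) (H i false b) × Blue (H i false b) (H i true a)
          inner i a b q q′ = ib , Blue-sym {H i true a} {H i false b} ib
            where
            ib : Blue (H i true a) (H i false b)
            ib = inj₂ (λ s → contradiction (trans (sym (H-side i true a)) (trans s (H-side i false b))) λ ()) , blue i a b q q′
          go : Dec (∃[ i ] c (inj₂ w) (inj₁ (F zero i)) ≡ false × c (inj₂ w) (inj₁ (F (suc zero) i)) ≡ false) → Result
          go (yes (i , e , e′)) = linked {i} {i} (bipartite-link (H i true) (H i false) p copy-inj copy-inj (λ _ _ → apart-sides) (inner i)) e e′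
          go (no ¬both) = w-clique (proj₁ ∘ β) (proj₂ ∘ β) (λ {i} {j} i≢j → F-red i≢j (proj₁ (β i)) (proj₁ (β j)))
            where
            β : ∀ i → ∃[ b ] c (inj₂ w) (inj₁ (F b i)) ≡ true
            β i with c (inj₂ w) (inj₁ (F zero i)) in e₀ | c (inj₂ w) (inj₁ (F (suc zero) i)) in e₁
            ... | true  | _     = zero , e₀
            ... | false | true  = suc zero , e₁
            ... | false | false = contradiction (i , e₀ , e₁) ¬both
            F-red : ∀ {i j} → i ≢ j → ∀ b b′ → R true (inj₁ (F b i)) (inj₁ (F b′ j))
            F-red i≢j zero    zero    = edge i≢j (κ-red true true) 0 0
            F-red i≢j zero    (suc _) = edge i≢j (κ-red true false) 0 0
            F-red i≢j (suc _) zero    = edge i≢j (κ-red false true) 0 0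
            F-red i≢j (suc _) (suc _) = edge i≢j (κ-red false false) 0 0

        red-across : Result
        red-across = go (Fin.any? λ i → Fin.any? λ a → Fin.any? λ b → cᵛ (H i true (toℕ a)) (H i false (toℕ b)) Bool.≟ true)
          where
          go : Dec (∃[ i ] ∃[ a ] ∃[ b ] cᵛ (H i true (toℕ {suc p} a)) (H i false (toℕ {suc p} b)) ≡ true) → Result
          go (yes (i , a , b , e)) = inner-clique i (toℕ a) (toℕ b) e
          go (no ¬red) = blue-inside λ i a b q q′ → Bool.¬-not λ e → ¬red (i , clamp p a , clamp p b ,
            trans (cong₂ (λ x y → cᵛ (H i true x) (H i false y)) (toℕ-clamp (s≤s q)) (toℕ-clamp (s≤s q′))) e)

    forced : Result
    forced = go (κ true true) (κ false false) (κ true false) refl refl refl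
      where
      go : ∀ x y z → κ true true ≡ x → κ false false ≡ y → κ true false ≡ z → Result
      go false _ _ e _ _ = blue-side true e
      go true false _ _ e _ = blue-side false e
      go true true z e e′ e″ = across z e″
        where
        red : ∀ σ → κ σ σ ≡ true
        red true  = e
        red false = e′
        open AllRed red
        across : ∀ z → κ true false ≡ z → Result
        across false = blue-across
        across true  = red-across

  base : Base (Complete (suc m)) (Cycle (2 + h)) (2 * m)
  base = record { V-finite = finite ; A = A ; A? = λ u v → r? u v ⊎-dec ¬? (side u Bool.≟ side v) ; A-sym = λ {u} {v} → A-sym {u} {v}
    ; A-irrefl = λ {v} → A-irrefl {v} ; good = good ; good-sym = good-sym ; good₁ = no-red ; good₂ = no-blue ; forced = forced }

-- Two odd cycles: the odd girth of interleaving sequences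

-- Each value of `f′` lies between two consecutive values of `f`, so the passage between the
-- sequences moves an index by `g` or by `g + 1`, according to the direction of the inequality. This
-- slack of one per edge is what limits the odd girth.
record Shift (g s : ℕ) (f f′ : ℕ → ℕ) : Set where
  field
    above : ∀ i → i + g ≤ s → f (i + g) < f′ i
    below : ∀ i → suc (i + g) ≤ s → f′ i < f (suc (i + g))

module _ (dir : ℕ → Bool) where

  forward backward : ℕ → ℕ
  forward zero     = 0
  forward (suc t)  = if dir t then suc (forward t) else forward t
  backward zero    = 0
  backward (suc t) = if dir t then backward t else suc (backward t)

  forward+backward : ∀ t → forward t + backward t ≡ t
  forward+backward zero = refl
  forward+backward (suc t) with dir t
  ... | true  = cong suc (forward+backward t)
  ... | false = trans (+-suc (forward t) _) (cong suc (forward+backward t))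

  forward-≤ : ∀ t → forward t ≤ t
  forward-≤ t = ≤-trans (m≤m+n _ (backward t)) (≤-reflexive (forward+backward t))

  backward-≤ : ∀ t → backward t ≤ t
  backward-≤ t = ≤-trans (m≤n+m _ (forward t)) (≤-reflexive (forward+backward t))

  -- a value is traced along the walk: its index drops by α at each forward and rises by β at each backward step
  module Drift (_≺_ : ℕ → ℕ → Set) (≺-trans : ∀ {a b c} → a ≺ b → b ≺ c → a ≺ c) (val : ℕ → ℕ → ℕ) (α β M s K : ℕ)
    (fw : ∀ t → t < K → dir t ≡ true → ∀ i → i + α ≤ s → val t (i + α) ≺ val (suc t) i)
    (bw : ∀ t → t < K → dir t ≡ false → ∀ i → i + β ≤ s → val t i ≺ val (suc t) (i + β))
    (low : K * α ≤ M) (high : M + K * β ≤ s) where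

    index : ℕ → ℕ
    index t = (M + backward t * β) ∸ forward t * α

    private
      step : ∀ t → t < K → ∀ d → dir t ≡ d → val t (index t) ≺ val (suc t) (index (suc t))
      step t t<K true e = subst₂ _≺_ (cong (val t) back) (cong (val (suc t)) (sym now)) (fw t t<K e _ in-range)
        where
        now : index (suc t) ≡ (M + backward t * β) ∸ (α + forward t * α)
        now = cong₂ (λ x y → (M + x * β) ∸ y * α) (cong (λ b → if b then backward t else suc (backward t)) e)
          (cong (λ b → if b then suc (forward t) else forward t) e)
        enough : α + forward t * α ≤ M + backward t * β
        enough = ≤-trans (*-monoˡ-≤ α {suc (forward t)} (≤-trans (s≤s (forward-≤ t)) t<K)) (≤-trans low (m≤m+n M _))
        back : (M + backward t * β) ∸ (α + forward t * α) + α ≡ index t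
        back = trans (cong (_+ α) (sym (∸-+-assoc (M + backward t * β) α (forward t * α)))) (eq (M + backward t * β) (forward t * α) α enough)
          where
          eq : ∀ m x a → a + x ≤ m → m ∸ a ∸ x + a ≡ m ∸ x
          eq m x a p = trans (cong (_+ a) (trans (∸-+-assoc m a x) (trans (cong (m ∸_) (+-comm a x)) (sym (∸-+-assoc m x a)))))
            (m∸n+n≡m (m+n≤o⇒m≤o∸n a p))
        in-range : (M + backward t * β) ∸ (α + forward t * α) + α ≤ s
        in-range = ≤-trans (≤-reflexive back) (≤-trans (m∸n≤m _ (forward t * α))
          (≤-trans (+-monoʳ-≤ M (*-monoˡ-≤ β (≤-trans (backward-≤ t) (<⇒≤ t<K)))) high))
      step t t<K false e = subst (λ i → val t (index t) ≺ val (suc t) i) (sym now) (bw t t<K e (index t) in-range)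
        where
        enough : forward t * α ≤ M + backward t * β
        enough = ≤-trans (*-monoˡ-≤ α (≤-trans (forward-≤ t) (<⇒≤ t<K))) (≤-trans low (m≤m+n M _))
        now : index (suc t) ≡ index t + β
        now = trans (cong₂ (λ x y → (M + x * β) ∸ y * α) (cong (λ b → if b then backward t else suc (backward t)) e)
          (cong (λ b → if b then suc (forward t) else forward t) e))
          (trans (cong (_∸ forward t * α) (eq M β (backward t * β))) (+-∸-comm β enough))
          where
          eq : ∀ m b x → m + (b + x) ≡ m + x + b
          eq = solve-∀
        in-range : index t + β ≤ s
        in-range = ≤-trans (+-monoˡ-≤ β (m∸n≤m _ (forward t * α))) (≤-trans (≤-reflexive (eq M (backward t * β) β))
          (≤-trans (+-monoʳ-≤ M (*-monoˡ-≤ β {suc (backward t)} (≤-trans (s≤s (backward-≤ t)) t<K))) high))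
          where
          eq : ∀ m x b → m + x + b ≡ m + (b + x)
          eq = solve-∀

    drift : ∀ t → t < K → val 0 M ≺ val (suc t) (index (suc t))
    drift zero p = subst (λ i → val 0 i ≺ val 1 (index 1)) (+-identityʳ M) (step 0 p (dir 0) refl)
    drift (suc t) p = ≺-trans (drift t (<-trans (n<1+n t) p)) (step (suc t) p (dir (suc t)) refl)

-- Suppose forward steps prevail. A value is followed upwards from index `M`; forward steps lower
-- the index by `g`, backward steps raise it by `suc g`. The backward steps number at most `a ≤ g`,
-- so the index ends at or below `M` although the value has grown, against monotonicity. With more
-- backward steps all is mirrored. The sizes of `M` and `s` keep the indices in range.
odd-girth : ∀ {V : Set} (seq : V → ℕ → ℕ) g M s a → a ≤ g → suc (suc (a + a)) * suc g ≤ M → M + suc (suc (a + a)) * suc g ≤ s →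
  ¬ ClosedWalk (λ u v → Shift g s (seq u) (seq v) ⊎ Shift g s (seq v) (seq u)) (suc (a + a))
odd-girth {V} seq g M s a a≤g low high W = majority (<-cmp F B)
  where
  open ClosedWalk W
  K = suc (a + a)
  val : ℕ → ℕ → ℕ
  val t = seq (at t)
  direction : ∀ t → Dec (t < K) → Bool
  direction t (yes p) = [ (λ _ → true) , (λ _ → false) ]′ (step t p)
  direction t (no _)  = true
  dir : ℕ → Bool
  dir t = direction t (t <? K)
  is-forward : ∀ t → t < K → dir t ≡ true → Shift g s (val t) (val (suc t))
  is-forward t p e with t <? K
  ... | no ¬p = contradiction p ¬p
  ... | yes p′ with step t p′
  ... | inj₁ S = S
  is-backward : ∀ t → t < K → dir t ≡ false → Shift g s (val (suc t)) (val t)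
  is-backward t p e with t <? K
  ... | no ¬p = contradiction p ¬p
  ... | yes p′ with step t p′
  ... | inj₂ S = S
  F = forward dir K
  B = backward dir K
  F+B : F + B ≡ K
  F+B = forward+backward dir K
  half-≤ : ∀ x y → x + y ≡ K → x < y → x ≤ g
  half-≤ x y e x<y = ≤-trans (≮⇒≥ λ a<x → <⇒≱ (≤-reflexive (cong suc (sym (+-suc a a))))
    (≤-trans (+-mono-≤ a<x (≤-trans a<x (<⇒≤ x<y))) (≤-reflexive e))) a≤g
  K-g : ∀ {x} → x ≤ suc g → K * x + suc g ≤ M
  K-g {x} p = ≤-trans (+-monoˡ-≤ (suc g) (*-monoʳ-≤ K p)) (≤-trans (≤-reflexive (+-comm (K * suc g) _)) low)
  K-high : ∀ {x} → x ≤ suc g → M + K * x + suc g ≤ s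
  K-high {x} p = ≤-trans (≤-reflexive (+-assoc M _ _)) (≤-trans (+-monoʳ-≤ M (≤-trans (+-monoˡ-≤ (suc g) (*-monoʳ-≤ K p)) (≤-reflexive (+-comm (K * suc g) _)))) high)
  -- Two neighbouring entries of the first sequence are separated by an entry of the second,
  -- whichever way the first step of the walk goes.
  increasing : ∀ j → g ≤ j → suc (suc j) + g ≤ s → val 0 j < val 0 (suc j)
  increasing j g≤j bd = go (dir 0) refl
    where
    go : ∀ d → dir 0 ≡ d → val 0 j < val 0 (suc j)
    go true e = subst (λ x → val 0 x < val 0 (suc x)) (m∸n+n≡m g≤j) (<-trans
      (Shift.above S (j ∸ g) (≤-trans (≤-reflexive (m∸n+n≡m g≤j)) j≤s))
      (Shift.below S (j ∸ g) (≤-trans (≤-reflexive (cong suc (m∸n+n≡m g≤j))) (≤-trans (n≤1+n _) (≤-trans (m≤m+n (suc (suc j)) g) bd)))))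
      where
      S = is-forward 0 (s≤s z≤n) e
      j≤s : j ≤ s
      j≤s = ≤-trans (≤-trans (n≤1+n j) (n≤1+n _)) (≤-trans (m≤m+n (suc (suc j)) g) bd)
    go false e = <-trans (Shift.below S j (≤-trans (n≤1+n _) bd)) (Shift.above S (suc j) (≤-trans (n≤1+n _) bd))
      where
      S = is-backward 0 (s≤s z≤n) e
  monotone : ∀ i d → g ≤ i → suc (i + d) + g ≤ s → val 0 i ≤ val 0 (i + d)
  monotone i zero _ _ = ≤-reflexive (cong (val 0) (sym (+-identityʳ i)))
  monotone i (suc d) p bd = ≤-trans (monotone i d p (≤-trans (n≤1+n _) (≤-trans (≤-reflexive (cong (λ x → suc (x + g)) (sym (+-suc i d)))) bd)))
    (<⇒≤ (subst (λ x → val 0 (i + d) < val 0 x) (sym (+-suc i d)) (increasing (i + d) (≤-trans p (m≤m+n i d))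
      (≤-trans (≤-reflexive (cong (λ x → suc (x + g)) (sym (+-suc i d)))) bd))))
  more-forward : B < F → ⊥
  more-forward B<F = <⇒≱ (subst (λ v → val 0 M < seq v I) close (drift (a + a) ≤-refl)) mono
    where
    open Drift dir _<_ <-trans val g (suc g) M s K (λ t p e → Shift.above (is-forward t p e))
      (λ t p e i q → subst (λ x → val t i < val (suc t) x) (sym (+-suc i g)) (Shift.below (is-backward t p e) i (≤-trans (≤-reflexive (sym (+-suc i g))) q)))
      (≤-trans (m≤m+n _ (suc g)) (K-g (n≤1+n g))) (≤-trans (m≤m+n _ (suc g)) (K-high ≤-refl))
    I = index K
    -- Since `B ≤ g` and `B < F`, one has `B * suc g = B * g + B ≤ suc B * g ≤ F * g`.
    I≤M : I ≤ M
    I≤M = m≤n+o⇒m∸n≤o _ (F * g) (≤-trans (+-monoʳ-≤ M (≤-trans (≤-reflexive (*-suc B g)) (≤-trans (+-monoˡ-≤ (B * g) (half-≤ B F (trans (+-comm B F) F+B) B<F)) (*-monoˡ-≤ g B<F)))) (≤-reflexive (+-comm M (F * g))))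
    g≤I : g ≤ I
    g≤I = m+n≤o⇒m≤o∸n g (≤-trans (≤-trans (≤-reflexive (+-comm g (F * g))) (≤-trans (+-mono-≤ (*-monoˡ-≤ g (forward-≤ dir K)) (n≤1+n g)) (K-g (n≤1+n g)))) (m≤m+n M _))
    mono : val 0 I ≤ val 0 M
    mono = subst (λ x → val 0 I ≤ val 0 x) (m+[n∸m]≡n I≤M) (monotone I (M ∸ I) g≤I
      (≤-trans (≤-reflexive (trans (cong (λ x → suc x + g) (m+[n∸m]≡n I≤M)) (sym (+-suc M g)))) (≤-trans (+-monoˡ-≤ (suc g) (m≤m+n M (K * g))) (K-high (n≤1+n g)))))
  more-backward : F < B → ⊥
  more-backward F<B = <⇒≱ (subst (λ v → seq v I < val 0 M) close (drift (a + a) ≤-refl)) mono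
    where
    open Drift dir (λ x y → y < x) (λ p q → <-trans q p) val (suc g) g M s K
      (λ t p e i q → subst (λ x → val (suc t) i < val t x) (sym (+-suc i g)) (Shift.below (is-forward t p e) i (≤-trans (≤-reflexive (sym (+-suc i g))) q)))
      (λ t p e → Shift.above (is-backward t p e))
      (≤-trans (m≤m+n _ (suc g)) (K-g ≤-refl)) (≤-trans (m≤m+n _ (suc g)) (K-high (n≤1+n g)))
    I = index K
    M≤I : M ≤ I
    M≤I = m+n≤o⇒m≤o∸n M (+-monoʳ-≤ M (≤-trans (≤-reflexive (*-suc F g)) (≤-trans (+-monoˡ-≤ (F * g) (half-≤ F B F+B F<B)) (*-monoˡ-≤ g F<B))))
    I-high : suc I + g ≤ s
    I-high = ≤-trans (≤-reflexive (sym (+-suc I g))) (≤-trans (+-monoˡ-≤ (suc g) (≤-trans (m∸n≤m _ (F * suc g)) (+-monoʳ-≤ M (*-monoˡ-≤ g (backward-≤ dir K))))) (K-high (n≤1+n g)))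
    mono : val 0 M ≤ val 0 I
    mono = subst (λ x → val 0 M ≤ val 0 x) (m+[n∸m]≡n M≤I) (monotone M (I ∸ M)
      (≤-trans (≤-trans (n≤1+n g) (m≤n+m (suc g) (K * suc g))) (K-g ≤-refl)) (subst (λ x → suc x + g ≤ s) (sym (m+[n∸m]≡n M≤I)) I-high))
  majority : _ → ⊥
  majority (tri< p _ _) = more-backward p
  majority (tri≈ _ p _) = odd≢double F a (trans (sym F+B) (cong (F +_) (sym p)))
    where
    odd≢double : ∀ x a → suc (a + a) ≢ x + x
    odd≢double (suc x) zero e = contradiction (trans (suc-injective e) (+-suc x x)) λ ()
    odd≢double (suc x) (suc a) e = odd≢double x a (suc-injective (trans (cong suc (sym (+-suc a a))) (trans (suc-injective e) (+-suc x x))))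
  majority (tri> _ _ p) = more-forward p

-- Configurations of arithmetic progressions

<-by : ∀ {x y} d → x + suc d ≡ y → x < y
<-by {x} d refl = ≤-trans (s≤s (m≤m+n x d)) (≤-reflexive (sym (+-suc x d)))

Point : Set
Point = ℕ × ℕ

swap : Point → Point
swap (a , c) = c , a

-- The point (a , c) stands for the progressions a, a + δ, … and c, c + δ, … in the two coordinates.
module Progressions (δ S : ℕ) where

  -- Adding multiples of `δ` to this inequality between first terms gives `Shift` with delay `g` for
  -- the progressions.
  Interleaved : ℕ → ℕ → ℕ → Set
  Interleaved g a a′ = a + g * δ < a′ × a′ < a + g * δ + δ

  -- With `S` the extent of a progression, the second one begins after the first has ended. This
  -- fixes the relative order of all terms, as an application of Ramsey's theorem requires.
  Far : ℕ → ℕ → Set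
  Far c c′ = c + S < c′

  Step : ℕ → Point → Point → Set
  Step g (a , c) (a′ , c′) = Interleaved g a a′ × Far c c′

  Adj₁ Adj₂ : ℕ → Point → Point → Set
  Adj₁ g u v = Step g u v ⊎ Step g v u
  Adj₂ g u v = Adj₁ g (swap u) (swap v)

  record Zigzag (g h : ℕ) (x y : Point) (X top : ℕ) : Set where
    field
      link  : Link (Adj₁ g) h x y
      bound : ∀ i → i ≤ h → proj₁ (Link.at link i) ≤ X × proj₂ (Link.at link i) ≤ top

  module _ {g q G θ a₀ c c′ e top : ℕ} (1≤q : 1 ≤ q) (G≤q : G ≤ q) (θ≤ : θ + 3 ≤ δ)
    (e> : a₀ + g * δ < e) (e< : e < a₀ + g * δ + δ) (S<c : S < c) (S<c′ : S < c′) (c-far : c + S < top) (c′<top : c′ < top)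
    (e≢ : e ≢ a₀ + G * θ + q) where

    private
      -- First coordinates of the lower points on the path: they fall by `suc θ` for `G` steps and
      -- then by 1, down to `a₀`. The falls are small enough for consecutive lower points to share
      -- an upper neighbour, and `G` and `θ` regulate the distance between the ends.
      low : ℕ → ℕ
      low j = a₀ + (G ∸ j) * θ + (q ∸ j)

      suc-∸ : ∀ m {j} → j < m → m ∸ j ≡ suc (m ∸ suc j)
      suc-∸ (suc m) {zero}  _       = refl
      suc-∸ (suc m) {suc j} (s≤s p) = suc-∸ m p

      G-step : ∀ j → (G ∸ suc j) * θ ≤ (G ∸ j) * θ × (G ∸ j) * θ ≤ (G ∸ suc j) * θ + θ
      G-step j = *-monoˡ-≤ θ (∸-monoʳ-≤ G (n≤1+n j)) , ≤-trans (*-monoˡ-≤ θ (pred-step G j)) (≤-reflexive (+-comm θ _))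
        where
        pred-step : ∀ m j → m ∸ j ≤ suc (m ∸ suc j)
        pred-step zero j = ≤-trans (≤-reflexive (0∸n≡0 j)) z≤n
        pred-step (suc m) zero = ≤-refl
        pred-step (suc m) (suc j) = pred-step m j

      low-suc : ∀ j → j < q → low (suc j) < low j × low j ≤ low (suc j) + θ + 1
      low-suc j p rewrite suc-∸ q p =
        ≤-trans (s≤s (+-monoˡ-≤ (q ∸ suc j) (+-monoʳ-≤ a₀ (proj₁ (G-step j))))) (≤-reflexive (sym (+-suc _ _))) ,
        ≤-trans (+-monoˡ-≤ (suc (q ∸ suc j)) (+-monoʳ-≤ a₀ (proj₂ (G-step j)))) (≤-reflexive (eq a₀ ((G ∸ suc j) * θ) θ (q ∸ suc j)))
        where
        eq : ∀ a x t y → a + (x + t) + suc y ≡ a + x + y + t + 1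
        eq = solve-∀

      low-anti : ∀ i d → i + suc d ≤ q → low (i + suc d) < low i
      low-anti i zero p = subst (λ x → low x < low i) (+-comm 1 i) (proj₁ (low-suc i (≤-trans (≤-reflexive (+-comm 1 i)) p)))
      low-anti i (suc d) p = <-trans (subst (λ x → low x < low (i + suc d)) (sym (+-suc i (suc d))) (proj₁ (low-suc (i + suc d) (≤-trans (≤-reflexive (sym (+-suc i (suc d)))) p))))
        (low-anti i d (≤-trans (n≤1+n _) (≤-trans (≤-reflexive (sym (+-suc i (suc d)))) p)))

      low-< : ∀ {i j} → i < j → j ≤ q → low j < low i
      low-< {i} {j} i<j p = subst (λ x → low x < low i) ij (low-anti i (j ∸ suc i) (≤-trans (≤-reflexive ij) p))
        where
        ij : i + suc (j ∸ suc i) ≡ j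
        ij = trans (+-suc i _) (m+[n∸m]≡n i<j)

      low-inj : ∀ {i j} → i ≤ q → j ≤ q → low i ≡ low j → i ≡ j
      low-inj {i} {j} p r e with <-cmp i j
      ... | tri< i<j _ _ = contradiction (sym e) (<⇒≢ (low-< i<j r))
      ... | tri≈ _ i≡j _ = i≡j
      ... | tri> _ _ j<i = contradiction e (<⇒≢ (low-< j<i p))

      low-≤ : ∀ {j} → j ≤ q → low j ≤ low 0
      low-≤ {zero} _ = ≤-refl
      low-≤ {suc j} p = <⇒≤ (low-< (s≤s z≤n) p)

      low-q : low q ≡ a₀
      low-q = trans (cong₂ (λ x y → a₀ + x * θ + y) (m≤n⇒m∸n≡0 G≤q) (n∸n≡0 q)) (trans (+-identityʳ _) (+-identityʳ a₀))

      high : ℕ → ℕ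
      high j = low j + g * δ + 1

      u v : ℕ → Point
      u zero    = low 0 , c
      u (suc j) = low (suc j) , 0
      v j = if ⌊ j ≟ q ⌋ then (e , c′) else (high j , top)

      v-view : ∀ j → (j ≡ q × v j ≡ (e , c′)) ⊎ (j ≢ q × v j ≡ (high j , top))
      v-view j with j ≟ q
      ... | yes p = inj₁ (p , refl)
      ... | no p  = inj₂ (p , refl)

      S<top : S < top
      S<top = ≤-<-trans (m≤n+m S c) c-far

      2<δ : 2 < δ
      2<δ = ≤-trans (m≤n+m 3 θ) θ≤

      u-inj : ∀ {i j} → i ≤ q → j ≤ q → u i ≡ u j → i ≡ j
      u-inj {zero} {zero} _ _ _ = refl
      u-inj {zero} {suc j} _ _ e = contradiction (subst (S <_) (cong proj₂ e) S<c) λ ()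
      u-inj {suc i} {zero} _ _ e = contradiction (subst (S <_) (cong proj₂ (sym e)) S<c) λ ()
      u-inj {suc i} {suc j} p r e = low-inj p r (cong proj₁ e)

      v-inj : ∀ {i j} → i ≤ q → j ≤ q → v i ≡ v j → i ≡ j
      v-inj {i} {j} p r eq with v-view i | v-view j
      ... | inj₁ (x , _) | inj₁ (y , _) = trans x (sym y)
      ... | inj₁ (_ , x) | inj₂ (_ , y) = contradiction (cong proj₂ (trans (sym x) (trans eq y))) (<⇒≢ c′<top)
      ... | inj₂ (_ , x) | inj₁ (_ , y) = contradiction (sym (cong proj₂ (trans (sym x) (trans eq y)))) (<⇒≢ c′<top)
      ... | inj₂ (_ , x) | inj₂ (_ , y) = low-inj p r (+-cancelʳ-≡ (g * δ) _ _ (+-cancelʳ-≡ 1 _ _ (cong proj₁ (trans (sym x) (trans eq y)))))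

      uv : ∀ {i j} → i ≤ q → j ≤ q → u i ≢ v j
      uv {zero} {j} _ _ eq with v-view j
      ... | inj₁ (_ , x) = e≢ (sym (cong proj₁ (trans eq x)))
      ... | inj₂ (_ , x) = contradiction (cong proj₂ (trans eq x)) (<⇒≢ (≤-<-trans (m≤m+n c S) c-far))
      uv {suc i} {j} _ _ eq with v-view j
      ... | inj₁ (_ , x) = contradiction (subst (S <_) (sym (cong proj₂ (trans eq x))) S<c′) λ ()
      ... | inj₂ (_ , x) = contradiction (subst (S <_) (sym (cong proj₂ (trans eq x))) S<top) λ ()

      rise : ∀ j → low j + g * δ < high j × high j < low j + g * δ + δ
      rise j = <-by 0 refl , +-monoʳ-< (low j + g * δ) (<-trans (s≤s (s≤s z≤n)) 2<δ)

      uv-step : ∀ j → j ≤ q → Adj₁ g (u j) (v j)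
      uv-step j p with v-view j
      uv-step zero p | inj₁ (x , _) = contradiction x (<⇒≢ 1≤q)
      uv-step zero p | inj₂ (_ , x) = inj₁ (subst (Step g (low 0 , c)) (sym x) (rise 0 , c-far))
      uv-step (suc j) p | inj₁ (refl , x) = inj₁ (subst (Step g (low (suc j) , 0)) (sym x)
        (subst (λ l → Interleaved g l e) (sym low-q) (e> , e<) , S<c′))
      uv-step (suc j) p | inj₂ (_ , x) = inj₁ (subst (Step g (low (suc j) , 0)) (sym x) (rise (suc j) , S<top))

      vu-step : ∀ j → j < q → Adj₁ g (v j) (u (suc j))
      vu-step j p with v-view j
      ... | inj₁ (x , _) = contradiction x (<⇒≢ p)
      ... | inj₂ (_ , x) = inj₂ (subst (Step g (low (suc j) , 0)) (sym x) ((lower , upper) , S<top))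
        where
        lower : low (suc j) + g * δ < high j
        lower = <-trans (+-monoˡ-< (g * δ) (proj₁ (low-suc j p))) (proj₁ (rise j))
        upper : high j < low (suc j) + g * δ + δ
        upper = ≤-trans (s≤s (+-monoˡ-≤ 1 (+-monoˡ-≤ (g * δ) (proj₂ (low-suc j p)))))
          (≤-trans (≤-reflexive (eq (low (suc j)) θ (g * δ))) (+-monoʳ-≤ (low (suc j) + g * δ) θ≤))
          where
          eq : ∀ l t x → suc (l + t + 1 + x + 1) ≡ l + x + (t + 3)
          eq = solve-∀

    zigzag : Zigzag g (suc (q + q)) (a₀ + G * θ + q , c) (e , c′) (a₀ + G * θ + q + g * δ + 1 + e) top
    zigzag = record
      { link = record { at = zig u v ; start = refl ; end = trans (Link.end L) (v-q (v-view q)) ; inj = Link.inj L ; step = Link.step L }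
      ; bound = λ i p → bound i p (half i) }
      where
      L = zig-link {R = Adj₁ g} u v q u-inj v-inj uv uv-step vu-step
      v-q : _ → v q ≡ (e , c′)
      v-q (inj₁ (_ , x)) = x
      v-q (inj₂ (x , _)) = contradiction refl x
      X = a₀ + G * θ + q + g * δ + 1 + e
      u-bound : ∀ j → j ≤ q → proj₁ (u j) ≤ X × proj₂ (u j) ≤ top
      u-bound zero p = ≤-trans (m≤m+n _ (g * δ)) (≤-trans (m≤m+n _ 1) (m≤m+n _ e)) , ≤-trans (m≤m+n c S) (<⇒≤ c-far)
      u-bound (suc j) p = ≤-trans (low-≤ p) (≤-trans (m≤m+n _ (g * δ)) (≤-trans (m≤m+n _ 1) (m≤m+n _ e))) , z≤n
      v-bound : ∀ j → j ≤ q → proj₁ (v j) ≤ X × proj₂ (v j) ≤ top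
      v-bound j p with v-view j
      ... | inj₁ (_ , x) rewrite x = m≤n+m e _ , <⇒≤ c′<top
      ... | inj₂ (_ , x) rewrite x = ≤-trans (+-monoˡ-≤ 1 (+-monoˡ-≤ (g * δ) (low-≤ p))) (m≤m+n _ e) , ≤-refl
      bound : ∀ i → i ≤ suc (q + q) → Half i → proj₁ (zig u v i) ≤ X × proj₂ (zig u v i) ≤ top
      bound _ p (even j) = subst (λ x → proj₁ x ≤ X × proj₂ x ≤ top) (sym (zig-even u v j)) (u-bound j (≤-pred (double-< {j} {suc q} (s≤s (≤-trans p (≤-reflexive (sym (+-suc q q))))))))
      bound _ (s≤s p) (odd j) = subst (λ x → proj₁ x ≤ X × proj₂ x ≤ top) (sym (zig-odd u v j))
        (v-bound j (≤-pred (double-< {j} {suc q} (s≤s (≤-trans p (≤-trans (n≤1+n _) (≤-reflexive (sym (+-suc q q)))))))))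

ends-apart : ∀ a d → a + suc d ≢ a
ends-apart a d e = contradiction (+-cancelˡ-≡ a (suc d) 0 (trans e (sym (+-identityʳ a)))) λ ()

suc-∸1 : ∀ {q} → 1 ≤ q → suc (q ∸ 1) ≡ q
suc-∸1 = m+[n∸m]≡n

-- δ = 7 + η leaves room for links of length 2q + 1 between points whose first coordinates differ by N or by 2N.
module Links (q ζ η S : ℕ) (1≤q : 1 ≤ q) (η≡ : η ≡ suc (3 * q + ζ)) where

  private
    δ g N : ℕ
    δ = 7 + η
    g = suc q
    N = δ + (q + q) + 1

  open Progressions δ S

  private module _ {c c′ top : ℕ} (S<c : S < c) (S<c′ : S < c′) (c-far : c + S < top) (c′<top : c′ < top) where

    -- The descent is the largest possible, `θ = δ - 3`. Then `a + N` equals `a₀ + g * δ + 1`, the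
    -- least first coordinate that an upper neighbour of `a₀` can have.
    link₁-from : ∀ a₀ → let a = a₀ + q * (5 + η) in Zigzag g (suc (q + q)) (a , c) (a + N , c′) (a + g * δ + 1 + (a + N)) top
    link₁-from a₀ = subst (λ a → Zigzag g (suc (q + q)) (a , c) (a₀ + q * (5 + η) + N , c′) (a + g * δ + 1 + (a₀ + q * (5 + η) + N)) top)
      (start a₀ q η) (zigzag {g} {q} {q} {4 + η} {a₀} 1≤q ≤-refl (≤-reflexive (+-comm (4 + η) 3))
        (<-by 0 (lower a₀ q η)) (<-by (5 + η) (upper a₀ q η)) S<c S<c′ c-far c′<top
        (λ e → ends-apart (a₀ + q * (5 + η)) (7 + η + (q + q)) (trans (trans (cong (a₀ + q * (5 + η) +_) (N-suc q η)) e) (start a₀ q η))))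
      where
      start : ∀ a q η → a + q * (4 + η) + q ≡ a + q * (5 + η)
      start = solve-∀
      lower : ∀ a q η → a + suc q * (7 + η) + 1 ≡ a + q * (5 + η) + (7 + η + (q + q) + 1)
      lower = solve-∀
      upper : ∀ a q η → a + q * (5 + η) + (7 + η + (q + q) + 1) + suc (5 + η) ≡ a + suc q * (7 + η) + (7 + η)
      upper = solve-∀
      N-suc : ∀ q η → suc (7 + η + (q + q)) ≡ 7 + η + (q + q) + 1
      N-suc = solve-∀

    -- The smaller descent `θ = η - 1` moves the far end out to `a + (N + N)`. It is large enough to
    -- be an upper neighbour of `a₀` because `η` exceeds `3 * q`, and small enough because `q ≥ 1`;
    -- hence the value of `η`.
    link₂-from : ∀ θ → η ≡ suc θ → θ ≡ 3 * q + ζ → ∀ a₀ → let a = a₀ + q * η in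
      Zigzag g (suc (q + q)) (a , c) (a + (N + N) , c′) (a + g * δ + 1 + (a + (N + N))) top
    link₂-from θ refl θ≡ a₀ = subst (λ a → Zigzag g (suc (q + q)) (a , c) (a₀ + q * η + (N + N) , c′) (a + g * δ + 1 + (a₀ + q * η + (N + N))) top)
      (start a₀ q θ) (zigzag {g} {q} {q} {θ} {a₀} 1≤q ≤-refl θ≤
        (subst (λ θ → a₀ + g * (7 + suc θ) < a₀ + q * suc θ + (7 + suc θ + (q + q) + 1 + (7 + suc θ + (q + q) + 1))) (sym θ≡) (<-by (9 + ζ) (lower a₀ q ζ)))
        (subst (λ q → a₀ + q * η + (7 + η + (q + q) + 1 + (7 + η + (q + q) + 1)) < a₀ + suc q * (7 + η) + (7 + η)) (suc-∸1 1≤q) (<-by (3 * (q ∸ 1)) (upper a₀ (q ∸ 1) η))) S<c S<c′ c-far c′<top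
        (λ e → ends-apart (a₀ + q * η) (15 + η + η + (q + q) + (q + q)) (trans (trans (cong (a₀ + q * η +_) (N-suc q η)) e) (start a₀ q θ))))
      where
      θ≤ : θ + 3 ≤ δ
      θ≤ = ≤-trans (≤-reflexive (+-comm θ 3)) (+-mono-≤ {3} {7} (s≤s (s≤s (s≤s z≤n))) (n≤1+n _))
      start : ∀ a q θ → a + q * θ + q ≡ a + q * suc θ
      start = solve-∀
      lower : ∀ a q ζ → a + suc q * (7 + suc (3 * q + ζ)) + suc (9 + ζ) ≡
        a + q * suc (3 * q + ζ) + (7 + suc (3 * q + ζ) + (q + q) + 1 + (7 + suc (3 * q + ζ) + (q + q) + 1))
      lower = solve-∀
      upper : ∀ a q η → a + suc q * η + (7 + η + (suc q + suc q) + 1 + (7 + η + (suc q + suc q) + 1)) + suc (3 * q) ≡ a + suc (suc q) * (7 + η) + (7 + η)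
      upper = solve-∀
      N-suc : ∀ q η → suc (15 + η + η + (q + q) + (q + q)) ≡ 7 + η + (q + q) + 1 + (7 + η + (q + q) + 1)
      N-suc = solve-∀

    short-link-from : ∀ Q → g ≤ Q → Q ≤ η → ∀ a₀ → let a = a₀ + (g * (4 + η) + Q) in
      Zigzag g (suc (Q + Q)) (a , c) (a + (g + g) + 1 , c′) (a + g * δ + 1 + (a + (g + g) + 1)) top
    short-link-from Q g≤Q Q≤η a₀ = subst (λ a → Zigzag g (suc (Q + Q)) (a , c) (a + (g + g) + 1 , c′) (a + g * δ + 1 + (a + (g + g) + 1)) top)
      (+-assoc a₀ _ Q) (zigzag {g} {Q} {g} {4 + η} {a₀} (≤-trans (s≤s z≤n) g≤Q) g≤Q (≤-reflexive (+-comm (4 + η) 3))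
      (<-by (Q ∸ g) (trans (lower a₀ g η (Q ∸ g)) (cong (λ x → a₀ + g * (4 + η) + x + (g + g) + 1) (m∸n+n≡m g≤Q))))
      (≤-<-trans (≤-reflexive (eq₁ a₀ g η Q)) (≤-<-trans (+-monoʳ-≤ (a₀ + g * (6 + η) + 1) Q≤η) (<-by (5 + g) (eq₂ a₀ g η)))) S<c S<c′ c-far c′<top
      (λ e → ends-apart (a₀ + g * (4 + η) + Q) (g + g) (trans (eq₃ (a₀ + g * (4 + η) + Q) (g + g)) e)))
      where
      lower : ∀ a g η d → a + g * (7 + η) + suc d ≡ a + g * (4 + η) + (d + g) + (g + g) + 1
      lower = solve-∀
      eq₁ : ∀ a g η Q → a + g * (4 + η) + Q + (g + g) + 1 ≡ a + g * (6 + η) + 1 + Q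
      eq₁ = solve-∀
      eq₂ : ∀ a g η → a + g * (6 + η) + 1 + η + suc (5 + g) ≡ a + g * (7 + η) + (7 + η)
      eq₂ = solve-∀
      eq₃ : ∀ x y → x + suc y ≡ x + y + 1
      eq₃ = solve-∀

  module _ {c c′ top : ℕ} (S<c : S < c) (S<c′ : S < c′) (c-far : c + S < top) (c′<top : c′ < top) where

    link₁ : ∀ a → q * (5 + η) ≤ a → Zigzag g (suc (q + q)) (a , c) (a + N , c′) (a + g * δ + 1 + (a + N)) top
    link₁ a p = subst (λ a → Zigzag g (suc (q + q)) (a , c) (a + N , c′) (a + g * δ + 1 + (a + N)) top)
      (m∸n+n≡m p) (link₁-from S<c S<c′ c-far c′<top (a ∸ q * (5 + η)))

    link₂ : ∀ a → q * (5 + η) ≤ a → Zigzag g (suc (q + q)) (a , c) (a + (N + N) , c′) (a + g * δ + 1 + (a + (N + N))) top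
    link₂ a p = subst (λ a → Zigzag g (suc (q + q)) (a , c) (a + (N + N) , c′) (a + g * δ + 1 + (a + (N + N))) top)
      (m∸n+n≡m {a} {q * η} (≤-trans (*-monoʳ-≤ q (m≤n+m η 5)) p)) (link₂-from S<c S<c′ c-far c′<top (3 * q + ζ) η≡ refl (a ∸ q * η))

    -- closes up to an odd cycle of length 2Q + 3 with a common upper neighbour of its ends
    short-link : ∀ Q → g ≤ Q → Q ≤ η → ∀ a → g * (4 + η) + Q ≤ a →
      Zigzag g (suc (Q + Q)) (a , c) (a + (g + g) + 1 , c′) (a + g * δ + 1 + (a + (g + g) + 1)) top
    short-link Q g≤Q Q≤η a p = subst (λ a → Zigzag g (suc (Q + Q)) (a , c) (a + (g + g) + 1 , c′) (a + g * δ + 1 + (a + (g + g) + 1)) top)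
      (m∸n+n≡m p) (short-link-from S<c S<c′ c-far c′<top Q g≤Q Q≤η (a ∸ (g * (4 + η) + Q)))

  apex-start : ∀ a {c top} → c + S < top → Step g (a , c) (a + (g + g) + 1 + g * δ + 1 , top)
  apex-start a far = (<-by (g + g + 1) (lower a g (g * δ)) , subst (λ η → a + (suc q + suc q) + 1 + g * δ + 1 < a + g * δ + (7 + η)) (sym η≡) (<-by (3 + (q + ζ)) (upper a q ζ (g * δ)))) , far
    where
    lower : ∀ a g x → a + x + suc (g + g + 1) ≡ a + (g + g) + 1 + x + 1
    lower = solve-∀
    upper : ∀ a q ζ x → a + (suc q + suc q) + 1 + x + 1 + suc (3 + (q + ζ)) ≡ a + x + (7 + suc (3 * q + ζ))
    upper = solve-∀

  apex-end : ∀ a {c top} → c + S < top → Step g (a , c) (a + g * δ + 1 , top)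
  apex-end a far = (<-by 0 refl , +-monoʳ-< (a + g * δ) (s≤s (s≤s z≤n))) , far

-- Homogeneous arithmetic progressions in two coordinates

append : ℕ → (ℕ → ℕ) → (ℕ → ℕ) → ℕ → ℕ
append zero    f g j       = g j
append (suc U) f g zero    = f 0
append (suc U) f g (suc j) = append U (f ∘ suc) g j

append-left : ∀ U f g {j} → j < U → append U f g j ≡ f j
append-left (suc U) f g {zero}  _       = refl
append-left (suc U) f g {suc j} (s≤s p) = append-left U (f ∘ suc) g p

append-right : ∀ U f g j → append U f g (U + j) ≡ g j
append-right zero    f g j = refl
append-right (suc U) f g j = append-right U (f ∘ suc) g j

append-increasing : ∀ U W f g → Increasing U f → Increasing W g → (∀ j → j < U → f j < g 0) → Increasing (U + W) (append U f g)
append-increasing zero W f g If Ig f<g = Ig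
append-increasing (suc zero) W f g If Ig f<g zero p = f<g 0 (s≤s z≤n)
append-increasing (suc (suc U)) W f g If Ig f<g zero p = If 0 (s≤s (s≤s z≤n))
append-increasing (suc U) W f g If Ig f<g (suc j) (s≤s p) =
  append-increasing U W (f ∘ suc) g (λ j q → If (suc j) (s≤s q)) Ig (λ j q → f<g (suc j) (s≤s q)) j p

append-bound : ∀ U W f g L → (∀ j → j < U → f j < L) → (∀ j → j < W → g j < L) → ∀ j → j < U + W → append U f g j < L
append-bound zero    W f g L bf bg j       p       = bg j p
append-bound (suc U) W f g L bf bg zero    p       = bf 0 (s≤s z≤n)
append-bound (suc U) W f g L bf bg (suc j) (s≤s p) = append-bound U W (f ∘ suc) g L (λ j q → bf (suc j) (s≤s q)) bg j p

zig-bound : ∀ u v W L → (∀ j → j < W → u j < L) → (∀ j → j < W → v j < L) → ∀ j → j < W + W → zig u v j < L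
zig-bound u v W L bu bv j p = go (half j) p
  where
  go : ∀ {j} → Half j → j < W + W → zig u v j < L
  go (even a) p = subst (_< L) (sym (zig-even u v a)) (bu a (double-< p))
  go (odd a)  p = subst (_< L) (sym (zig-odd u v a)) (bv a (double-< (<-trans (n<1+n _) p)))

Seq : ℕ → ℕ → Set
Seq N s = Vec (Fin (suc N)) (suc s)

seq : ∀ {N s} → Seq N s → ℕ → ℕ
seq {s = s} v i = toℕ (Vec.lookup v (clamp s i))

sequence : ∀ N s → (ℕ → ℕ) → Seq N s
sequence N s X = tabulate (clamp N ∘ X ∘ toℕ)

sequence-cong : ∀ N s {X Y} → (∀ i → i < suc s → X i ≡ Y i) → sequence N s X ≡ sequence N s Y
sequence-cong N s e = Vec.tabulate-cong λ i → cong (clamp N) (e (toℕ i) (Fin.toℕ<n i))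

seq-sequence : ∀ N s X i → i ≤ s → X i < N → seq (sequence N s X) i ≡ X i
seq-sequence N s X i i≤s X< = trans (cong toℕ (trans (Vec.lookup∘tabulate (clamp N ∘ X ∘ toℕ) (clamp s i))
  (cong (clamp N ∘ X) (toℕ-clamp (s≤s i≤s))))) (toℕ-clamp (m≤n⇒m≤1+n X<))

module Homogeneity (g₁ g₂ s δ Z : ℕ) where

  open Progressions δ (s * δ)

  Bounded : Point → Set
  Bounded (a , c) = a ≤ Z × c ≤ Z

  private
    W U B L u : ℕ
    W = suc s + (g₁ + g₂)
    U = W + W
    B = suc (Z + W * δ)
    -- Indices below `B` serve the first coordinates, those from `B` on the second ones. A list of
    -- length `u` holds an interleaved pair in `U` entries and a separated pair in two blocks of
    -- `suc s`.
    L = B + B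
    u = U + (suc s + suc s)

    abstract
      ram : ∃[ N ] (∀ (c : Fin 2 → List ℕ → Bool) → Σ[ h ∈ (ℕ → ℕ) ]
        (∀ i j → i < j → j < L → h i < h j) × (∀ j → j < L → h j < N) ×
        Σ[ κ ∈ (Fin 2 → Bool) ] (∀ i f → Increasing u f → (∀ j → j < u → f j < L) → c i (applyUpTo (h ∘ f) u) ≡ κ i))
      ram = ramsey-increasing u 2 L

  N : ℕ
  N = proj₁ ram

  V : Set
  V = Seq N s × Seq N s

  record Embedding (c : V → V → Bool) : Set where
    field
      point     : Point → V
      injective : ∀ {p p′} → Bounded p → Bounded p′ → point p ≡ point p′ → p ≡ p′
      κ₁ κ₂     : Bool
      shift₁    : ∀ {p p′} → Bounded p → Bounded p′ → Step g₁ p p′ →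
        Shift g₁ s (seq (proj₁ (point p))) (seq (proj₁ (point p′))) × c (point p) (point p′) ≡ κ₁
      shift₂    : ∀ {p p′} → Bounded p → Bounded p′ → Step g₂ (swap p) (swap p′) →
        Shift g₂ s (seq (proj₂ (point p))) (seq (proj₂ (point p′))) × c (point p) (point p′) ≡ κ₂

  private
    -- The two progressions of an interleaved pair are read off alternately, the later one being shifted back by g steps.
    module Interleave (g a a′ : ℕ) (g≤ : g ≤ g₁ + g₂) (a≤Z : a ≤ Z) (a′≤Z : a′ ≤ Z) (I : Interleaved g a a′) where

      x x′ : ℕ → ℕ
      x j  = a + j * δ
      x′ j = (a′ ∸ g * δ) + j * δ

      gδ≤a′ : g * δ ≤ a′
      gδ≤a′ = <⇒≤ (≤-<-trans (m≤n+m (g * δ) a) (proj₁ I))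

      back : a′ ∸ g * δ + g * δ ≡ a′
      back = m∸n+n≡m gδ≤a′

      after : a < a′ ∸ g * δ
      after = +-cancelʳ-< (g * δ) a _ (<-≤-trans (proj₁ I) (≤-reflexive (sym back)))

      before : a′ ∸ g * δ < a + δ
      before = +-cancelʳ-< (g * δ) _ (a + δ) (<-≤-trans (≤-<-trans (≤-reflexive back) (proj₂ I)) (≤-reflexive (eq a (g * δ) δ)))
        where
        eq : ∀ a y d → a + y + d ≡ a + d + y
        eq = solve-∀

      increasing : Increasing U (zig x x′)
      increasing j p = zig-step {R = _<_} x x′ W (λ j _ → +-monoˡ-< (j * δ) after)
        (λ j _ → <-≤-trans (+-monoˡ-< (j * δ) before) (≤-reflexive (+-assoc a δ (j * δ)))) j p

      progression-≤ : ∀ {y} → y ≤ Z → ∀ j → j < W → y + j * δ < B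
      progression-≤ y≤Z j p = s≤s (+-mono-≤ y≤Z (*-monoˡ-≤ δ (<⇒≤ p)))

      bound : ∀ j → j < U → zig x x′ j < B
      bound = zig-bound x x′ W B (progression-≤ a≤Z) (progression-≤ (≤-trans (m∸n≤m a′ (g * δ)) a′≤Z))

      lower-in : ∀ i → i < suc s → i + i < U
      lower-in i p = +-mono-< i<W i<W
        where
        i<W : i < W
        i<W = <-≤-trans p (m≤m+n (suc s) (g₁ + g₂))

      upper-in : ∀ i → i < suc s → suc ((i + g) + (i + g)) < U
      upper-in i p = ≤-trans (≤-reflexive (cong suc (sym (+-suc (i + g) (i + g))))) (+-mono-≤ i+g<W i+g<W)
        where
        i+g<W : i + g < W
        i+g<W = +-mono-<-≤ p g≤

      lower-at : ∀ i → zig x x′ (i + i) ≡ a + i * δ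
      lower-at i = zig-even x x′ i

      upper-at : ∀ i → zig x x′ (suc ((i + g) + (i + g))) ≡ a′ + i * δ
      upper-at i = trans (zig-odd x x′ (i + g)) (trans (eq (a′ ∸ g * δ) i g δ) (cong (_+ i * δ) back))
        where
        eq : ∀ y i g d → y + (i + g) * d ≡ y + g * d + i * d
        eq = solve-∀

    module Blocks (c c′ : ℕ) (far : Far c c′) where

      blocks : ℕ → ℕ
      blocks = append (suc s) (λ j → c + j * δ) (λ j → c′ + j * δ)

      module _ (0<δ : 0 < δ) where

        increasing : Increasing (suc s + suc s) blocks
        increasing = append-increasing (suc s) (suc s) _ _ (rise c) (rise c′)
          λ j p → ≤-<-trans (+-monoʳ-≤ c (*-monoˡ-≤ δ (≤-pred p))) (<-≤-trans far (≤-reflexive (sym (+-identityʳ c′))))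
          where
          rise : ∀ y → Increasing (suc s) (λ j → y + j * δ)
          rise y j _ = +-monoʳ-< y (m<n+m (j * δ) 0<δ)

      bound : ∀ K → c ≤ K → c′ ≤ K → ∀ j → j < suc s + suc s → blocks j < suc (K + s * δ)
      bound K p p′ = append-bound (suc s) (suc s) _ _ _ (λ j q → s≤s (+-mono-≤ p (*-monoˡ-≤ δ (≤-pred q)))) (λ j q → s≤s (+-mono-≤ p′ (*-monoˡ-≤ δ (≤-pred q))))

      lower-at : ∀ i → i < suc s → blocks i ≡ c + i * δ
      lower-at i p = append-left (suc s) (λ j → c + j * δ) (λ j → c′ + j * δ) p

      upper-at : ∀ i → blocks (suc s + i) ≡ c′ + i * δ
      upper-at = append-right (suc s) (λ j → c + j * δ) (λ j → c′ + j * δ)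

    module Read (c : V → V → Bool) where

      -- For each kind of edge the entries of the two ends occupy fixed places in an increasing list
      -- that contains them. The ends can thus be read off the list, and a colour of edges becomes a
      -- colour of lists.
      lower₁ upper₁ lower₂ upper₂ : List ℕ → V
      lower₁ zs = sequence N s (λ i → nth zs (i + i)) , sequence N s (λ i → nth zs (U + i))
      upper₁ zs = sequence N s (λ i → nth zs (suc ((i + g₁) + (i + g₁)))) , sequence N s (λ i → nth zs (U + (suc s + i)))
      lower₂ zs = sequence N s (nth zs) , sequence N s (λ i → nth zs ((suc s + suc s) + (i + i)))
      upper₂ zs = sequence N s (λ i → nth zs (suc s + i)) , sequence N s (λ i → nth zs ((suc s + suc s) + suc ((i + g₂) + (i + g₂))))

      bits : Fin 2 → List ℕ → Bool
      bits zero    zs = c (lower₁ zs) (upper₁ zs)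
      bits (suc _) zs = c (lower₂ zs) (upper₂ zs)

    module Build (0<δ : 0 < δ) (c : V → V → Bool) (h : ℕ → ℕ) (h-mono : ∀ i j → i < j → j < L → h i < h j) (h-bound : ∀ j → j < L → h j < N)
      (κ : Fin 2 → Bool) (hom : ∀ i f → Increasing u f → (∀ j → j < u → f j < L) → Read.bits c i (applyUpTo (h ∘ f) u) ≡ κ i) where

      open Read c

      point : Point → V
      point (a , y) = sequence N s (λ i → h (a + i * δ)) , sequence N s (λ i → h (B + y + i * δ))

      s<W : s < W
      s<W = m≤m+n (suc s) (g₁ + g₂)

      in-range : ∀ {y i} → y ≤ Z → i ≤ s → B + y + i * δ < L
      in-range {y} {i} p q = ≤-<-trans (≤-reflexive (+-assoc B y _)) (+-monoʳ-< B (s≤s (+-mono-≤ p (*-monoˡ-≤ δ (≤-trans q (<⇒≤ s<W))))))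

      in-range₀ : ∀ {a i} → a ≤ Z → i ≤ s → a + i * δ < L
      in-range₀ {a} {i} p q = <-≤-trans (s≤s (+-mono-≤ p (*-monoˡ-≤ δ (≤-trans q (<⇒≤ s<W))))) (m≤m+n B B)

      read₁ : ∀ {a y i} → a ≤ Z → i ≤ s → seq (proj₁ (point (a , y))) i ≡ h (a + i * δ)
      read₁ {a} {y} {i} p q = seq-sequence N s (λ i → h (a + i * δ)) i q (h-bound _ (in-range₀ p q))

      read₂ : ∀ {a y i} → y ≤ Z → i ≤ s → seq (proj₂ (point (a , y))) i ≡ h (B + y + i * δ)
      read₂ {a} {y} {i} p q = seq-sequence N s (λ i → h (B + y + i * δ)) i q (h-bound _ (in-range p q))

      h-injective : ∀ {i j} → i < L → j < L → h i ≡ h j → i ≡ j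
      h-injective = increasing⇒injective h h-mono

      injective : ∀ {p p′} → Bounded p → Bounded p′ → point p ≡ point p′ → p ≡ p′
      injective {a , y} {a′ , y′} (a≤ , y≤) (a′≤ , y′≤) e = cong₂ _,_
        (+-cancelʳ-≡ 0 a a′ (h-injective (in-range₀ {i = 0} a≤ z≤n) (in-range₀ {i = 0} a′≤ z≤n)
          (trans (sym (read₁ {a} {y} a≤ z≤n)) (trans (cong (λ v → seq (proj₁ v) 0) e) (read₁ {a′} {y′} a′≤ z≤n)))))
        (+-cancelˡ-≡ B y y′ (+-cancelʳ-≡ 0 (B + y) (B + y′) (h-injective (in-range {i = 0} y≤ z≤n) (in-range {i = 0} y′≤ z≤n)
          (trans (sym (read₂ {a} {y} y≤ z≤n)) (trans (cong (λ v → seq (proj₂ v) 0) e) (read₂ {a′} {y′} y′≤ z≤n))))))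

      progressions-shift : ∀ g o {a a′ f f′} → (∀ {i} → i ≤ s → f i ≡ h (o + a + i * δ)) → (∀ {i} → i ≤ s → f′ i ≡ h (o + a′ + i * δ)) →
        (∀ {i} → i ≤ s → o + a + i * δ < L) → (∀ {i} → i ≤ s → o + a′ + i * δ < L) → Interleaved g a a′ → Shift g s f f′
      progressions-shift g o {a} {a′} {f} {f′} rf rf′ bd bd′ (lower , upper) = record
        { above = λ i p → subst₂ _<_ (sym (rf p)) (sym (rf′ (≤-trans (m≤m+n i g) p)))
            (h-mono _ _ (<-≤-trans (≤-<-trans (≤-reflexive (eq₁ o a i g δ)) (+-monoˡ-< (i * δ) (+-monoʳ-< o lower))) ≤-refl) (bd′ (≤-trans (m≤m+n i g) p)))
        ; below = λ i p → subst₂ _<_ (sym (rf′ (≤-trans (m≤m+n i g) (<⇒≤ p)))) (sym (rf p))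
            (h-mono _ _ (<-≤-trans (+-monoˡ-< (i * δ) (+-monoʳ-< o upper)) (≤-reflexive (eq₂ o a i g δ))) (bd p)) }
        where
        eq₁ : ∀ o a i g d → o + a + (i + g) * d ≡ o + (a + g * d) + i * d
        eq₁ = solve-∀
        eq₂ : ∀ o a i g d → o + (a + g * d + d) + i * d ≡ o + a + suc (i + g) * d
        eq₂ = solve-∀

      nth-code : ∀ f j → j < u → nth (applyUpTo (h ∘ f) u) j ≡ h (f j)
      nth-code f j p = nth-applyUpTo (h ∘ f) u j p

      constant₁ : ∀ {p p′} → Bounded p → Bounded p′ → Step g₁ p p′ → c (point p) (point p′) ≡ κ zero
      constant₁ {a , y} {a′ , y′} (a≤ , y≤) (a′≤ , y′≤) (I , far) = trans (sym (cong₂ c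
          (cong₂ _,_ (sequence-cong N s λ i p → trans (nth-code f (i + i) (left (X.lower-in i p)))
            (cong h (trans (append-left U (zig X.x X.x′) Y.blocks (X.lower-in i p)) (X.lower-at i))))
            (sequence-cong N s λ i p → trans (nth-code f (U + i) (right (<-≤-trans p (m≤m+n (suc s) (suc s)))))
            (cong h (trans (append-right U (zig X.x X.x′) Y.blocks i) (Y.lower-at i p)))))
          (cong₂ _,_ (sequence-cong N s λ i p → trans (nth-code f (suc ((i + g₁) + (i + g₁))) (left (X.upper-in i p)))
            (cong h (trans (append-left U (zig X.x X.x′) Y.blocks (X.upper-in i p)) (X.upper-at i))))
            (sequence-cong N s λ i p → trans (nth-code f (U + (suc s + i)) (right (+-monoʳ-< (suc s) p)))
            (cong h (trans (append-right U (zig X.x X.x′) Y.blocks (suc s + i)) (Y.upper-at i)))))))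
        (hom zero f (append-increasing U (suc s + suc s) (zig X.x X.x′) Y.blocks X.increasing (Y.increasing 0<δ)
            (λ j p → <-≤-trans (X.bound j p) (≤-trans (m≤m+n B y) (m≤m+n (B + y) 0))))
          (append-bound U (suc s + suc s) (zig X.x X.x′) Y.blocks L (λ j p → <-≤-trans (X.bound j p) (m≤m+n B B))
            (λ j p → <-≤-trans (Y.bound (B + Z) (+-monoʳ-≤ B y≤) (+-monoʳ-≤ B y′≤) j p)
              (≤-trans (≤-reflexive (trans (cong suc (+-assoc B Z (s * δ))) (sym (+-suc B _)))) (+-monoʳ-≤ B (s≤s (+-monoʳ-≤ Z (*-monoˡ-≤ δ (<⇒≤ s<W)))))))))
        where
        module X = Interleave g₁ a a′ (m≤m+n g₁ g₂) a≤ a′≤ I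
        module Y = Blocks (B + y) (B + y′) (≤-<-trans (≤-reflexive (+-assoc B y _)) (+-monoʳ-< B far))
        f : ℕ → ℕ
        f = append U (zig X.x X.x′) Y.blocks
        left : ∀ {j} → j < U → j < u
        left p = <-≤-trans p (m≤m+n U _)
        right : ∀ {j} → j < suc s + suc s → U + j < u
        right p = +-monoʳ-< U p

      constant₂ : ∀ {p p′} → Bounded p → Bounded p′ → Step g₂ (swap p) (swap p′) → c (point p) (point p′) ≡ κ (suc zero)
      constant₂ {a , y} {a′ , y′} (a≤ , y≤) (a′≤ , y′≤) (I , far) = trans (sym (cong₂ c
          (cong₂ _,_ (sequence-cong N s λ i p → trans (nth-code f i (left (<-≤-trans p (m≤m+n (suc s) (suc s)))))
            (cong h (trans (append-left T X.blocks ys (<-≤-trans p (m≤m+n (suc s) (suc s)))) (X.lower-at i p))))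
            (sequence-cong N s λ i p → trans (nth-code f (T + (i + i)) (right (Y.lower-in i p)))
            (cong h (trans (append-right T X.blocks ys (i + i)) (trans (cong (B +_) (Y.lower-at i)) (sym (+-assoc B y _)))))))
          (cong₂ _,_ (sequence-cong N s λ i p → trans (nth-code f (suc s + i) (left (+-monoʳ-< (suc s) p)))
            (cong h (trans (append-left T X.blocks ys (+-monoʳ-< (suc s) p)) (X.upper-at i))))
            (sequence-cong N s λ i p → trans (nth-code f (T + suc ((i + g₂) + (i + g₂))) (right (Y.upper-in i p)))
            (cong h (trans (append-right T X.blocks ys (suc ((i + g₂) + (i + g₂)))) (trans (cong (B +_) (Y.upper-at i)) (sym (+-assoc B y′ _)))))))))
        (hom (suc zero) f (λ j p → append-increasing T U X.blocks ys (X.increasing 0<δ) (λ j q → +-monoʳ-< B (Y.increasing j q))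
            (λ j q → <-≤-trans (blocks-bound j q) (m≤m+n B _)) j (<-≤-trans p (≤-reflexive (+-comm U T))))
          (λ j p → append-bound T U X.blocks ys L (λ j q → <-≤-trans (blocks-bound j q) (m≤m+n B B))
            (λ j q → +-monoʳ-< B (Y.bound j q)) j (<-≤-trans p (≤-reflexive (+-comm U T)))))
        where
        T = suc s + suc s
        module X = Blocks a a′ far
        module Y = Interleave g₂ y y′ (m≤n+m g₂ g₁) y≤ y′≤ I
        ys f : ℕ → ℕ
        ys j = B + zig Y.x Y.x′ j
        f = append T X.blocks ys
        blocks-bound : ∀ j → j < T → X.blocks j < B
        blocks-bound j q = <-≤-trans (X.bound Z a≤ a′≤ j q) (s≤s (+-monoʳ-≤ Z (*-monoˡ-≤ δ (<⇒≤ s<W))))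
        left : ∀ {j} → j < T → j < u
        left p = <-≤-trans p (m≤n+m T U)
        right : ∀ {j} → j < U → T + j < u
        right p = <-≤-trans (+-monoʳ-< T p) (≤-reflexive (+-comm T U))

      embedding : Embedding c
      embedding = record
        { point = point ; injective = injective ; κ₁ = κ zero ; κ₂ = κ (suc zero)
        ; shift₁ = λ {p} {p′} b b′ st → progressions-shift g₁ 0 (λ {i} q → read₁ {y = proj₂ p} (proj₁ b) q) (λ {i} q → read₁ {y = proj₂ p′} (proj₁ b′) q)
            (λ q → in-range₀ (proj₁ b) q) (λ q → in-range₀ (proj₁ b′) q) (proj₁ st) , constant₁ b b′ st
        ; shift₂ = λ {p} {p′} b b′ st → progressions-shift g₂ B (λ {i} q → read₂ {a = proj₁ p} (proj₂ b) q) (λ {i} q → read₂ {a = proj₁ p′} (proj₂ b′) q)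
            (λ q → in-range (proj₂ b) q) (λ q → in-range (proj₂ b′) q) (proj₁ st) , constant₂ b b′ st }

  embedding : 0 < δ → ∀ c → Embedding c
  embedding 0<δ c with h , h-mono , h-bound , κ , hom ← proj₂ ram (Read.bits c) = Build.embedding 0<δ c h h-mono h-bound κ hom

-- Two odd cycles: the base graph

-- A bound for the first coordinates on all paths that follow; `top` is placed beyond it.
extent : ℕ → ℕ → ℕ → ℕ
extent q η e = e + N + suc q * (7 + η) + 1 + (e + (N + N))
  where N = 7 + η + (q + q) + 1

far≤extent : ∀ q η e → e + ((7 + η + (q + q) + 1) + (7 + η + (q + q) + 1)) ≤ extent q η e
far≤extent q η e = m≤n+m _ (e + (7 + η + (q + q) + 1) + suc q * (7 + η) + 1)

rise≤extent : ∀ q η e → e + suc q * (7 + η) + 1 ≤ extent q η e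
rise≤extent q η e = ≤-trans (+-monoˡ-≤ 1 (+-monoˡ-≤ (suc q * (7 + η)) (m≤m+n e (7 + η + (q + q) + 1)))) (m≤m+n _ _)

module Pattern (q q′ η S E top : ℕ) (1≤q : 1 ≤ q) (η≡ : η ≡ suc (3 * q + 3 * q′)) (room : suc q * (5 + η) + q′ ≤ E) (S<E : S < E) where

  private
    δ g g′ N N′ : ℕ
    δ  = 7 + η
    g  = suc q
    g′ = suc q′
    N  = δ + (q + q) + 1
    N′ = δ + (q′ + q′) + 1

  open Progressions δ S
  open Links q (3 * q′) η S 1≤q η≡

  -- Any two of them differ by `N` or `N + N` in the first and by `N′` or `N′ + N′` in the second
  -- coordinate, so each kind of edge provides a path between them.
  A₀ A₁ A₂ : Point
  A₀ = E , E
  A₁ = E + N , E + N′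
  A₂ = E + (N + N) , E + (N′ + N′)

  module Realise (extent< : extent q η E + S < top) (A₂< : E + (N′ + N′) + S < top) (apex< : E + g′ * δ + 1 < top)
    {V : Set} (f : Point → V) (R₁ R₂ : V → V → Set)
    (f-inj : ∀ {u v} → proj₁ u ≤ suc top × proj₂ u ≤ suc top → proj₁ v ≤ suc top × proj₂ v ≤ suc top → f u ≡ f v → u ≡ v)
    (edge₁ : ∀ {u v} → proj₁ u ≤ suc top × proj₂ u ≤ suc top → proj₁ v ≤ suc top × proj₂ v ≤ suc top → Adj₁ g u v → R₁ (f u) (f v))
    (edge₂ : ∀ {u v} → proj₁ u ≤ suc top × proj₂ u ≤ suc top → proj₁ v ≤ suc top × proj₂ v ≤ suc top → Adj₂ g′ u v → R₂ (f u) (f v))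
    (R₁-sym : ∀ {u v} → R₁ u v → R₁ v u) where

    private
      extent<top : extent q η E < top
      extent<top = ≤-<-trans (m≤m+n (extent q η E) S) extent<

      ≤top : ∀ {x} → x ≤ extent q η E → x ≤ suc top
      ≤top p = ≤-trans p (≤-trans (<⇒≤ extent<top) (n≤1+n top))

      module _ {h x y X} (Z : Zigzag g h x y X top) (X≤ : X ≤ extent q η E) where
        open Zigzag Z

        bounded : ∀ {i} → i ≤ h → proj₁ (Link.at link i) ≤ suc top × proj₂ (Link.at link i) ≤ suc top
        bounded p = ≤top (≤-trans (proj₁ (bound _ p)) X≤) , ≤-trans (proj₂ (bound _ p)) (n≤1+n top)

        carry : Link R₁ h (f x) (f y)
        carry = record { at = f ∘ Link.at link ; start = cong f (Link.start link) ; end = cong f (Link.end link)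
          ; inj = λ p p′ e → Link.inj link p p′ (f-inj (bounded p) (bounded p′) e)
          ; step = λ i p → edge₁ (bounded (<⇒≤ p)) (bounded p) (Link.step link i p) }

      E+<top : ∀ {x y} → x ≤ y → E + y + S < top → E + x + S < top
      E+<top p q = ≤-<-trans (+-monoˡ-≤ S (+-monoʳ-≤ E p)) q

      0+<top : E + S < top
      0+<top = ≤-<-trans (+-monoˡ-≤ S (m≤m+n E _)) A₂<

      no-S : ∀ {x} → x + S < top → x < top
      no-S {x} p = ≤-<-trans (m≤m+n x S) p

      S<E+ : ∀ x → S < E + x
      S<E+ x = <-≤-trans S<E (m≤m+n E x)

      q-room : q * (5 + η) ≤ E
      q-room = ≤-trans (≤-trans (m≤n+m (q * (5 + η)) (5 + η)) (m≤m+n _ q′)) room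

      short-room : g * (4 + η) + q′ ≤ E
      short-room = ≤-trans (+-monoˡ-≤ q′ (*-monoʳ-≤ g (n≤1+n (4 + η)))) room

      near : ∀ {x} → x ≤ N + N → E + g * δ + 1 + (E + x) ≤ extent q η E
      near p = +-mono-≤ (+-monoˡ-≤ 1 (+-monoˡ-≤ (g * δ) (m≤m+n E N))) (+-monoʳ-≤ E p)

      g+g≤N : (g + g) + 1 ≤ N + N
      g+g≤N = ≤-trans (≤-trans (≤-reflexive (eq q)) (+-monoˡ-≤ 1 (+-monoˡ-≤ (q + q) (≤-trans (s≤s (s≤s z≤n)) (m≤m+n 7 η))))) (m≤m+n N N)
        where
        eq : ∀ q → (suc q + suc q) + 1 ≡ 2 + (q + q) + 1
        eq = solve-∀

    link₀₁ : Link R₁ (suc (q + q)) (f A₀) (f A₁)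
    link₀₁ = carry (link₁ S<E (S<E+ N′) 0+<top (no-S (E+<top (m≤m+n N′ N′) A₂<)) E q-room) (near (m≤m+n N N))

    link₀₂ : Link R₁ (suc (q + q)) (f A₀) (f A₂)
    link₀₂ = carry (link₂ S<E (S<E+ (N′ + N′)) 0+<top (no-S A₂<) E q-room) (near ≤-refl)

    link₁₂ : Link R₁ (suc (q + q)) (f A₁) (f A₂)
    link₁₂ = subst (λ x → Link R₁ (suc (q + q)) (f A₁) (f (x , E + (N′ + N′)))) (+-assoc E N N)
      (carry (link₁ (S<E+ N′) (S<E+ (N′ + N′)) (E+<top (m≤m+n N′ N′) A₂<) (no-S A₂<) (E + N) (≤-trans q-room (m≤m+n E N)))
        (≤-reflexive (cong (E + N + g * δ + 1 +_) (+-assoc E N N))))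

    -- This settles the case that both kinds of edges have one colour: a path of the first kind
    -- between points with equal second coordinate is closed by a vertex which edges of the second
    -- kind join to both ends.
    mixed-cycle : (∀ {u v} → R₂ u v → R₁ u v) → Copy (Cycle (2 + suc (q + q))) R₁
    mixed-cycle R₂⊆R₁ = apex-cycle R₁-sym (f z) (carry Z (near (m≤m+n N N)))
      (R₂⊆R₁ (edge₂ z-bounded (≤top (≤-trans (m≤m+n E _) E+N≤) , E≤) (inj₂ (rise , 0+<top))))
      (R₂⊆R₁ (edge₂ z-bounded (≤top E+N≤ , E≤) (inj₂ (rise , ≤-<-trans (+-monoˡ-≤ S E+N≤) extent<))))
      λ i p e → contradiction (cong proj₁ (f-inj z-bounded (bounded Z (near (m≤m+n N N)) p) e))
        (<⇒≢ (≤-<-trans (≤-trans (proj₁ (Zigzag.bound Z i p)) (near (m≤m+n N N))) extent<top) ∘ sym)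
      where
      Z : Zigzag g (suc (q + q)) (E , E) (E + N , E) (E + g * δ + 1 + (E + N)) top
      Z = link₁ S<E S<E 0+<top (no-S 0+<top) E q-room
      z : Point
      z = top , E + g′ * δ + 1
      z-bounded : top ≤ suc top × E + g′ * δ + 1 ≤ suc top
      z-bounded = n≤1+n top , ≤-trans (<⇒≤ apex<) (n≤1+n top)
      E+N≤ : E + N ≤ extent q η E
      E+N≤ = ≤-trans (m≤m+n (E + N) (g * δ)) (≤-trans (m≤m+n _ 1) (m≤m+n _ _))
      E≤ : E ≤ suc top
      E≤ = ≤-trans (<⇒≤ (no-S 0+<top)) (n≤1+n top)
      rise : Interleaved g′ E (E + g′ * δ + 1)
      rise = <-by 0 refl , +-monoʳ-< (E + g′ * δ) (s≤s (s≤s z≤n))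

    -- The delay `g` excludes odd cycles only up to length `2q + 3`; a longer one is found among
    -- edges of the first kind alone.
    pure-cycle : q < q′ → q′ ≤ η → Copy (Cycle (2 + suc (q′ + q′))) R₁
    pure-cycle q<q′ q′≤η = apex-cycle R₁-sym (f z) (carry Z X≤)
      (edge₁ z-bounded (≤top (≤-trans (m≤m+n E (N + g * δ + 1)) extent-split) , E≤) (inj₂ (apex-start E (<-trans 0+<top (n<1+n top)))))
      (edge₁ z-bounded (≤top (≤-trans (m≤n+m _ (E + g * δ + 1)) X≤) , E≤) (inj₂ (apex-end (E + (g + g) + 1) (<-trans 0+<top (n<1+n top)))))
      λ i p e → contradiction (cong proj₂ (f-inj z-bounded (bounded Z X≤ p) e)) (<⇒≢ (s≤s (proj₂ (Zigzag.bound Z i p))) ∘ sym)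
      where
      Z : Zigzag g (suc (q′ + q′)) (E , E) (E + (g + g) + 1 , E) (E + g * δ + 1 + (E + (g + g) + 1)) top
      Z = short-link S<E S<E 0+<top (no-S 0+<top) q′ q<q′ q′≤η E short-room
      X≤ : E + g * δ + 1 + (E + (g + g) + 1) ≤ extent q η E
      X≤ = ≤-trans (≤-reflexive (cong (E + g * δ + 1 +_) (+-assoc E (g + g) 1))) (near g+g≤N)
      z : Point
      z = E + (g + g) + 1 + g * δ + 1 , suc top
      z-bounded : E + (g + g) + 1 + g * δ + 1 ≤ suc top × suc top ≤ suc top
      z-bounded = ≤top (≤-trans (≤-trans (m≤n+m _ E) (≤-reflexive (eq E (g + g) (g * δ)))) X≤) , ≤-refl
        where
        eq : ∀ e x y → e + (e + x + 1 + y + 1) ≡ e + y + 1 + (e + x + 1)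
        eq = solve-∀
      E≤ : E ≤ suc top
      E≤ = ≤-trans (<⇒≤ (no-S 0+<top)) (n≤1+n top)
      extent-split : E + (N + g * δ + 1) ≤ extent q η E
      extent-split = ≤-trans (≤-reflexive (eq E N (g * δ))) (m≤m+n _ _)
        where
        eq : ∀ e x y → e + (x + y + 1) ≡ e + x + y + 1
        eq = solve-∀

-- A vertex is a pair of sequences; red edges shift the first and blue edges the second one.
module OddOdd (q q′ M s η O top : ℕ) (1≤q : 1 ≤ q) (1≤q′ : 1 ≤ q′) (η≡ : η ≡ suc (3 * q + 3 * q′))
  (M-large : suc (suc ((suc q + suc q′) + (suc q + suc q′))) * suc (suc q + suc q′) ≤ M) (s-large : M + M ≤ s)
  (room : suc q * (5 + η) + q′ ≤ O) (room′ : suc q′ * (5 + η) + q ≤ O) (S<O : s * (7 + η) < O)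
  (top-large : extent q η O + extent q′ η O + s * (7 + η) < top) where

  private
    g g′ S : ℕ
    g  = suc q
    g′ = suc q′
    S  = s * (7 + η)

    η≡′ : η ≡ suc (3 * q′ + 3 * q)
    η≡′ = trans η≡ (cong suc (+-comm (3 * q) (3 * q′)))

    module P  = Pattern q q′ η S O top 1≤q η≡ room S<O
    module P′ = Pattern q′ q η S O top 1≤q′ η≡′ room′ S<O

    ext< : ∀ {y} → y ≤ extent q η O → y + S < top
    ext< p = ≤-<-trans (+-monoˡ-≤ S (≤-trans p (m≤m+n _ (extent q′ η O)))) top-large

    ext′< : ∀ {y} → y ≤ extent q′ η O → y + S < top
    ext′< p = ≤-<-trans (+-monoˡ-≤ S (≤-trans p (m≤n+m _ (extent q η O)))) top-large

    drop-S : ∀ {y} → y + S < top → y < top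
    drop-S {y} p = ≤-<-trans (m≤m+n y S) p

  open Progressions (7 + η) S
  open Homogeneity g g′ s (7 + η) (suc top)

  private
    V-finite : Finite V
    V-finite = finite-× (finite-Vec (finite-Fin _) _) (finite-Vec (finite-Fin _) _)

    shift? : ∀ k x y → Dec (Shift k s (seq {N} {s} x) (seq {N} {s} y))
    shift? k x y = map′ (λ (up , down) → record
        { above = λ i p → from (λ i → i + k ≤ s → seq x (i + k) < seq y i) (m≤m+n i k) up p p
        ; below = λ i p → from (λ i → suc (i + k) ≤ s → seq y i < seq x (suc (i + k))) (≤-trans (m≤m+n i k) (n≤1+n _)) down p p })
      (λ T → (λ i → Shift.above T (toℕ i)) , λ i → Shift.below T (toℕ i))
      (Fin.all? (λ i → (toℕ i + k ≤? s) →-dec (seq x (toℕ i + k) <? seq y (toℕ i)))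
        ×-dec Fin.all? (λ i → (suc (toℕ i + k) ≤? s) →-dec (seq y (toℕ i) <? seq x (suc (toℕ i + k)))))
      where
      from : ∀ (Q : ℕ → Set) {m i} → i ≤ m → (∀ (j : Fin (suc s)) → Q (toℕ j)) → m ≤ s → Q i
      from Q i≤m all m≤s = subst Q (Fin.toℕ-fromℕ< (s≤s (≤-trans i≤m m≤s))) (all (fromℕ< (s≤s (≤-trans i≤m m≤s))))

    Close : ℕ → Seq N s → Seq N s → Set
    Close k x y = Shift k s (seq x) (seq y) ⊎ Shift k s (seq y) (seq x)

    close? : ∀ k x y → Dec (Close k x y)
    close? k x y = shift? k x y ⊎-dec shift? k y x

    close-sym : ∀ k x y → Close k x y → Close k y x
    close-sym k x y = [ inj₂ , inj₁ ]′

    no-closed-walk : ∀ k a (π : V → Seq N s) → a ≤ k → k ≤ g + g′ → ¬ ClosedWalk (λ u v → Close k (π u) (π v)) (suc (a + a))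
    no-closed-walk k a π a≤k k≤ = odd-girth (λ v → seq (π v)) k M s a a≤k size-≤ (≤-trans (+-monoʳ-≤ M size-≤) s-large)
      where
      size-≤ : suc (suc (a + a)) * suc k ≤ M
      size-≤ = ≤-trans (*-mono-≤ (s≤s (s≤s (+-mono-≤ (≤-trans a≤k k≤) (≤-trans a≤k k≤)))) (s≤s k≤)) M-large

    close-irrefl : ∀ k {x} → k ≤ g + g′ → ¬ Close k x x
    close-irrefl k {x} k≤ c = no-closed-walk k 0 (λ _ → x) z≤n k≤ record { at = λ _ → x , x ; step = λ _ _ → c ; close = refl }

    r b A : V → V → Set
    r u v = Close g (proj₁ u) (proj₁ v)
    b u v = Close g′ (proj₂ u) (proj₂ v)
    A u v = r u v ⊎ b u v

    r? : ∀ u v → Dec (r u v)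
    r? u v = close? g (proj₁ u) (proj₁ v)

    A-sym : ∀ {u v} → A u v → A v u
    A-sym {u} {v} (inj₁ e) = inj₁ (close-sym g (proj₁ u) (proj₁ v) e)
    A-sym {u} {v} (inj₂ e) = inj₂ (close-sym g′ (proj₂ u) (proj₂ v) e)

    A-irrefl : ∀ {v} → ¬ A v v
    A-irrefl {v} (inj₁ e) = close-irrefl g {proj₁ v} (m≤m+n g g′) e
    A-irrefl {v} (inj₂ e) = close-irrefl g′ {proj₂ v} (m≤n+m g′ g) e

    good : V → V → Bool
    good u v = ⌊ r? u v ⌋

    good-sym : ∀ u v → good u v ≡ good v u
    good-sym u v = by-dec (r? u v)
      where
      by-dec : Dec (r u v) → good u v ≡ good v u
      by-dec (yes e) = trans (⇒does (r? u v) e) (sym (⇒does (r? v u) (close-sym g (proj₁ u) (proj₁ v) e)))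
      by-dec (no ¬e) = trans (⇒¬does (r? u v) ¬e) (sym (⇒¬does (r? v u) (¬e ∘ close-sym g (proj₁ v) (proj₁ u))))

    no-cycle : ∀ k (π : V → Seq N s) p → k ≡ suc p → k ≤ g + g′ → ¬ Copy (Cycle (2 + suc (p + p))) (λ u v → Close k (π u) (π v))
    no-cycle k π p refl k≤ cp = no-closed-walk k k π ≤-refl k≤
      (subst (ClosedWalk (λ u v → Close k (π u) (π v))) (cong (λ x → 2 + x) (sym (+-suc p p))) (cycle-walk (2 + (p + p)) (s≤s z≤n) cp))

    no-red : ¬ Copy (Cycle (2 + suc (q + q))) (A ∧ᶜ good ≐ true)
    no-red cp = no-cycle g proj₁ q refl (m≤m+n g g′) (copy-map id id (λ u v (_ , e) → does⇒ (r? u v) e) cp)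

    no-blue : ¬ Copy (Cycle (2 + suc (q′ + q′))) (A ∧ᶜ good ≐ false)
    no-blue cp = no-cycle g′ proj₂ q′ refl (m≤n+m g′ g) (copy-map id id only-b cp)
      where
      only-b : ∀ u v → (A ∧ᶜ good ≐ false) u v → b u v
      only-b u v (inj₁ e , c) = contradiction (trans (sym (⇒does (r? u v) e)) c) λ ()
      only-b u v (inj₂ e , _) = e

  private module _ (c : V ⊎ Vec V 3 → V ⊎ Vec V 3 → Bool) (c-sym : ∀ x y → c x y ≡ c y x) where

    cᵛ : V → V → Bool
    cᵛ u v = c (inj₁ u) (inj₁ v)
    R : Bool → V ⊎ Vec V 3 → V ⊎ Vec V 3 → Set
    R κ = Attach A Vec.lookup ∧ᶜ c ≐ κ

    Result : Set
    Result = Copy (Cycle (2 + suc (q + q))) (R true) ⊎ Copy (Cycle (2 + suc (q′ + q′))) (R false)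

    module Cases (H : Embedding cᵛ) where
      open Embedding H

      Rᵛ : Bool → V → V → Set
      Rᵛ κ = A ∧ᶜ cᵛ ≐ κ

      Rᵛ-sym : ∀ κ {u v} → Rᵛ κ u v → Rᵛ κ v u
      Rᵛ-sym κ {u} {v} (a , e) = A-sym {u} {v} a , trans (c-sym (inj₁ v) (inj₁ u)) e

      edge₁ : ∀ {u v} → Bounded u → Bounded v → Adj₁ g u v → Rᵛ κ₁ (point u) (point v)
      edge₁ {u} {v} bu bv (inj₁ st) = let T = shift₁ {u} {v} bu bv st in inj₁ (inj₁ (proj₁ T)) , proj₂ T
      edge₁ {u} {v} bu bv (inj₂ st) = let T = shift₁ {v} {u} bv bu st in
        inj₁ (inj₂ (proj₁ T)) , trans (c-sym (inj₁ (point u)) (inj₁ (point v))) (proj₂ T)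

      edge₂ : ∀ {u v} → Bounded u → Bounded v → Adj₂ g′ u v → Rᵛ κ₂ (point u) (point v)
      edge₂ {u} {v} bu bv (inj₁ st) = let T = shift₂ {u} {v} bu bv st in inj₂ (inj₁ (proj₁ T)) , proj₂ T
      edge₂ {u} {v} bu bv (inj₂ st) = let T = shift₂ {v} {u} bv bu st in
        inj₂ (inj₂ (proj₁ T)) , trans (c-sym (inj₁ (point u)) (inj₁ (point v))) (proj₂ T)

      flip-bounded : ∀ {u} → Bounded u → Bounded (swap u)
      flip-bounded (p , p′) = p′ , p

      module K₁ = P.Realise (ext< ≤-refl) (ext′< (far≤extent q′ η O)) (drop-S (ext′< (rise≤extent q′ η O))) point (Rᵛ κ₁) (Rᵛ κ₂)
        (λ {u} {v} → injective {u} {v}) (λ {u} {v} → edge₁ {u} {v}) (λ {u} {v} → edge₂ {u} {v}) (λ {u} {v} → Rᵛ-sym κ₁ {u} {v})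
      module K₂ = P′.Realise (ext′< ≤-refl) (ext< (far≤extent q η O)) (drop-S (ext< (rise≤extent q η O))) (point ∘ swap) (Rᵛ κ₂) (Rᵛ κ₁)
        (λ {u} {v} p p′ e → cong swap (injective {swap u} {swap v} (flip-bounded {u} p) (flip-bounded {v} p′) e))
        (λ {u} {v} p p′ → edge₂ {swap u} {swap v} (flip-bounded {u} p) (flip-bounded {v} p′))
        (λ {u} {v} p p′ → edge₁ {swap u} {swap v} (flip-bounded {u} p) (flip-bounded {v} p′)) (λ {u} {v} → Rᵛ-sym κ₂ {u} {v})

      extend : ∀ k {κ} → Copy (Cycle k) (Rᵛ κ) → Copy (Cycle k) (R κ)
      extend k = copy-map inj₁ inj₁-injective (λ _ _ → id)

      record Links₃ (κ : Bool) (h : ℕ) : Set where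
        constructor links
        field
          ℓ₀₁ : Link (Rᵛ κ) h (point P.A₀) (point P.A₁)
          ℓ₀₂ : Link (Rᵛ κ) h (point P.A₀) (point P.A₂)
          ℓ₁₂ : Link (Rᵛ κ) h (point P.A₁) (point P.A₂)

      links₁ : Links₃ κ₁ (suc (q + q))
      links₁ = links K₁.link₀₁ K₁.link₀₂ K₁.link₁₂

      links₂ : Links₃ κ₂ (suc (q′ + q′))
      links₂ = links K₂.link₀₁ K₂.link₀₂ K₂.link₁₂

      w : Vec V 3
      w = point P.A₀ ∷ point P.A₁ ∷ point P.A₂ ∷ []

      close-up : ∀ {κ h} → Links₃ κ h → ∀ i j → Link (Rᵛ κ) h (Vec.lookup w i) (Vec.lookup w j) →
        c (inj₂ w) (inj₁ (Vec.lookup w i)) ≡ κ → c (inj₂ w) (inj₁ (Vec.lookup w j)) ≡ κ → Copy (Cycle (2 + h)) (R κ)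
      close-up _ i j ℓ ei ej = linked-neighbours {A = A} (λ {u} {v} → A-sym {u} {v}) c-sym w i j ℓ ei ej

      -- Two of the three edges at `w` agree, and the path of their colour between the ends closes
      -- the cycle.
      by-triple : Links₃ true (suc (q + q)) → Links₃ false (suc (q′ + q′)) → Result
      by-triple T F = go (c (inj₂ w) (inj₁ (Vec.lookup w zero))) refl (c (inj₂ w) (inj₁ (Vec.lookup w (suc zero)))) refl
          (c (inj₂ w) (inj₁ (Vec.lookup w (suc (suc zero))))) refl
        where
        go : ∀ x → c (inj₂ w) (inj₁ (Vec.lookup w zero)) ≡ x → ∀ y → c (inj₂ w) (inj₁ (Vec.lookup w (suc zero))) ≡ y →
          ∀ z → c (inj₂ w) (inj₁ (Vec.lookup w (suc (suc zero)))) ≡ z → Result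
        go true  x true  y _     z = inj₁ (close-up T zero (suc zero) (Links₃.ℓ₀₁ T) x y)
        go false x false y _     z = inj₂ (close-up F zero (suc zero) (Links₃.ℓ₀₁ F) x y)
        go true  x false y true  z = inj₁ (close-up T zero (suc (suc zero)) (Links₃.ℓ₀₂ T) x z)
        go true  x false y false z = inj₂ (close-up F (suc zero) (suc (suc zero)) (Links₃.ℓ₁₂ F) y z)
        go false x true  y true  z = inj₁ (close-up T (suc zero) (suc (suc zero)) (Links₃.ℓ₁₂ T) y z)
        go false x true  y false z = inj₂ (close-up F zero (suc (suc zero)) (Links₃.ℓ₀₂ F) x z)

      q≤η : q ≤ η
      q≤η = subst (q ≤_) (sym η≡) (≤-trans (m≤m+n q _) (≤-trans (m≤m+n (3 * q) (3 * q′)) (n≤1+n _)))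

      q′≤η : q′ ≤ η
      q′≤η = subst (q′ ≤_) (sym η≡) (≤-trans (m≤m+n q′ _) (≤-trans (m≤n+m (3 * q′) (3 * q)) (n≤1+n _)))

      result : Result
      result = go κ₁ refl κ₂ refl
        where
        go : ∀ x → κ₁ ≡ x → ∀ y → κ₂ ≡ y → Result
        go true e true e′ = inj₁ (extend (2 + suc (q + q)) (subst (λ κ → Copy (Cycle (2 + suc (q + q))) (Rᵛ κ)) e
          (K₁.mixed-cycle λ {u} {v} → subst (λ κ → Rᵛ κ u v) (trans e′ (sym e)))))
        go false e false e′ = inj₂ (extend (2 + suc (q′ + q′)) (subst (λ κ → Copy (Cycle (2 + suc (q′ + q′))) (Rᵛ κ)) e′
          (K₂.mixed-cycle λ {u} {v} → subst (λ κ → Rᵛ κ u v) (trans e (sym e′)))))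
        go true e false e′ = by-triple (subst (λ κ → Links₃ κ (suc (q + q))) e links₁) (subst (λ κ → Links₃ κ (suc (q′ + q′))) e′ links₂)
        -- The colours come out interchanged. For different lengths, the kind of edge with the
        -- smaller delay contains the longer cycle, and its colour is now the one in which that
        -- cycle is wanted.
        go false e true e′ = by-length (<-cmp q q′)
          where
          by-length : _ → Result
          by-length (tri< q<q′ _ _) = inj₂ (extend (2 + suc (q′ + q′)) (subst (λ κ → Copy (Cycle (2 + suc (q′ + q′))) (Rᵛ κ)) e (K₁.pure-cycle q<q′ q′≤η)))
          by-length (tri≈ _ q≡q′ _) = by-triple (subst₂ Links₃ e′ (cong (λ x → suc (x + x)) (sym q≡q′)) links₂)
            (subst₂ Links₃ e (cong (λ x → suc (x + x)) q≡q′) links₁)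
          by-length (tri> _ _ q′<q) = inj₁ (extend (2 + suc (q + q)) (subst (λ κ → Copy (Cycle (2 + suc (q + q))) (Rᵛ κ)) e′ (K₂.pure-cycle q′<q q≤η)))

    forced : Result
    forced = Cases.result (embedding (s≤s z≤n) cᵛ)

  base : Base (Cycle (2 + suc (q + q))) (Cycle (2 + suc (q′ + q′))) 3
  base = record { V-finite = V-finite ; A = A ; A? = λ u v → r? u v ⊎-dec close? g′ (proj₂ u) (proj₂ v)
    ; A-sym = λ {u} {v} → A-sym {u} {v} ; A-irrefl = λ {v} → A-irrefl {v} ; good = good ; good-sym = good-sym ; good₁ = no-red ; good₂ = no-blue ; forced = forced }

-- A constant is handed on as a variable known only to exceed `x`, which is all that the estimates
-- use and keeps large terms from unfolding.
above : ∀ {A : Set₁} x → (∀ y → x < y → A) → A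
above x k = k (suc x) ≤-refl

odd-odd-base : ∀ q q′ → 1 ≤ q → 1 ≤ q′ → Base (Cycle (2 + suc (q + q))) (Cycle (2 + suc (q′ + q′))) 3
odd-odd-base q q′ 1≤q 1≤q′ =
  above (suc (suc ((suc q + suc q′) + (suc q + suc q′))) * suc (suc q + suc q′)) λ M M> →
  above (M + M) λ s s> →
  with-η λ η η≡ →
  above (s * (7 + η) + ((suc q * (5 + η) + q′) + (suc q′ * (5 + η) + q))) λ O O> →
  above (extent q η O + extent q′ η O + s * (7 + η)) λ top top> →
  OddOdd.base q q′ M s η O top 1≤q 1≤q′ η≡ (<⇒≤ M>) (<⇒≤ s>)
    (≤-trans (≤-trans (m≤m+n _ (suc q′ * (5 + η) + q)) (m≤n+m _ (s * (7 + η)))) (<⇒≤ O>))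
    (≤-trans (≤-trans (m≤n+m _ (suc q * (5 + η) + q′)) (m≤n+m _ (s * (7 + η)))) (<⇒≤ O>))
    (≤-<-trans (m≤m+n (s * (7 + η)) _) O>) top>
  where
  with-η : ∀ {A : Set₁} → (∀ η → η ≡ suc (3 * q + 3 * q′) → A) → A
  with-η k = k _ refl

-- Parity of the cycle lengths and assembly of the cases

data CycleLength : ℕ → Set where
  even-length : ∀ M → 1 ≤ M → CycleLength (suc M + suc M)
  odd-length  : ∀ p → 1 ≤ p → CycleLength (2 + suc (p + p))

cycle-length : ∀ {k} → 4 ≤ k → CycleLength k
cycle-length {k} 4≤k = by-half (half k) 4≤k
  where
  by-half : ∀ {k} → Half k → 4 ≤ k → CycleLength k
  by-half (even (suc (suc M))) _ = even-length (suc M) (s≤s z≤n)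
  by-half (even (suc zero)) (s≤s (s≤s ()))
  by-half (odd (suc (suc p))) _ = subst CycleLength (cong (λ x → 2 + x) (sym (+-suc (suc p) (suc p)))) (odd-length (suc p) (s≤s z≤n))
  by-half (odd zero) (s≤s ())
  by-half (odd (suc zero)) (s≤s (s≤s (s≤s ())))

cycle-gadget : ∀ {k ℓ} → CycleLength k → CycleLength ℓ → Gadget (Cycle k) (Cycle ℓ) 3
cycle-gadget (even-length M 1≤M) (even-length M′ 1≤M′) = gadget (EvenEven.base M M′ 1≤M 1≤M′)
cycle-gadget (even-length M 1≤M) (odd-length q 1≤q)    = gadget (EvenOdd.base M q 1≤M 1≤q)
cycle-gadget (odd-length q 1≤q)  (even-length M 1≤M)   = swap-gadget (gadget (EvenOdd.base M q 1≤M 1≤q))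
cycle-gadget (odd-length q 1≤q)  (odd-length q′ 1≤q′)  = gadget (odd-odd-base q q′ 1≤q 1≤q′)

-- The general construction for odd cycles works with three classes, that is, with `m ≥ 3`; the
-- triangle has its own.
complete-cycle-gadget : ∀ m {ℓ} → 2 ≤ m → CycleLength ℓ → Gadget (Complete (suc m)) (Cycle ℓ) (2 * m)
complete-cycle-gadget m 2≤m (even-length M 1≤M) = gadget (CompleteEven.base m M 1≤M)
complete-cycle-gadget m 2≤m (odd-length p 1≤p) = by-size (m≤n⇒m<n∨m≡n 2≤m)
  where
  by-size : 2 < m ⊎ 2 ≡ m → Gadget (Complete (suc m)) (Cycle (2 + suc (p + p))) (2 * m)
  by-size (inj₁ 3≤m)  = gadget (CompleteOdd.base m p 3≤m 1≤p)
  by-size (inj₂ refl) = gadget (TriangleOdd.base p 1≤p)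

theorem1p2 : (t k ℓ : ℕ) → 3 ≤ t → 4 ≤ k → 4 ≤ ℓ →
  sIs 2 (pair (Cycle k) (Cycle ℓ)) 3 ×
  sIs 2 (pair (Complete t) (Cycle ℓ)) (2 * (t ∸ 1))
theorem1p2 (suc (suc m)) (suc k) (suc ℓ) (s≤s 2≤t) 4≤k@(s≤s 3≤k) 4≤ℓ@(s≤s 3≤ℓ) =
  sIs-from (cycle-gadget (cycle-length 4≤k) (cycle-length 4≤ℓ)) (cycle-noIsolated k (<⇒≤ (<⇒≤ 3≤k))) (cycle-noIsolated ℓ (<⇒≤ (<⇒≤ 3≤ℓ)))
    (cycle-lower k ℓ (<⇒≤ 3≤k) (<⇒≤ 3≤ℓ)) ,
  sIs-from (complete-cycle-gadget (suc m) 2≤t (cycle-length 4≤ℓ)) (complete-noIsolated m) (cycle-noIsolated ℓ (<⇒≤ (<⇒≤ 3≤ℓ)))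
    (complete-cycle-lower (suc m) ℓ 2≤t (<⇒≤ 3≤ℓ))
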